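{- Let $q$ be a prime power and $n$ a positive integer. Except in the case $q = 2$ and $n = 1$, $$\prod_{\substack{p \in \mathcal{I}_q \\ \deg p \le n}} \left(1 - \frac{1}{\|p\|}\right) > \frac{1}{e^{\gamma}(n+1)}.$$
   Context: $\mathcal{I}_q$ is the set of monic irreducible polynomials in $\mathbb{F}_q[x]$, $\|p\| = q^{\deg p}$, and $\gamma$ is the Euler–Mascheroni constant. -}

module Defs where

open import Algebra.Bundles using (CommutativeRing; RawSemiring)
open import Algebra.Definitions using (Invertible)
open import Algebra.Definitions.RawMagma using (_,_)
import Algebra.Definitions.RawSemiring as RawSemiringDefs
open import Data.Empty using (⊥-elim)
open import Data.Fin.Base using (Fin)
import Data.Fin.Properties as Fin
open import Data.Integer.Base as ℤ using (ℤ)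
import Data.Integer.Properties as ℤ
open import Data.List.Base using (List; []; _∷_; [_]; _++_; map; foldr; filter; concatMap; cartesianProductWith; allFin; upTo)
open import Data.List.Membership.Propositional using (_∈_; lose; find)
open import Data.List.Membership.Propositional.Properties using (∈-map⁺; ∈-cartesianProductWith⁺; ∈-allFin; ∈-concatMap⁺; ∈-upTo⁺)
open import Data.List.Relation.Unary.Any using (Any; any?; here)
open import Data.Nat.Base as ℕ using (ℕ; zero; suc; z≤n; s≤s)
import Data.Nat.Coprimality as Coprimality
open import Data.Nat.Primality using (Prime)
import Data.Nat.Properties as ℕ
open import Data.Product.Base using (∃-syntax; _×_; _,_; proj₁; proj₂)
open import Data.Rational.Base as ℚ using (ℚ; mkℚ; 0ℚ; 1ℚ; ½)
import Data.Rational.Properties as ℚ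
open import Data.Rational.Solver using (module +-*-Solver)
open import Data.Sum.Base using (_⊎_; inj₁; inj₂)
open import Data.Vec.Base using (Vec; []; _∷_; toList)
open import Function.Base using (_∘_)
open import Function.Bundles using (Inverse)
open import Level using (Level) renaming (suc to lsuc; _⊔_ to _⊔ˡ_)
open import Relation.Binary.Definitions using (tri<; tri≈; tri>)
open import Relation.Binary.PropositionalEquality as ≡ using (_≡_)
import Relation.Binary.Reasoning.Setoid as SetoidReasoning
open import Relation.Nullary using (¬_; Dec; yes; no)
open import Relation.Nullary.Decidable using (map′; _×-dec_)

PrimePower : ℕ → Set
PrimePower q = ∃[ p ] ∃[ k ] Prime p × 1 ℕ.≤ k × q ≡ p ℕ.^ k

record FiniteField (c ℓ : Level) (q : ℕ) : Set (lsuc (c ⊔ˡ ℓ)) where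
  field
    commutativeRing : CommutativeRing c ℓ
  open CommutativeRing commutativeRing public
  field
    1≉0         : ¬ 1# ≈ 0#
    invertible  : ∀ x → ¬ x ≈ 0# → Invertible _≈_ 1# _*_ x
    enumeration : Inverse setoid (≡.setoid (Fin q))

module Polynomials {c ℓ : Level} {q : ℕ} (F : FiniteField c ℓ q) where

  open FiniteField F

  -- Coefficient lists, constant term first. Trailing zeros are allowed,
  -- so equality compares all coefficients.
  Poly : Set c
  Poly = List Carrier

  coeff : Poly → ℕ → Carrier
  coeff []      _       = 0#
  coeff (a ∷ p) zero    = a
  coeff (a ∷ p) (suc i) = coeff p i

  infix  4 _≈ₚ_
  infixl 6 _+ₚ_
  infixl 7 _*ₚ_

  _≈ₚ_ : Poly → Poly → Set ℓ
  p ≈ₚ r = ∀ i → coeff p i ≈ coeff r i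

  _+ₚ_ : Poly → Poly → Poly
  []      +ₚ r       = r
  (a ∷ p) +ₚ []      = a ∷ p
  (a ∷ p) +ₚ (b ∷ r) = a + b ∷ p +ₚ r

  _*ₚ_ : Poly → Poly → Poly
  []      *ₚ r = []
  (a ∷ p) *ₚ r = map (a *_) r +ₚ (0# ∷ p *ₚ r)

  polyRawSemiring : RawSemiring c ℓ
  polyRawSemiring = record
    { Carrier = Poly ; _≈_ = _≈ₚ_ ; _+_ = _+ₚ_ ; _*_ = _*ₚ_ ; 0# = [] ; 1# = [ 1# ] }

  open RawSemiringDefs polyRawSemiring public using (Irreducible; mkIrred)
  open RawSemiringDefs polyRawSemiring using (_∣_)

  record MonicPoly : Set c where
    constructor monic
    field
      deg   : ℕ
      lower : Vec Carrier deg

    -- xᵈ + a_{d-1} xᵈ⁻¹ + … + a₀, where lower = a₀ ∷ … ∷ a_{d-1} ∷ []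
    poly : Poly
    poly = toList lower ++ [ 1# ]

  open MonicPoly public

  -- Each list below has every element exactly once: the coefficients are
  -- the representatives listed in elements, so no two entries are ≈ₚ.
  elements : List Carrier
  elements = map (Inverse.from enumeration) (allFin q)

  vectors : (d : ℕ) → List (Vec Carrier d)
  vectors zero    = [ [] ]
  vectors (suc d) = cartesianProductWith _∷_ elements (vectors d)

  monicsOfDegree : ℕ → List MonicPoly
  monicsOfDegree d = map (monic d) (vectors d)

  monics≤ : ℕ → List MonicPoly
  monics≤ n = concatMap monicsOfDegree (upTo (suc n))

  open SetoidReasoning setoid

  to : Carrier → Fin q
  to = Inverse.to enumeration

  from : Fin q → Carrier
  from = Inverse.from enumeration

  from∘to : ∀ x → from (to x) ≈ x
  from∘to x = Inverse.inverseʳ enumeration ≡.refl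

  infix 4 _≈?_
  _≈?_ : ∀ x y → Dec (x ≈ y)
  x ≈? y = map′ (λ e → trans (sym (from∘to x)) (trans (reflexive (≡.cong from e)) (from∘to y)))
                (Inverse.to-cong enumeration) (to x Fin.≟ to y)

  inv : ∀ {x} → ¬ x ≈ 0# → Carrier
  inv x≉0 = proj₁ (invertible _ x≉0)

  invˡ : ∀ {x} (x≉0 : ¬ x ≈ 0#) → inv x≉0 * x ≈ 1#
  invˡ x≉0 = proj₁ (proj₂ (invertible _ x≉0))

  *-nonzero : ∀ {x y} → ¬ x ≈ 0# → ¬ y ≈ 0# → ¬ x * y ≈ 0#
  *-nonzero {x} {y} x≉0 y≉0 xy≈0 = y≉0 (begin
    y                    ≈⟨ *-identityˡ y ⟨
    1# * y               ≈⟨ *-congʳ (invˡ x≉0) ⟨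
    inv x≉0 * x * y      ≈⟨ *-assoc _ _ _ ⟩
    inv x≉0 * (x * y)    ≈⟨ *-congˡ xy≈0 ⟩
    inv x≉0 * 0#         ≈⟨ zeroʳ _ ⟩
    0#                   ∎)

  conv : (ℕ → Carrier) → (ℕ → Carrier) → ℕ → Carrier
  conv f g zero    = f 0 * g 0
  conv f g (suc i) = f 0 * g (suc i) + conv (f ∘ suc) g i

  conv-cong : ∀ {f f′ g g′} → (∀ i → f i ≈ f′ i) → (∀ i → g i ≈ g′ i) → ∀ i → conv f g i ≈ conv f′ g′ i
  conv-cong ff gg zero    = *-cong (ff 0) (gg 0)
  conv-cong ff gg (suc i) = +-cong (*-cong (ff 0) (gg (suc i))) (conv-cong (ff ∘ suc) gg i)

  conv-zeroˡ : ∀ {f g} → (∀ i → f i ≈ 0#) → ∀ i → conv f g i ≈ 0#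
  conv-zeroˡ f0 zero    = trans (*-congʳ (f0 0)) (zeroˡ _)
  conv-zeroˡ f0 (suc i) = trans (+-cong (trans (*-congʳ (f0 0)) (zeroˡ _)) (conv-zeroˡ (f0 ∘ suc) i)) (+-identityˡ 0#)

  conv-zeroʳ : ∀ {f g} → (∀ i → g i ≈ 0#) → ∀ i → conv f g i ≈ 0#
  conv-zeroʳ g0 zero    = trans (*-congˡ (g0 0)) (zeroʳ _)
  conv-zeroʳ g0 (suc i) = trans (+-cong (trans (*-congˡ (g0 (suc i))) (zeroʳ _)) (conv-zeroʳ g0 i)) (+-identityˡ 0#)

  conv-scaleˡ : ∀ {f g} u i → conv (λ j → u * f j) g i ≈ u * conv f g i
  conv-scaleˡ u zero    = *-assoc _ _ _
  conv-scaleˡ u (suc i) = trans (+-cong (*-assoc _ _ _) (conv-scaleˡ u i)) (sym (distribˡ _ _ _))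

  swap : ∀ a w b → a * (w * b) ≈ w * (a * b)
  swap a w b = trans (sym (*-assoc _ _ _)) (trans (*-congʳ (*-comm a w)) (*-assoc _ _ _))

  conv-scaleʳ : ∀ {f g} w i → conv f (λ j → w * g j) i ≈ w * conv f g i
  conv-scaleʳ w zero    = swap _ _ _
  conv-scaleʳ w (suc i) = trans (+-cong (swap _ _ _) (conv-scaleʳ w i)) (sym (distribˡ _ _ _))

  coeff-+ : ∀ p r i → coeff (p +ₚ r) i ≈ coeff p i + coeff r i
  coeff-+ []      r       i       = sym (+-identityˡ _)
  coeff-+ (a ∷ p) []      i       = sym (+-identityʳ _)
  coeff-+ (a ∷ p) (b ∷ r) zero    = refl
  coeff-+ (a ∷ p) (b ∷ r) (suc i) = coeff-+ p r i

  coeff-scale : ∀ u p i → coeff (map (u *_) p) i ≈ u * coeff p i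
  coeff-scale u []      i       = sym (zeroʳ u)
  coeff-scale u (a ∷ p) zero    = refl
  coeff-scale u (a ∷ p) (suc i) = coeff-scale u p i

  coeff-* : ∀ p r i → coeff (p *ₚ r) i ≈ conv (coeff p) (coeff r) i
  coeff-* []      r i       = sym (conv-zeroˡ (λ _ → refl) i)
  coeff-* (a ∷ p) r zero    = trans (coeff-+ (map (a *_) r) _ 0)
    (trans (+-cong (coeff-scale a r 0) refl) (+-identityʳ _))
  coeff-* (a ∷ p) r (suc i) = trans (coeff-+ (map (a *_) r) _ (suc i))
    (+-cong (coeff-scale a r (suc i)) (coeff-* p r i))

  Below : ℕ → (ℕ → Carrier) → Set ℓ
  Below m f = ∀ i → m ℕ.≤ i → f i ≈ 0#

  conv-top : ∀ m n f g → Below (suc m) f → Below (suc n) g → conv f g (m ℕ.+ n) ≈ f m * g n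
  conv-top zero    zero    f g bf bg = refl
  conv-top zero    (suc n) f g bf bg =
    trans (+-congˡ (conv-zeroˡ (λ i → bf (suc i) (s≤s z≤n)) n)) (+-identityʳ _)
  conv-top (suc m) n       f g bf bg = trans
    (+-cong (trans (*-congˡ (bg _ (s≤s (ℕ.m≤n+m n m)))) (zeroʳ _))
            (conv-top m n (f ∘ suc) g (λ i le → bf (suc i) (s≤s le)) bg))
    (+-identityˡ _)

  conv-below : ∀ m n f g → Below (suc m) f → Below (suc n) g → Below (suc (m ℕ.+ n)) (conv f g)
  conv-below zero n f g bf bg (suc i) le = trans
    (+-cong (trans (*-congˡ (bg _ le)) (zeroʳ _)) (conv-zeroˡ (λ j → bf (suc j) (s≤s z≤n)) i)) (+-identityˡ 0#)
  conv-below (suc m) n f g bf bg (suc i) (s≤s le) = trans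
    (+-cong (trans (*-congˡ (bg _ (s≤s (ℕ.≤-trans (ℕ.m≤n+m n (suc m)) le)))) (zeroʳ _))
            (conv-below m n (f ∘ suc) g (λ j l → bf (suc j) (s≤s l)) bg i le))
    (+-identityˡ 0#)

  record HasDegree (p : Poly) (m : ℕ) : Set ℓ where
    constructor hasDegree
    field
      below : Below (suc m) (coeff p)
      lead  : ¬ coeff p m ≈ 0#

  degree? : ∀ p → (∀ i → coeff p i ≈ 0#) ⊎ (∃[ m ] HasDegree p m)
  degree? []      = inj₁ (λ _ → refl)
  degree? (a ∷ p) with degree? p
  ... | inj₂ (m , hasDegree b l) = inj₂ (suc m , hasDegree (λ { (suc i) (s≤s le) → b i le }) l)
  ... | inj₁ p≈0 with a ≈? 0#
  ...   | yes a≈0 = inj₁ (λ { zero → a≈0 ; (suc i) → p≈0 i })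
  ...   | no  a≉0 = inj₂ (0 , hasDegree (λ { (suc i) _ → p≈0 i }) a≉0)

  poly≈? : ∀ p r → Dec (p ≈ₚ r)
  poly≈? []      []      = yes (λ _ → refl)
  poly≈? []      (b ∷ r) = map′ (λ { (e , es) zero → e ; (e , es) (suc i) → es i })
    (λ es → es 0 , es ∘ suc) ((0# ≈? b) ×-dec poly≈? [] r)
  poly≈? (a ∷ p) []      = map′ (λ { (e , es) zero → e ; (e , es) (suc i) → es i })
    (λ es → es 0 , es ∘ suc) ((a ≈? 0#) ×-dec poly≈? p [])
  poly≈? (a ∷ p) (b ∷ r) = map′ (λ { (e , es) zero → e ; (e , es) (suc i) → es i })
    (λ es → es 0 , es ∘ suc) ((a ≈? b) ×-dec poly≈? p r)

  monic-lead : ∀ {d} (v : Vec Carrier d) → coeff (poly (monic d v)) d ≈ 1#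
  monic-lead []      = refl
  monic-lead (a ∷ v) = monic-lead v

  monic-below : ∀ {d} (v : Vec Carrier d) → Below (suc d) (coeff (poly (monic d v)))
  monic-below []      (suc i) le       = refl
  monic-below (a ∷ v) (suc i) (s≤s le) = monic-below v i le

  monic-degree : ∀ p → HasDegree (poly p) (deg p)
  monic-degree (monic d v) = hasDegree (monic-below v) (λ e → 1≉0 (trans (sym (monic-lead v)) e))

  truncate : (d : ℕ) → (ℕ → Carrier) → Vec Carrier d
  truncate zero    f = []
  truncate (suc d) f = from (to (f 0)) ∷ truncate d (f ∘ suc)

  truncate-≈ : ∀ d f → f d ≈ 1# → Below (suc d) f → ∀ i → coeff (poly (monic d (truncate d f))) i ≈ f i
  truncate-≈ zero    f f1 bf zero    = sym f1
  truncate-≈ zero    f f1 bf (suc i) = sym (bf (suc i) (s≤s z≤n))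
  truncate-≈ (suc d) f f1 bf zero    = from∘to (f 0)
  truncate-≈ (suc d) f f1 bf (suc i) = truncate-≈ d (f ∘ suc) f1 (λ j le → bf (suc j) (s≤s le)) i

  truncate-∈ : ∀ d f → truncate d f ∈ vectors d
  truncate-∈ zero    f = here ≡.refl
  truncate-∈ (suc d) f = ∈-cartesianProductWith⁺ _∷_ (∈-map⁺ from (∈-allFin _)) (truncate-∈ d (f ∘ suc))

  monics≤-∈ : ∀ {d n} → d ℕ.≤ n → ∀ f → monic d (truncate d f) ∈ monics≤ n
  monics≤-∈ {d} le f = ∈-concatMap⁺ monicsOfDegree
    (lose (∈-upTo⁺ (s≤s le)) (∈-map⁺ (monic d) (truncate-∈ d f)))

  monic-rep : ∀ p {m n} (h : HasDegree p m) → m ℕ.≤ n →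
              ∃[ a ] a ∈ monics≤ n × deg a ≡ m × (∀ i → coeff (poly a) i ≈ inv (HasDegree.lead h) * coeff p i)
  monic-rep p {m} (hasDegree b l) le =
    monic m (truncate m f) , monics≤-∈ le f , ≡.refl ,
    truncate-≈ m f (invˡ l) (λ i m<i → trans (*-congˡ (b i m<i)) (zeroʳ _))
    where f = λ i → inv l * coeff p i

  unit : ∀ p → HasDegree p 0 → p ∣ [ 1# ]
  unit p (hasDegree b l) = [ inv l ] , λ i → trans (coeff-* [ inv l ] p i) (go i)
    where
    go : ∀ i → conv (coeff [ inv l ]) (coeff p) i ≈ coeff [ 1# ] i
    go zero    = invˡ l
    go (suc i) = trans (+-cong (trans (*-congˡ (b (suc i) (s≤s z≤n))) (zeroʳ _)) (conv-zeroˡ (λ _ → refl) i)) (+-identityˡ 0#)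

  one-coeff : ∀ {i} → 1 ℕ.≤ i → coeff [ 1# ] i ≈ 0#
  one-coeff (s≤s _) = refl

  nonunit : ∀ p {m} → 1 ℕ.≤ m → HasDegree p m → ¬ p ∣ [ 1# ]
  nonunit p {m} 1≤m (hasDegree b l) (z , zp≈1) with degree? z
  ... | inj₁ z≈0 = 1≉0 (trans (sym (zp≈1 0)) (trans (coeff-* z p 0) (conv-zeroˡ {g = coeff p} z≈0 0)))
  ... | inj₂ (k , hasDegree b′ l′) = *-nonzero l′ l (begin
    coeff z k * coeff p m            ≈⟨ conv-top k m _ _ b′ b ⟨
    conv (coeff z) (coeff p) (k ℕ.+ m) ≈⟨ coeff-* z p _ ⟨
    coeff (z *ₚ p) (k ℕ.+ m)           ≈⟨ zp≈1 _ ⟩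
    coeff [ 1# ] (k ℕ.+ m)             ≈⟨ one-coeff (ℕ.≤-trans 1≤m (ℕ.m≤n+m m k)) ⟩
    0#                                 ∎)

  ProperFactors : MonicPoly → MonicPoly → MonicPoly → Set ℓ
  ProperFactors p a b = 1 ℕ.≤ deg a × 1 ℕ.≤ deg b × poly p ≈ₚ poly a *ₚ poly b

  Reducible : MonicPoly → Set (c ⊔ˡ ℓ)
  Reducible p = Any (λ a → Any (ProperFactors p a) (monics≤ (deg p))) (monics≤ (deg p))

  reducible? : ∀ p → Dec (Reducible p)
  reducible? p = any? (λ a → any? (λ b →
    (1 ℕ.≤? deg a) ×-dec (1 ℕ.≤? deg b) ×-dec poly≈? (poly p) (poly a *ₚ poly b)) _) _

  reducible⇒¬irreducible : ∀ p → Reducible p → ¬ Irreducible (poly p)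
  reducible⇒¬irreducible p red (mkIrred _ split) with find red
  ... | a , _ , red′ with find red′
  ...   | b , _ , 1≤a , 1≤b , p≈ab with split {poly a} {poly b} p≈ab
  ...     | inj₁ a∣1 = nonunit (poly a) 1≤a (monic-degree a) a∣1
  ...     | inj₂ b∣1 = nonunit (poly b) 1≤b (monic-degree b) b∣1

  module Factorisation (p : MonicPoly) {x y : Poly} (p≈xy : poly p ≈ₚ x *ₚ y) where

    p≈conv : ∀ i → coeff (poly p) i ≈ conv (coeff x) (coeff y) i
    p≈conv i = trans (p≈xy i) (coeff-* x y i)

    lead≉0 = HasDegree.lead (monic-degree p)

    factors≢0 : ∃[ m ] ∃[ n ] HasDegree x m × HasDegree y n
    factors≢0 with degree? x | degree? y
    ... | inj₁ x≈0     | _            = ⊥-elim (lead≉0 (trans (p≈conv _) (conv-zeroˡ x≈0 (deg p))))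
    ... | inj₂ _       | inj₁ y≈0     = ⊥-elim (lead≉0 (trans (p≈conv _) (conv-zeroʳ y≈0 (deg p))))
    ... | inj₂ (m , h) | inj₂ (n , k) = m , n , h , k

    degree-sum : ∀ {m n} → HasDegree x m → HasDegree y n → m ℕ.+ n ≡ deg p
    degree-sum {m} {n} (hasDegree bx lx) (hasDegree by ly) with ℕ.<-cmp (m ℕ.+ n) (deg p)
    ... | tri≈ _ e _ = e
    ... | tri< l _ _ = ⊥-elim (lead≉0 (trans (p≈conv _) (conv-below m n _ _ bx by (deg p) l)))
    ... | tri> _ _ l = ⊥-elim (*-nonzero lx ly (trans (sym (conv-top m n _ _ bx by))
            (trans (sym (p≈conv _)) (HasDegree.below (monic-degree p) _ l))))

    reduce : ∀ {m n} → HasDegree x (suc m) → HasDegree y (suc n) → Reducible p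
    reduce {m} {n} h@(hasDegree bx lx) k@(hasDegree by ly)
      with monic-rep x h (ℕ.≤-trans (ℕ.m≤m+n (suc m) (suc n)) (ℕ.≤-reflexive (degree-sum h k)))
         | monic-rep y k (ℕ.≤-trans (ℕ.m≤n+m (suc n) (suc m)) (ℕ.≤-reflexive (degree-sum h k)))
    ... | a , a∈ , ≡.refl , a≈ | b , b∈ , ≡.refl , b≈ = lose a∈ (lose b∈ (s≤s z≤n , s≤s z≤n , λ i → sym (begin
      coeff (poly a *ₚ poly b) i                                    ≈⟨ coeff-* (poly a) (poly b) i ⟩
      conv (coeff (poly a)) (coeff (poly b)) i                      ≈⟨ conv-cong a≈ b≈ i ⟩
      conv (λ j → inv lx * coeff x j) (λ j → inv ly * coeff y j) i  ≈⟨ conv-scaleˡ (inv lx) i ⟩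
      inv lx * conv (coeff x) (λ j → inv ly * coeff y j) i          ≈⟨ *-congˡ (conv-scaleʳ (inv ly) i) ⟩
      inv lx * (inv ly * conv (coeff x) (coeff y) i)                ≈⟨ *-assoc _ _ _ ⟨
      inv lx * inv ly * conv (coeff x) (coeff y) i                  ≈⟨ *-congʳ leads ⟩
      1# * conv (coeff x) (coeff y) i                               ≈⟨ *-identityˡ _ ⟩
      conv (coeff x) (coeff y) i                                    ≈⟨ p≈conv i ⟨
      coeff (poly p) i                                              ∎)))
      where
      top : coeff x (suc m) * coeff y (suc n) ≈ 1#
      top = begin
        coeff x (suc m) * coeff y (suc n)             ≈⟨ conv-top (suc m) (suc n) _ _ bx by ⟨
        conv (coeff x) (coeff y) (suc m ℕ.+ suc n)    ≈⟨ p≈conv _ ⟨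
        coeff (poly p) (suc m ℕ.+ suc n)              ≡⟨ ≡.cong (coeff (poly p)) (degree-sum h k) ⟩
        coeff (poly p) (deg p)                        ≈⟨ monic-lead (lower p) ⟩
        1#                                            ∎
      leads : inv lx * inv ly ≈ 1#
      leads = begin
        inv lx * inv ly                                         ≈⟨ *-identityʳ _ ⟨
        inv lx * inv ly * 1#                                    ≈⟨ *-congˡ top ⟨
        inv lx * inv ly * (coeff x (suc m) * coeff y (suc n))   ≈⟨ *-assoc _ _ _ ⟩
        inv lx * (inv ly * (coeff x (suc m) * coeff y (suc n))) ≈⟨ *-congˡ (swap _ _ _) ⟩
        inv lx * (coeff x (suc m) * (inv ly * coeff y (suc n))) ≈⟨ *-congˡ (*-congˡ (invˡ ly)) ⟩
        inv lx * (coeff x (suc m) * 1#)                         ≈⟨ *-congˡ (*-identityʳ _) ⟩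
        inv lx * coeff x (suc m)                                ≈⟨ invˡ lx ⟩
        1#                                                      ∎

    split : ¬ Reducible p → x ∣ [ 1# ] ⊎ y ∣ [ 1# ]
    split ¬red with factors≢0
    ... | zero  , _     , h , _ = inj₁ (unit x h)
    ... | suc _ , zero  , _ , k = inj₂ (unit y k)
    ... | suc _ , suc _ , h , k = ⊥-elim (¬red (reduce h k))

  irreducible? : ∀ p → Dec (Irreducible (poly p))
  irreducible? p@(monic zero _) = no λ irr → Irreducible.p∤1 irr (unit (poly p) (monic-degree p))
  irreducible? p@(monic (suc _) _) with reducible? p
  ... | yes red = no (reducible⇒¬irreducible p red)
  ... | no ¬red = yes (mkIrred (nonunit (poly p) (s≤s z≤n) (monic-degree p)) (λ p≈xy → Factorisation.split p p≈xy ¬red))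

  irreducibles≤ : ℕ → List MonicPoly
  irreducibles≤ n = filter irreducible? (monics≤ n)

module EulerProduct {c ℓ : Level} {q : ℕ} (F : FiniteField c ℓ q) where

  open Polynomials F

  q-nonZero : ℕ.NonZero q
  q-nonZero = Fin.nonZeroIndex (Inverse.to (FiniteField.enumeration F) (FiniteField.0# F))

  ‖_‖ : MonicPoly → ℕ
  ‖ p ‖ = q ℕ.^ deg p

  ‖‖-nonZero : ∀ p → ℕ.NonZero ‖ p ‖
  ‖‖-nonZero p = ℕ.m^n≢0 q (deg p) {{q-nonZero}}

  factor : MonicPoly → ℚ
  factor p = 1ℚ ℚ.- (ℤ.+ 1 ℚ./ ‖ p ‖) {{‖‖-nonZero p}}

  product≤ : ℕ → ℚ
  product≤ n = foldr ℚ._*_ 1ℚ (map factor (irreducibles≤ n))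

module Real where

  open import Data.Integer.Base using (+_)
  open import Data.Rational.Base using (_/_; *≤*; *<*; _≤_; _<_; _+_; _*_; _-_; -_; ∣_∣; _⊔_)


  IsCauchy : (ℕ → ℚ) → Set
  IsCauchy s = ∀ ε → 0ℚ < ε → ∃[ N ] (∀ m n → N ℕ.≤ m → N ℕ.≤ n → ∣ s m - s n ∣ < ε)

  record ℝ : Set where
    constructor real
    field
      seq    : ℕ → ℚ
      cauchy : IsCauchy seq

  open ℝ public

  infix 4 _<ℝ_
  _<ℝ_ : ℝ → ℝ → Set
  x <ℝ y = ∃[ ε ] 0ℚ < ε × (∃[ N ] (∀ n → N ℕ.≤ n → seq x n + ε ≤ seq y n))

  fromℕ : ℕ → ℚ
  fromℕ n = + n / 1

  open ℚ.≤-Reasoning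
  open +-*-Solver

  0<1 : 0ℚ < 1ℚ
  0<1 = ℚ.positive⁻¹ 1ℚ

  0<½ : 0ℚ < ½
  0<½ = ℚ.positive⁻¹ ½

  *-pos : ∀ {a b} → 0ℚ < a → 0ℚ < b → 0ℚ < a * b
  *-pos {a} {b} 0<a 0<b = ℚ.positive⁻¹ (a * b) {{ℚ.pos*pos⇒pos a {{ℚ.positive 0<a}} b {{ℚ.positive 0<b}}}}

  *-nonNeg : ∀ {a b} → 0ℚ ≤ a → 0ℚ ≤ b → 0ℚ ≤ a * b
  *-nonNeg {a} {b} 0≤a 0≤b =
    ℚ.nonNegative⁻¹ (a * b) {{ℚ.nonNeg*nonNeg⇒nonNeg a {{ℚ.nonNegative 0≤a}} b {{ℚ.nonNegative 0≤b}}}}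

  *-mono : ∀ {a b c d} → 0ℚ ≤ a → 0ℚ ≤ d → a ≤ b → c ≤ d → a * c ≤ b * d
  *-mono {a} {b} {c} {d} 0≤a 0≤d a≤b c≤d = ℚ.≤-trans
    (ℚ.*-monoˡ-≤-nonNeg a {{ℚ.nonNegative 0≤a}} c≤d) (ℚ.*-monoʳ-≤-nonNeg d {{ℚ.nonNegative 0≤d}} a≤b)

  half : ℚ → ℚ
  half ε = ½ * ε

  half-pos : ∀ {ε} → 0ℚ < ε → 0ℚ < half ε
  half-pos = *-pos 0<½

  half+half : ∀ ε → half ε + half ε ≡ ε
  half+half = solve 1 (λ e → con ½ :* e :+ con ½ :* e := e) ≡.refl

  divide : ∀ {B} ε → 0ℚ < B → 0ℚ < ε → ∃[ δ ] 0ℚ < δ × B * δ ≡ ε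
  divide {B} ε 0<B 0<ε = (ℚ.1/ B) * ε , *-pos (ℚ.positive⁻¹ (ℚ.1/ B) {{ℚ.1/pos⇒pos B}}) 0<ε ,
    ≡.trans (≡.sym (ℚ.*-assoc B _ ε)) (≡.trans (≡.cong (_* ε) (ℚ.*-inverseʳ B)) (ℚ.*-identityˡ ε))
    where instance
      B>0 : ℚ.Positive B
      B>0 = ℚ.positive 0<B
      B≢0 : ℚ.NonZero B
      B≢0 = ℚ.pos⇒nonZero B

  ∣-∣-sym : ∀ a b → ∣ a - b ∣ ≡ ∣ b - a ∣
  ∣-∣-sym a b = ≡.trans (≡.cong ∣_∣ (solve 2 (λ x y → x :- y := :- (y :- x)) ≡.refl a b)) (ℚ.∣-p∣≡∣p∣ (b - a))

  triangle : ∀ a b c → ∣ a - c ∣ ≤ ∣ a - b ∣ + ∣ b - c ∣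
  triangle a b c = ℚ.≤-trans
    (ℚ.≤-reflexive (≡.cong ∣_∣ (solve 3 (λ x y z → x :- z := (x :- y) :+ (y :- z)) ≡.refl a b c)))
    (ℚ.∣p+q∣≤∣p∣+∣q∣ (a - b) (b - c))

  ≤-∣∣ : ∀ a → a ≤ ∣ a ∣
  ≤-∣∣ a with ℚ.≤-total 0ℚ a
  ... | inj₁ 0≤a = ℚ.≤-reflexive (≡.sym (ℚ.0≤p⇒∣p∣≡p 0≤a))
  ... | inj₂ a≤0 = ℚ.≤-trans a≤0 (ℚ.0≤∣p∣ a)

  ∣∣-≤ : ∀ {a b} → a ≤ b → - a ≤ b → ∣ a ∣ ≤ b
  ∣∣-≤ {a} a≤b -a≤b with ℚ.∣p∣≡p∨∣p∣≡-p a
  ... | inj₁ e = ℚ.≤-trans (ℚ.≤-reflexive e) a≤b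
  ... | inj₂ e = ℚ.≤-trans (ℚ.≤-reflexive e) -a≤b

  0≤- : ∀ {a b} → a ≤ b → 0ℚ ≤ b - a
  0≤- {a} {b} a≤b = ℚ.≤-trans (ℚ.≤-reflexive (≡.sym (ℚ.+-inverseʳ a))) (ℚ.+-monoˡ-≤ (- a) a≤b)

  -≤0 : ∀ {a b} → 0ℚ ≤ b - a → a ≤ b
  -≤0 {a} {b} h = begin
    a            ≡⟨ ℚ.+-identityˡ a ⟨
    0ℚ + a       ≤⟨ ℚ.+-monoˡ-≤ a h ⟩
    b - a + a    ≡⟨ solve 2 (λ x y → y :- x :+ x := y) ≡.refl a b ⟩
    b            ∎

  ∣∣-lipschitz : ∀ a b → ∣ ∣ a ∣ - ∣ b ∣ ∣ ≤ ∣ a - b ∣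
  ∣∣-lipschitz a b = ∣∣-≤ (one a b) (begin
    - (∣ a ∣ - ∣ b ∣)  ≡⟨ solve 2 (λ x y → :- (x :- y) := y :- x) ≡.refl ∣ a ∣ ∣ b ∣ ⟩
    ∣ b ∣ - ∣ a ∣      ≤⟨ one b a ⟩
    ∣ b - a ∣          ≡⟨ ∣-∣-sym b a ⟩
    ∣ a - b ∣          ∎)
    where
    one : ∀ a b → ∣ a ∣ - ∣ b ∣ ≤ ∣ a - b ∣
    one a b = begin
      ∣ a ∣ - ∣ b ∣               ≡⟨ ≡.cong (λ z → ∣ z ∣ - ∣ b ∣) (solve 2 (λ x y → x := x :- y :+ y) ≡.refl a b) ⟩
      ∣ a - b + b ∣ - ∣ b ∣       ≤⟨ ℚ.+-monoˡ-≤ (- ∣ b ∣) (ℚ.∣p+q∣≤∣p∣+∣q∣ (a - b) b) ⟩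
      ∣ a - b ∣ + ∣ b ∣ - ∣ b ∣   ≡⟨ solve 2 (λ x y → x :+ y :- y := x) ≡.refl ∣ a - b ∣ ∣ b ∣ ⟩
      ∣ a - b ∣                   ∎

  +-lipschitz : ∀ a b c d → ∣ (a + b) - (c + d) ∣ ≤ ∣ a - c ∣ + ∣ b - d ∣
  +-lipschitz a b c d = ℚ.≤-trans
    (ℚ.≤-reflexive (≡.cong ∣_∣ (solve 4 (λ x y z w → (x :+ y) :- (z :+ w) := (x :- z) :+ (y :- w)) ≡.refl a b c d)))
    (ℚ.∣p+q∣≤∣p∣+∣q∣ (a - c) (b - d))

  *-lipschitz : ∀ {B C} a b c d → ∣ a ∣ ≤ B → ∣ d ∣ ≤ C → ∣ a * b - c * d ∣ ≤ B * ∣ b - d ∣ + C * ∣ a - c ∣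
  *-lipschitz {B} {C} a b c d a≤B d≤C = begin
    ∣ a * b - c * d ∣                     ≡⟨ ≡.cong ∣_∣ (solve 4 (λ x y z w → x :* y :- z :* w := x :* (y :- w) :+ w :* (x :- z)) ≡.refl a b c d) ⟩
    ∣ a * (b - d) + d * (a - c) ∣         ≤⟨ ℚ.∣p+q∣≤∣p∣+∣q∣ (a * (b - d)) (d * (a - c)) ⟩
    ∣ a * (b - d) ∣ + ∣ d * (a - c) ∣     ≡⟨ ≡.cong₂ _+_ (ℚ.∣p*q∣≡∣p∣*∣q∣ a (b - d)) (ℚ.∣p*q∣≡∣p∣*∣q∣ d (a - c)) ⟩
    ∣ a ∣ * ∣ b - d ∣ + ∣ d ∣ * ∣ a - c ∣ ≤⟨ ℚ.+-mono-≤
        (ℚ.*-monoʳ-≤-nonNeg ∣ b - d ∣ {{ℚ.∣-∣-nonNeg (b - d)}} a≤B)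
        (ℚ.*-monoʳ-≤-nonNeg ∣ a - c ∣ {{ℚ.∣-∣-nonNeg (a - c)}} d≤C) ⟩
    B * ∣ b - d ∣ + C * ∣ a - c ∣         ∎

  Bounded : (ℕ → ℚ) → Set
  Bounded s = ∃[ B ] 0ℚ < B × (∀ n → ∣ s n ∣ ≤ B)

  bounded : ∀ {s} → IsCauchy s → Bounded s
  bounded {s} cs = B , 0<B , bound
    where
    N = proj₁ (cs 1ℚ 0<1)
    S : ℕ → ℚ
    S zero    = ∣ s 0 ∣
    S (suc n) = S n + ∣ s (suc n) ∣
    0≤S : ∀ n → 0ℚ ≤ S n
    0≤S zero    = ℚ.0≤∣p∣ (s 0)
    0≤S (suc n) = ℚ.+-mono-≤ (0≤S n) (ℚ.0≤∣p∣ (s (suc n)))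
    S-bound′ : ∀ {i n} → i ℕ.≤′ n → ∣ s i ∣ ≤ S n
    S-bound′ {zero}  ℕ.≤′-refl     = ℚ.≤-refl
    S-bound′ {suc i} ℕ.≤′-refl     =
      ℚ.≤-trans (ℚ.≤-reflexive (≡.sym (ℚ.+-identityˡ _))) (ℚ.+-monoˡ-≤ ∣ s (suc i) ∣ (0≤S i))
    S-bound′ {i} {suc n} (ℕ.≤′-step i≤n) =
      ℚ.≤-trans (S-bound′ i≤n) (ℚ.≤-trans (ℚ.≤-reflexive (≡.sym (ℚ.+-identityʳ _))) (ℚ.+-monoʳ-≤ (S n) (ℚ.0≤∣p∣ (s (suc n)))))
    B = S N + 1ℚ
    S≤B : S N ≤ B
    S≤B = ℚ.≤-trans (ℚ.≤-reflexive (≡.sym (ℚ.+-identityʳ _))) (ℚ.+-monoʳ-≤ (S N) (ℚ.<⇒≤ 0<1))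
    0<B : 0ℚ < B
    0<B = ℚ.+-mono-≤-< (0≤S N) 0<1
    bound : ∀ n → ∣ s n ∣ ≤ B
    bound n with ℕ.≤-total n N
    ... | inj₁ n≤N = ℚ.≤-trans (S-bound′ (ℕ.≤⇒≤′ n≤N)) S≤B
    ... | inj₂ N≤n = begin
      ∣ s n ∣               ≡⟨ ≡.cong ∣_∣ (solve 2 (λ x y → x := y :+ (x :- y)) ≡.refl (s n) (s N)) ⟩
      ∣ s N + (s n - s N) ∣ ≤⟨ ℚ.∣p+q∣≤∣p∣+∣q∣ (s N) (s n - s N) ⟩
      ∣ s N ∣ + ∣ s n - s N ∣ ≤⟨ ℚ.+-mono-≤ (S-bound′ (ℕ.≤⇒≤′ (ℕ.≤-refl {N}))) (ℚ.<⇒≤ (proj₂ (cs 1ℚ 0<1) n N N≤n ℕ.≤-refl)) ⟩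
      B                     ∎

  dominated : ∀ s (x y : ℝ) {B C} → 0ℚ < B → 0ℚ < C →
              (∀ m n → ∣ s m - s n ∣ ≤ B * ∣ seq x m - seq x n ∣ + C * ∣ seq y m - seq y n ∣) → IsCauchy s
  dominated s x y {B} {C} 0<B 0<C h ε 0<ε
    with divide (half ε) 0<B (half-pos 0<ε) | divide (half ε) 0<C (half-pos 0<ε)
  ... | δ , 0<δ , Bδ | η , 0<η , Cη with cauchy x δ 0<δ | cauchy y η 0<η
  ...   | M , cM | N , cN = M ℕ.⊔ N , λ m n hm hn → begin-strict
    ∣ s m - s n ∣                                            ≤⟨ h m n ⟩
    B * ∣ seq x m - seq x n ∣ + C * ∣ seq y m - seq y n ∣    <⟨ ℚ.+-mono-<
        (ℚ.*-monoʳ-<-pos B {{ℚ.positive 0<B}} (cM m n (ℕ.m⊔n≤o⇒m≤o M N hm) (ℕ.m⊔n≤o⇒m≤o M N hn)))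
        (ℚ.*-monoʳ-<-pos C {{ℚ.positive 0<C}} (cN m n (ℕ.m⊔n≤o⇒n≤o M N hm) (ℕ.m⊔n≤o⇒n≤o M N hn))) ⟩
    B * δ + C * η                                            ≡⟨ ≡.cong₂ _+_ Bδ Cη ⟩
    half ε + half ε                                          ≡⟨ half+half ε ⟩
    ε                                                        ∎

  dominated₁ : ∀ s (x : ℝ) {B} → 0ℚ < B → (∀ m n → ∣ s m - s n ∣ ≤ B * ∣ seq x m - seq x n ∣) → IsCauchy s
  dominated₁ s x {B} 0<B h ε 0<ε with divide ε 0<B 0<ε
  ... | δ , 0<δ , Bδ with cauchy x δ 0<δ
  ...   | N , cN = N , λ m n hm hn → ℚ.≤-<-trans (h m n)
            (ℚ.<-≤-trans (ℚ.*-monoʳ-<-pos B {{ℚ.positive 0<B}} (cN m n hm hn)) (ℚ.≤-reflexive Bδ))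

  fromℚ : ℚ → ℝ
  fromℚ a = real (λ _ → a) λ ε 0<ε → 0 , λ _ _ _ _ → ℚ.≤-<-trans (ℚ.≤-reflexive (≡.cong ∣_∣ (ℚ.+-inverseʳ a))) 0<ε

  infixl 6 _-ℝ_
  infixl 7 _*ℝ_

  _-ℝ_ : ℝ → ℝ → ℝ
  x -ℝ y = real (λ n → seq x n - seq y n) (dominated (λ n → seq x n - seq y n) x y 0<1 0<1 bound)
    where
    bound : ∀ m n → ∣ (seq x m - seq y m) - (seq x n - seq y n) ∣ ≤
                    1ℚ * ∣ seq x m - seq x n ∣ + 1ℚ * ∣ seq y m - seq y n ∣
    bound m n = begin
      ∣ (seq x m - seq y m) - (seq x n - seq y n) ∣
        ≡⟨ ≡.cong ∣_∣ (solve 4 (λ a b c d → (a :- b) :- (c :- d) := (a :- c) :+ (d :- b)) ≡.refl (seq x m) (seq y m) (seq x n) (seq y n)) ⟩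
      ∣ (seq x m - seq x n) + (seq y n - seq y m) ∣
        ≤⟨ ℚ.∣p+q∣≤∣p∣+∣q∣ (seq x m - seq x n) (seq y n - seq y m) ⟩
      ∣ seq x m - seq x n ∣ + ∣ seq y n - seq y m ∣
        ≡⟨ ≡.cong (λ z → ∣ seq x m - seq x n ∣ + z) (∣-∣-sym (seq y n) (seq y m)) ⟩
      ∣ seq x m - seq x n ∣ + ∣ seq y m - seq y n ∣
        ≡⟨ ≡.cong₂ _+_ (ℚ.*-identityˡ ∣ seq x m - seq x n ∣) (ℚ.*-identityˡ ∣ seq y m - seq y n ∣) ⟨
      1ℚ * ∣ seq x m - seq x n ∣ + 1ℚ * ∣ seq y m - seq y n ∣ ∎

  _*ℝ_ : ℝ → ℝ → ℝ
  x *ℝ y = real (λ n → seq x n * seq y n) (cauchy-* (bounded (cauchy x)) (bounded (cauchy y)))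
    where
    cauchy-* : Bounded (seq x) → Bounded (seq y) → IsCauchy (λ n → seq x n * seq y n)
    cauchy-* (B , 0<B , x≤B) (C , 0<C , y≤C) = dominated (λ n → seq x n * seq y n) y x 0<B 0<C λ m n →
      *-lipschitz (seq x m) (seq y m) (seq x n) (seq y n) (x≤B m) (y≤C n)

  ∣_∣ℝ : ℝ → ℝ
  ∣ x ∣ℝ = real (λ n → ∣ seq x n ∣) (dominated₁ (λ n → ∣ seq x n ∣) x 0<1 λ m n →
    ℚ.≤-trans (∣∣-lipschitz (seq x m) (seq x n)) (ℚ.≤-reflexive (≡.sym (ℚ.*-identityˡ ∣ seq x m - seq x n ∣))))

  1/pos : ∀ {a} → 0ℚ < a → ℚ
  1/pos {a} 0<a = (ℚ.1/ a) {{ℚ.>-nonZero 0<a}}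

  1/pos-inverse : ∀ {a} (0<a : 0ℚ < a) → a * 1/pos 0<a ≡ 1ℚ
  1/pos-inverse {a} 0<a = ℚ.*-inverseʳ a {{ℚ.>-nonZero 0<a}}

  1/pos-pos : ∀ {a} (0<a : 0ℚ < a) → 0ℚ < 1/pos 0<a
  1/pos-pos {a} 0<a = ℚ.positive⁻¹ _ {{ℚ.1/pos⇒pos a {{ℚ.positive 0<a}}}}

  1/pos-antitone : ∀ {a b} (0<a : 0ℚ < a) (0<b : 0ℚ < b) → a ≤ b → 1/pos 0<b ≤ 1/pos 0<a
  1/pos-antitone {a} {b} 0<a 0<b a≤b = begin
    1/b                ≡⟨ ℚ.*-identityˡ 1/b ⟨
    1ℚ * 1/b           ≡⟨ ≡.cong (_* 1/b) (1/pos-inverse 0<a) ⟨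
    a * 1/a * 1/b      ≤⟨ *-mono (*-nonNeg (ℚ.<⇒≤ 0<a) (ℚ.<⇒≤ (1/pos-pos 0<a))) (ℚ.<⇒≤ (1/pos-pos 0<b))
                            (ℚ.*-monoʳ-≤-nonNeg 1/a {{ℚ.nonNegative (ℚ.<⇒≤ (1/pos-pos 0<a))}} a≤b) ℚ.≤-refl ⟩
    b * 1/a * 1/b      ≡⟨ solve 3 (λ x y z → x :* y :* z := x :* z :* y) ≡.refl b 1/a 1/b ⟩
    b * 1/b * 1/a      ≡⟨ ≡.cong (_* 1/a) (1/pos-inverse 0<b) ⟩
    1ℚ * 1/a           ≡⟨ ℚ.*-identityˡ 1/a ⟩
    1/a                ∎
    where
    1/a = 1/pos 0<a
    1/b = 1/pos 0<b

  -- The positivity proof gives ε > 0 with ε ≤ seq x n for all large n, so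
  -- that the maximum with ε only affects finitely many approximations.
  infix 8 _⁻¹⟨_⟩
  _⁻¹⟨_⟩ : (x : ℝ) → fromℚ 0ℚ <ℝ x → ℝ
  x ⁻¹⟨ ε , 0<ε , _ ⟩ = real r (dominated₁ r x 0<C bound)
    where
    t : ℕ → ℚ
    t n = seq x n ⊔ ε
    0<⊔ : ∀ n → 0ℚ < t n
    0<⊔ n = ℚ.<-≤-trans 0<ε (ℚ.p≤q⊔p (seq x n) ε)
    r : ℕ → ℚ
    r n = 1/pos (0<⊔ n)
    C = 1/pos 0<ε * 1/pos 0<ε
    0<C : 0ℚ < C
    0<C = *-pos (1/pos-pos 0<ε) (1/pos-pos 0<ε)
    r≤ : ∀ n → r n ≤ 1/pos 0<ε
    r≤ n = 1/pos-antitone 0<ε (0<⊔ n) (ℚ.p≤q⊔p (seq x n) ε)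
    0≤r : ∀ n → 0ℚ ≤ r n
    0≤r n = ℚ.<⇒≤ (1/pos-pos (0<⊔ n))
    ⊔-lipschitz : ∀ a b → ∣ (a ⊔ ε) - (b ⊔ ε) ∣ ≤ ∣ a - b ∣
    ⊔-lipschitz a b = ∣∣-≤ (one a b) (begin
      - ((a ⊔ ε) - (b ⊔ ε)) ≡⟨ solve 2 (λ x y → :- (x :- y) := y :- x) ≡.refl (a ⊔ ε) (b ⊔ ε) ⟩
      (b ⊔ ε) - (a ⊔ ε)     ≤⟨ one b a ⟩
      ∣ b - a ∣             ≡⟨ ∣-∣-sym b a ⟩
      ∣ a - b ∣             ∎)
      where
      one : ∀ a b → (a ⊔ ε) - (b ⊔ ε) ≤ ∣ a - b ∣
      one a b = begin
        (a ⊔ ε) - (b ⊔ ε)                    ≤⟨ ℚ.+-monoˡ-≤ (- (b ⊔ ε)) (ℚ.⊔-lub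
            (ℚ.≤-trans (ℚ.≤-reflexive (solve 2 (λ x y → x := (x :- y) :+ y) ≡.refl a b)) (ℚ.+-mono-≤ (≤-∣∣ (a - b)) (ℚ.p≤p⊔q b ε)))
            (ℚ.≤-trans (ℚ.≤-reflexive (≡.sym (ℚ.+-identityˡ ε))) (ℚ.+-mono-≤ (ℚ.0≤∣p∣ (a - b)) (ℚ.p≤q⊔p b ε)))) ⟩
        ∣ a - b ∣ + (b ⊔ ε) - (b ⊔ ε)        ≡⟨ solve 2 (λ x y → x :+ y :- y := x) ≡.refl ∣ a - b ∣ (b ⊔ ε) ⟩
        ∣ a - b ∣                            ∎
    diff : ∀ m n → r m - r n ≡ (r m * r n) * (t n - t m)
    diff m n = ≡.sym (≡.trans
      (solve 4 (λ a b c d → (a :* b) :* (c :- d) := a :* (c :* b) :- b :* (d :* a)) ≡.refl (r m) (r n) (t n) (t m))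
      (≡.cong₂ _-_ (≡.trans (≡.cong (r m *_) (1/pos-inverse (0<⊔ n))) (ℚ.*-identityʳ (r m)))
                   (≡.trans (≡.cong (r n *_) (1/pos-inverse (0<⊔ m))) (ℚ.*-identityʳ (r n)))))
    bound : ∀ m n → ∣ r m - r n ∣ ≤ C * ∣ seq x m - seq x n ∣
    bound m n = begin
      ∣ r m - r n ∣                     ≡⟨ ≡.cong ∣_∣ (diff m n) ⟩
      ∣ (r m * r n) * (t n - t m) ∣     ≡⟨ ℚ.∣p*q∣≡∣p∣*∣q∣ (r m * r n) (t n - t m) ⟩
      ∣ r m * r n ∣ * ∣ t n - t m ∣     ≡⟨ ≡.cong₂ _*_ (ℚ.0≤p⇒∣p∣≡p (*-nonNeg (0≤r m) (0≤r n))) (∣-∣-sym (t n) (t m)) ⟩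
      (r m * r n) * ∣ t m - t n ∣       ≤⟨ *-mono (*-nonNeg (0≤r m) (0≤r n)) (ℚ.0≤∣p∣ (seq x m - seq x n))
                                             (*-mono (0≤r m) (ℚ.<⇒≤ (1/pos-pos 0<ε)) (r≤ m) (r≤ n)) (⊔-lipschitz (seq x m) (seq x n)) ⟩
      C * ∣ seq x m - seq x n ∣         ∎

  -- Shifted index: recip k = 1 / (k + 1).
  recip : ℕ → ℚ
  recip k = + 1 / suc k

  toℚ : ℕ → ℚ
  toℚ n = mkℚ (+ n) 0 (Coprimality.sym (Coprimality.1-coprimeTo n))

  fromℕ≡ : ∀ n → fromℕ n ≡ toℚ n
  fromℕ≡ n = ℚ.normalize-coprime _

  recip≡ : ∀ k → recip k ≡ mkℚ (+ 1) k (Coprimality.1-coprimeTo (suc k))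
  recip≡ k = ℚ.normalize-coprime _

  fromℕ-+ : ∀ m n → fromℕ m + fromℕ n ≡ fromℕ (m ℕ.+ n)
  fromℕ-+ m n = ≡.trans (≡.cong₂ _+_ (fromℕ≡ m) (fromℕ≡ n))
    (≡.cong (_/ 1) (≡.cong₂ ℤ._+_ (ℤ.*-identityʳ (+ m)) (ℤ.*-identityʳ (+ n))))

  fromℕ-* : ∀ m n → fromℕ m * fromℕ n ≡ fromℕ (m ℕ.* n)
  fromℕ-* m n = ≡.trans (≡.cong₂ _*_ (fromℕ≡ m) (fromℕ≡ n)) (≡.cong (_/ 1) (≡.sym (ℤ.pos-* m n)))

  fromℕ-nonNeg : ∀ n → 0ℚ ≤ fromℕ n
  fromℕ-nonNeg n = ℚ.nonNegative⁻¹ (fromℕ n) {{ℚ.normalize-nonNeg n 1}}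

  fromℕ-recip : ∀ k → fromℕ (suc k) * recip k ≡ 1ℚ
  fromℕ-recip k = ≡.trans (≡.cong₂ _*_ (fromℕ≡ (suc k)) (recip≡ k)) (ℚ.*-inverseʳ (toℚ (suc k)))

  recip-pos : ∀ k → 0ℚ < recip k
  recip-pos k = ℚ.positive⁻¹ (recip k) {{ℚ.normalize-pos 1 (suc k)}}

  recip-nonNeg : ∀ k → 0ℚ ≤ recip k
  recip-nonNeg k = ℚ.<⇒≤ (recip-pos k)

  recip-antitone : ∀ {k l} → k ℕ.≤ l → recip l ≤ recip k
  recip-antitone {k} {l} k≤l = ≡.subst₂ _≤_ (≡.sym (recip≡ l)) (≡.sym (recip≡ k))
    (*≤* (ℤ.*-monoˡ-≤-nonNeg (+ 1) (ℤ.+≤+ (s≤s k≤l))))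

  archimedean : ∀ {ε} → 0ℚ < ε → ∃[ N ] (∀ n → N ℕ.≤ n → recip n < ε)
  archimedean {ε@(mkℚ (+ suc a) d c)} 0<ε = suc d , λ n d<n → ℚ.≤-<-trans (recip-antitone d<n)
    (≡.subst (_< ε) (≡.sym (recip≡ (suc d))) below)
    where
    below : mkℚ (+ 1) (suc d) (Coprimality.1-coprimeTo (suc (suc d))) < ε
    below = *<* (ℤ.+<+ (ℕ.≤-trans (ℕ.≤-reflexive (≡.cong suc (ℕ.+-identityʳ (suc d))))
              (ℕ.m≤m+n (suc (suc d)) (a ℕ.* suc (suc d)))))
  archimedean {mkℚ (+ 0) d c} (*<* (ℤ.+<+ ()))
  archimedean {mkℚ ℤ.-[1+ a ] d c} (*<* ())

  telescoping : ∀ (s c : ℕ → ℚ) J →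
    (∀ n → J ℕ.≤ n → ∣ s n - s (suc n) ∣ ≤ c n - c (suc n)) →
    (∀ n → J ℕ.≤ n → 0ℚ ≤ c n) → (m n : ℕ) → J ℕ.≤ m → m ℕ.≤ n → ∣ s m - s n ∣ ≤ c m
  telescoping s c J step 0≤c m n J≤m m≤n = ℚ.≤-trans (go (ℕ.≤⇒≤′ m≤n)) (begin
    c m - c n        ≤⟨ ℚ.+-monoʳ-≤ (c m) (ℚ.neg-antimono-≤ (0≤c n (ℕ.≤-trans J≤m m≤n))) ⟩
    c m - 0ℚ         ≡⟨ ℚ.+-identityʳ (c m) ⟩
    c m              ∎)
    where
    go : ∀ {n} → m ℕ.≤′ n → ∣ s m - s n ∣ ≤ c m - c n
    go ℕ.≤′-refl = ℚ.≤-reflexive (≡.trans (≡.cong ∣_∣ (ℚ.+-inverseʳ (s m))) (≡.sym (ℚ.+-inverseʳ (c m))))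
    go (ℕ.≤′-step {n} m≤n) = begin
      ∣ s m - s (suc n) ∣                      ≤⟨ triangle (s m) (s n) (s (suc n)) ⟩
      ∣ s m - s n ∣ + ∣ s n - s (suc n) ∣      ≤⟨ ℚ.+-mono-≤ (go m≤n) (step n (ℕ.≤-trans J≤m (ℕ.≤′⇒≤ m≤n))) ⟩
      c m - c n + (c n - c (suc n))            ≡⟨ solve 3 (λ x y z → x :- y :+ (y :- z) := x :- z) ≡.refl (c m) (c n) (c (suc n)) ⟩
      c m - c (suc n)                          ∎

  telescoping-cauchy : ∀ (s c : ℕ → ℚ) J →
    (∀ n → J ℕ.≤ n → ∣ s n - s (suc n) ∣ ≤ c n - c (suc n)) → (∀ n → J ℕ.≤ n → 0ℚ ≤ c n) →
    (∀ ε → 0ℚ < ε → ∃[ N ] (∀ n → N ℕ.≤ n → c n < ε)) → IsCauchy s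
  telescoping-cauchy s c J step 0≤c c→0 ε 0<ε with c→0 ε 0<ε
  ... | N , cN = J ℕ.⊔ N , λ m n hm hn → go m n hm hn (ℕ.≤-total m n)
    where
    go : ∀ m n → J ℕ.⊔ N ℕ.≤ m → J ℕ.⊔ N ℕ.≤ n → m ℕ.≤ n ⊎ n ℕ.≤ m → ∣ s m - s n ∣ < ε
    go m n hm hn (inj₁ m≤n) = ℚ.≤-<-trans (telescoping s c J step 0≤c m n (ℕ.m⊔n≤o⇒m≤o J N hm) m≤n)
      (cN m (ℕ.m⊔n≤o⇒n≤o J N hm))
    go m n hm hn (inj₂ n≤m) = ℚ.≤-<-trans (ℚ.≤-trans (ℚ.≤-reflexive (∣-∣-sym (s m) (s n)))
      (telescoping s c J step 0≤c n m (ℕ.m⊔n≤o⇒m≤o J N hn) n≤m)) (cN n (ℕ.m⊔n≤o⇒n≤o J N hn))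

  IsCauchyℝ : (ℕ → ℝ) → Set
  IsCauchyℝ x = ∀ ε → 0ℚ < ε → ∃[ N ] (∀ m n → N ℕ.≤ m → N ℕ.≤ n → ∣ x m -ℝ x n ∣ℝ <ℝ fromℚ ε)

  lim : (x : ℕ → ℝ) → IsCauchyℝ x → ℝ
  lim x cx = real s cauchy-s
    where
    M : ℕ → ℕ
    M k = proj₁ (cauchy (x k) (recip k) (recip-pos k))
    -- s k is within 1/(k+1) of x k
    s : ℕ → ℚ
    s k = seq (x k) (M k)
    close : ∀ k i → M k ℕ.≤ i → ∣ s k - seq (x k) i ∣ < recip k
    close k i = proj₂ (cauchy (x k) (recip k) (recip-pos k)) (M k) i ℕ.≤-refl
    cauchy-s : IsCauchy s
    cauchy-s ε 0<ε with cx (half ε) (half-pos 0<ε) | archimedean (half-pos (half-pos 0<ε))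
    ... | N , cN | A , cA = N ℕ.⊔ A , go
      where
      go : ∀ k l → N ℕ.⊔ A ℕ.≤ k → N ℕ.⊔ A ℕ.≤ l → ∣ s k - s l ∣ < ε
      go k l hk hl with cN k l (ℕ.m⊔n≤o⇒m≤o N A hk) (ℕ.m⊔n≤o⇒m≤o N A hl)
      ... | δ , 0<δ , K , cK = begin-strict
        ∣ s k - s l ∣
          ≤⟨ triangle (s k) (seq (x k) i) (s l) ⟩
        ∣ s k - seq (x k) i ∣ + ∣ seq (x k) i - s l ∣
          ≤⟨ ℚ.+-monoʳ-≤ ∣ s k - seq (x k) i ∣ (triangle (seq (x k) i) (seq (x l) i) (s l)) ⟩
        ∣ s k - seq (x k) i ∣ + (∣ seq (x k) i - seq (x l) i ∣ + ∣ seq (x l) i - s l ∣)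
          <⟨ ℚ.+-mono-< (ℚ.<-trans (close k i (ℕ.≤-trans (ℕ.m≤m⊔n (M k) (M l)) (ℕ.m≤n⊔m K _))) (cA k (ℕ.m⊔n≤o⇒n≤o N A hk)))
               (ℚ.+-mono-≤-< (middle (∣ seq (x k) i - seq (x l) i ∣) (cK i (ℕ.m≤m⊔n K _)))
                 (ℚ.<-trans (ℚ.≤-<-trans (ℚ.≤-reflexive (∣-∣-sym (seq (x l) i) (s l)))
                   (close l i (ℕ.≤-trans (ℕ.m≤n⊔m (M k) (M l)) (ℕ.m≤n⊔m K _)))) (cA l (ℕ.m⊔n≤o⇒n≤o N A hl)))) ⟩
        half (half ε) + (half ε + half (half ε))
          ≡⟨ solve 1 (λ e → con ½ :* (con ½ :* e) :+ (con ½ :* e :+ con ½ :* (con ½ :* e)) := e) ≡.refl ε ⟩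
        ε ∎
        where
        i = K ℕ.⊔ (M k ℕ.⊔ M l)
        middle : ∀ a → a + δ ≤ half ε → a ≤ half ε
        middle a h = ℚ.≤-trans (ℚ.≤-trans (ℚ.≤-reflexive (≡.sym (ℚ.+-identityʳ a))) (ℚ.+-monoʳ-≤ a (ℚ.<⇒≤ 0<δ))) h

  lim-lower : ∀ x cx {a} → (∀ m k → a ≤ seq (x m) k) → ∀ k → a ≤ seq (lim x cx) k
  lim-lower x cx h k = h k (proj₁ (cauchy (x k) (recip k) (recip-pos k)))

  Σ< : ℕ → (ℕ → ℚ) → ℚ
  Σ< zero    f = 0ℚ
  Σ< (suc n) f = Σ< n f + f n

  -- expTerm a j = aʲ / j!
  expTerm : ℚ → ℕ → ℚ
  expTerm a zero    = 1ℚ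
  expTerm a (suc j) = expTerm a j * a * recip j

  expTerm-nonNeg : ∀ {a} → 0ℚ ≤ a → ∀ j → 0ℚ ≤ expTerm a j
  expTerm-nonNeg 0≤a zero    = ℚ.<⇒≤ 0<1
  expTerm-nonNeg 0≤a (suc j) = *-nonNeg (*-nonNeg (expTerm-nonNeg 0≤a j) 0≤a) (recip-nonNeg j)

  expTerm-pos : ∀ {a} → 0ℚ < a → ∀ j → 0ℚ < expTerm a j
  expTerm-pos 0<a zero    = 0<1
  expTerm-pos 0<a (suc j) = *-pos (*-pos (expTerm-pos 0<a j) 0<a) (recip-pos j)

  module ExpSum {B : ℚ} (0<B : 0ℚ < B) where

    t : ℕ → ℚ
    t = expTerm B
    E : ℕ → ℚ
    E k = Σ< k t
    0≤t : ∀ j → 0ℚ ≤ t j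
    0≤t = expTerm-nonNeg (ℚ.<⇒≤ 0<B)
    δ = divide ½ 0<B 0<½
    J = proj₁ (archimedean (proj₁ (proj₂ δ)))

    halving : ∀ j → J ℕ.≤ j → t (suc j) ≤ ½ * t j
    halving j J≤j = begin
      t j * B * recip j       ≤⟨ ℚ.*-monoˡ-≤-nonNeg (t j * B) {{ℚ.nonNegative (*-nonNeg (0≤t j) (ℚ.<⇒≤ 0<B))}}
                                   (ℚ.<⇒≤ (proj₂ (archimedean (proj₁ (proj₂ δ))) j J≤j)) ⟩
      t j * B * proj₁ δ       ≡⟨ ℚ.*-assoc (t j) B (proj₁ δ) ⟩
      t j * (B * proj₁ δ)     ≡⟨ ≡.cong (t j *_) (proj₂ (proj₂ δ)) ⟩
      t j * ½                 ≡⟨ ℚ.*-comm (t j) ½ ⟩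
      ½ * t j                 ∎

    c : ℕ → ℚ
    c j = t j + t j

    step : ∀ n → J ℕ.≤ n → ∣ E n - E (suc n) ∣ ≤ c n - c (suc n)
    step n J≤n = begin
      ∣ E n - (E n + t n) ∣                     ≡⟨ ≡.cong ∣_∣ (solve 2 (λ x y → x :- (x :+ y) := :- y) ≡.refl (E n) (t n)) ⟩
      ∣ - t n ∣                                 ≡⟨ ℚ.∣-p∣≡∣p∣ (t n) ⟩
      ∣ t n ∣                                   ≡⟨ ℚ.0≤p⇒∣p∣≡p (0≤t n) ⟩
      t n                                       ≡⟨ solve 1 (λ x → x := (x :+ x) :- (con ½ :* x :+ con ½ :* x)) ≡.refl (t n) ⟩
      c n - (½ * t n + ½ * t n)                 ≤⟨ ℚ.+-monoʳ-≤ (c n) (ℚ.neg-antimono-≤ (ℚ.+-mono-≤ (halving n J≤n) (halving n J≤n))) ⟩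
      c n - c (suc n)                           ∎

    decay : ∀ i → t (i ℕ.+ J) ≤ t J * recip i
    decay zero    = ℚ.≤-reflexive (≡.sym (ℚ.*-identityʳ (t J)))
    decay (suc i) = begin
      t (suc (i ℕ.+ J))        ≤⟨ halving (i ℕ.+ J) (ℕ.m≤n+m J i) ⟩
      ½ * t (i ℕ.+ J)          ≤⟨ ℚ.*-monoˡ-≤-nonNeg ½ (decay i) ⟩
      ½ * (t J * recip i)      ≡⟨ solve 2 (λ x y → con ½ :* (x :* y) := x :* (con ½ :* y)) ≡.refl (t J) (recip i) ⟩
      t J * (½ * recip i)      ≤⟨ ℚ.*-monoˡ-≤-nonNeg (t J) {{ℚ.nonNegative (0≤t J)}} (half-recip i) ⟩
      t J * recip (suc i)      ∎
      where
      half-recip : ∀ i → ½ * recip i ≤ recip (suc i)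
      half-recip i = begin
        ½ * recip i                                            ≡⟨ ≡.cong (λ z → ½ * z) (≡.trans (≡.sym (ℚ.*-identityʳ (recip i))) (≡.cong (recip i *_) (≡.sym (fromℕ-recip (suc i))))) ⟩
        ½ * (recip i * (fromℕ (suc (suc i)) * recip (suc i)))  ≡⟨ solve 3 (λ x y z → con ½ :* (x :* (y :* z)) := (con ½ :* (x :* y)) :* z) ≡.refl (recip i) (fromℕ (suc (suc i))) (recip (suc i)) ⟩
        (½ * (recip i * fromℕ (suc (suc i)))) * recip (suc i)  ≤⟨ ℚ.*-monoʳ-≤-nonNeg (recip (suc i)) {{ℚ.nonNegative (recip-nonNeg (suc i))}} (ℚ.*-monoˡ-≤-nonNeg ½ two) ⟩
        (½ * (1ℚ + 1ℚ)) * recip (suc i)                        ≡⟨ ℚ.*-identityˡ (recip (suc i)) ⟩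
        recip (suc i)                                          ∎
        where
        two : recip i * fromℕ (suc (suc i)) ≤ 1ℚ + 1ℚ
        two = begin
          recip i * fromℕ (suc (suc i))              ≡⟨ ≡.cong (recip i *_) (fromℕ-+ 1 (suc i)) ⟨
          recip i * (1ℚ + fromℕ (suc i))             ≡⟨ solve 2 (λ x y → x :* (con 1ℚ :+ y) := x :+ y :* x) ≡.refl (recip i) (fromℕ (suc i)) ⟩
          recip i + fromℕ (suc i) * recip i          ≡⟨ ≡.cong (λ z → recip i + z) (fromℕ-recip i) ⟩
          recip i + 1ℚ                               ≤⟨ ℚ.+-monoˡ-≤ 1ℚ (recip-antitone {0} {i} z≤n) ⟩
          1ℚ + 1ℚ                                    ∎

    c→0 : ∀ ε → 0ℚ < ε → ∃[ N ] (∀ n → N ℕ.≤ n → c n < ε)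
    c→0 ε 0<ε = N ℕ.+ J , λ n le → ≡.subst (λ z → c z < ε) (ℕ.m∸n+n≡m (ℕ.≤-trans (ℕ.m≤n+m J N) le))
              (small (n ℕ.∸ J) (ℕ.m+n≤o⇒m≤o∸n N le))
      where
      quotient : ∃[ η ] 0ℚ < η × t J * η ≡ half ε
      quotient = divide {t J} (half ε) (expTerm-pos 0<B J) (half-pos 0<ε)
      arch = archimedean (proj₁ (proj₂ quotient))
      N = proj₁ arch
      small₁ : ∀ i → N ℕ.≤ i → t (i ℕ.+ J) < half ε
      small₁ i N≤i = ℚ.≤-<-trans (decay i) (ℚ.<-≤-trans
        (ℚ.*-monoʳ-<-pos (t J) {{ℚ.positive (expTerm-pos 0<B J)}} (proj₂ arch i N≤i)) (ℚ.≤-reflexive (proj₂ (proj₂ quotient))))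
      small : ∀ i → N ℕ.≤ i → c (i ℕ.+ J) < ε
      small i N≤i = ℚ.<-≤-trans (ℚ.+-mono-< (small₁ i N≤i) (small₁ i N≤i)) (ℚ.≤-reflexive (half+half ε))

    expSum-cauchy : IsCauchy (λ k → Σ< k (expTerm B))
    expSum-cauchy = telescoping-cauchy E c J step (λ n _ → ℚ.+-mono-≤ (0≤t n) (0≤t n)) c→0

  Σ<-lipschitz : ∀ k (f g h : ℕ → ℚ) → (∀ j → ∣ f j - g j ∣ ≤ h j) → ∣ Σ< k f - Σ< k g ∣ ≤ Σ< k h
  Σ<-lipschitz zero    f g h le = ℚ.≤-refl
  Σ<-lipschitz (suc k) f g h le = ℚ.≤-trans (+-lipschitz (Σ< k f) (f k) (Σ< k g) (g k))
    (ℚ.+-mono-≤ (Σ<-lipschitz k f g h le) (le k))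

  Σ<-*ˡ : ∀ k a f → Σ< k (λ j → a * f j) ≡ a * Σ< k f
  Σ<-*ˡ zero    a f = ≡.sym (ℚ.*-zeroʳ a)
  Σ<-*ˡ (suc k) a f = ≡.trans (≡.cong (_+ a * f k) (Σ<-*ˡ k a f)) (≡.sym (ℚ.*-distribˡ-+ a (Σ< k f) (f k)))

  -- expTerm, delayed by one step: bounds the derivative of each term
  delayed : ℚ → ℕ → ℚ
  delayed B zero    = 0ℚ
  delayed B (suc j) = expTerm B j

  Σ<-delayed : ∀ B k → Σ< (suc k) (delayed B) ≡ Σ< k (expTerm B)
  Σ<-delayed B zero    = ≡.refl
  Σ<-delayed B (suc k) = ≡.cong (_+ expTerm B k) (Σ<-delayed B k)

  delayed-step : ∀ B j → (delayed B j * B + expTerm B j) * recip j ≡ expTerm B j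
  delayed-step B zero    = ≡.trans (ℚ.*-identityʳ _) (≡.trans (≡.cong (_+ 1ℚ) (ℚ.*-zeroˡ B)) (ℚ.+-identityˡ 1ℚ))
  delayed-step B (suc j) = begin-equality
    (t * B + t * B * recip j) * r                       ≡⟨ ≡.cong (λ z → (z + t * B * recip j) * r) (≡.trans (≡.sym (ℚ.*-identityʳ (t * B))) (≡.cong (t * B *_) (≡.sym (fromℕ-recip j)))) ⟩
    (t * B * (n * recip j) + t * B * recip j) * r       ≡⟨ solve 5 (λ t b n q r → (t :* b :* (n :* q) :+ t :* b :* q) :* r := t :* b :* q :* ((con 1ℚ :+ n) :* r)) ≡.refl t B n (recip j) r ⟩
    t * B * recip j * ((1ℚ + n) * r)                    ≡⟨ ≡.cong (λ z → t * B * recip j * (z * r)) (fromℕ-+ 1 (suc j)) ⟩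
    t * B * recip j * (fromℕ (suc (suc j)) * r)         ≡⟨ ≡.cong (t * B * recip j *_) (fromℕ-recip (suc j)) ⟩
    t * B * recip j * 1ℚ                                ≡⟨ ℚ.*-identityʳ (t * B * recip j) ⟩
    t * B * recip j                                     ∎
    where
    t = expTerm B j
    n = fromℕ (suc j)
    r = recip (suc j)

  expTerm-bound : ∀ {a B} → ∣ a ∣ ≤ B → ∀ j → ∣ expTerm a j ∣ ≤ expTerm B j
  expTerm-bound a≤B zero    = ℚ.≤-refl
  expTerm-bound {a} {B} a≤B (suc j) = begin
    ∣ expTerm a j * a * recip j ∣           ≡⟨ ℚ.∣p*q∣≡∣p∣*∣q∣ (expTerm a j * a) (recip j) ⟩
    ∣ expTerm a j * a ∣ * ∣ recip j ∣       ≡⟨ ≡.cong₂ _*_ (ℚ.∣p*q∣≡∣p∣*∣q∣ (expTerm a j) a) (ℚ.0≤p⇒∣p∣≡p (recip-nonNeg j)) ⟩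
    ∣ expTerm a j ∣ * ∣ a ∣ * recip j       ≤⟨ ℚ.*-monoʳ-≤-nonNeg (recip j) {{ℚ.nonNegative (recip-nonNeg j)}}
                                                (*-mono (ℚ.0≤∣p∣ (expTerm a j)) (ℚ.≤-trans (ℚ.0≤∣p∣ a) a≤B) (expTerm-bound a≤B j) a≤B) ⟩
    expTerm B j * B * recip j               ∎

  expTerm-lipschitz : ∀ {a b B} → ∣ a ∣ ≤ B → ∣ b ∣ ≤ B → ∀ j →
                      ∣ expTerm a j - expTerm b j ∣ ≤ ∣ a - b ∣ * delayed B j
  expTerm-lipschitz {a} {b} a≤B b≤B zero    = ℚ.≤-reflexive (≡.sym (ℚ.*-zeroʳ ∣ a - b ∣))
  expTerm-lipschitz {a} {b} {B} a≤B b≤B (suc j) = begin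
    ∣ ta * a * r - tb * b * r ∣             ≡⟨ ≡.cong ∣_∣ (solve 5 (λ x y z w r → x :* y :* r :- z :* w :* r := (x :* y :- z :* w) :* r) ≡.refl ta a tb b r) ⟩
    ∣ (ta * a - tb * b) * r ∣               ≡⟨ ≡.trans (ℚ.∣p*q∣≡∣p∣*∣q∣ (ta * a - tb * b) r) (≡.cong (∣ ta * a - tb * b ∣ *_) (ℚ.0≤p⇒∣p∣≡p (recip-nonNeg j))) ⟩
    ∣ ta * a - tb * b ∣ * r                 ≤⟨ mono-r (*-lipschitz ta a tb b (expTerm-bound a≤B j) b≤B) ⟩
    (expTerm B j * d + B * ∣ ta - tb ∣) * r ≤⟨ mono-r (ℚ.+-monoʳ-≤ (expTerm B j * d) (ℚ.*-monoˡ-≤-nonNeg B {{ℚ.nonNegative (ℚ.≤-trans (ℚ.0≤∣p∣ a) a≤B)}} (expTerm-lipschitz a≤B b≤B j))) ⟩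
    (expTerm B j * d + B * (d * delayed B j)) * r ≡⟨ solve 5 (λ t d b l r → (t :* d :+ b :* (d :* l)) :* r := d :* ((l :* b :+ t) :* r)) ≡.refl (expTerm B j) d B (delayed B j) r ⟩
    d * ((delayed B j * B + expTerm B j) * r) ≡⟨ ≡.cong (d *_) (delayed-step B j) ⟩
    d * expTerm B j                         ∎
    where
    ta = expTerm a j
    tb = expTerm b j
    r = recip j
    d = ∣ a - b ∣
    mono-r : ∀ {x y} → x ≤ y → x * r ≤ y * r
    mono-r = ℚ.*-monoʳ-≤-nonNeg r {{ℚ.nonNegative (recip-nonNeg j)}}

  expSum-tail : ∀ {a B} → ∣ a ∣ ≤ B → ∀ {m n} → m ℕ.≤′ n →
                ∣ Σ< m (expTerm a) - Σ< n (expTerm a) ∣ ≤ Σ< n (expTerm B) - Σ< m (expTerm B)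
  expSum-tail {a} {B} a≤B {m} ℕ.≤′-refl = ℚ.≤-reflexive
    (≡.trans (≡.cong ∣_∣ (ℚ.+-inverseʳ (Σ< m (expTerm a)))) (≡.sym (ℚ.+-inverseʳ (Σ< m (expTerm B)))))
  expSum-tail {a} {B} a≤B {m} (ℕ.≤′-step {n} m≤n) = begin
    ∣ x - (y + u) ∣        ≡⟨ ≡.cong ∣_∣ (solve 3 (λ x y u → x :- (y :+ u) := (x :- y) :+ (:- u)) ≡.refl x y u) ⟩
    ∣ (x - y) + (- u) ∣    ≤⟨ ℚ.∣p+q∣≤∣p∣+∣q∣ (x - y) (- u) ⟩
    ∣ x - y ∣ + ∣ - u ∣    ≤⟨ ℚ.+-mono-≤ (expSum-tail a≤B m≤n) (ℚ.≤-trans (ℚ.≤-reflexive (ℚ.∣-p∣≡∣p∣ u)) (expTerm-bound a≤B n)) ⟩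
    (Y - X) + U            ≡⟨ solve 3 (λ x y u → (y :- x) :+ u := (y :+ u) :- x) ≡.refl X Y U ⟩
    (Y + U) - X            ∎
    where
    x = Σ< m (expTerm a)
    y = Σ< n (expTerm a)
    u = expTerm a n
    X = Σ< m (expTerm B)
    Y = Σ< n (expTerm B)
    U = expTerm B n

  expSum-tail-∣∣ : ∀ {a B} → ∣ a ∣ ≤ B → ∀ m n →
                   ∣ Σ< m (expTerm a) - Σ< n (expTerm a) ∣ ≤ ∣ Σ< m (expTerm B) - Σ< n (expTerm B) ∣
  expSum-tail-∣∣ {a} {B} a≤B m n with ℕ.≤-total m n
  ... | inj₁ m≤n = ℚ.≤-trans (expSum-tail a≤B (ℕ.≤⇒≤′ m≤n)) (ℚ.≤-trans (≤-∣∣ _) (ℚ.≤-reflexive (∣-∣-sym (Σ< n (expTerm B)) (Σ< m (expTerm B)))))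
  ... | inj₂ n≤m = ℚ.≤-trans (ℚ.≤-reflexive (∣-∣-sym (Σ< m (expTerm a)) (Σ< n (expTerm a)))) (ℚ.≤-trans (expSum-tail a≤B (ℕ.≤⇒≤′ n≤m)) (≤-∣∣ _))

  exp-cauchy : ∀ x → IsCauchy (λ k → Σ< k (expTerm (seq x k)))
  exp-cauchy x with bounded (cauchy x)
  ... | B , 0<B , x≤B with bounded (ExpSum.expSum-cauchy 0<B)
  ...   | C , 0<C , e≤C = dominated (λ k → Σ< k (expTerm (seq x k))) x (real (λ k → Σ< k (expTerm B)) (ExpSum.expSum-cauchy 0<B)) 0<C 0<1 bound
    where
    delayed≤C : ∀ k → Σ< k (delayed B) ≤ C
    delayed≤C zero    = ℚ.<⇒≤ 0<C
    delayed≤C (suc k) = ℚ.≤-trans (ℚ.≤-reflexive (Σ<-delayed B k)) (ℚ.≤-trans (≤-∣∣ _) (e≤C k))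
    bound : ∀ m n → ∣ Σ< m (expTerm (seq x m)) - Σ< n (expTerm (seq x n)) ∣ ≤
                    C * ∣ seq x m - seq x n ∣ + 1ℚ * ∣ Σ< m (expTerm B) - Σ< n (expTerm B) ∣
    bound m n = begin
      ∣ Σ< m (expTerm a) - Σ< n (expTerm b) ∣
        ≤⟨ triangle (Σ< m (expTerm a)) (Σ< m (expTerm b)) (Σ< n (expTerm b)) ⟩
      ∣ Σ< m (expTerm a) - Σ< m (expTerm b) ∣ + ∣ Σ< m (expTerm b) - Σ< n (expTerm b) ∣
        ≤⟨ ℚ.+-mono-≤ (ℚ.≤-trans (Σ<-lipschitz m (expTerm a) (expTerm b) (λ j → d * delayed B j) (expTerm-lipschitz (x≤B m) (x≤B n)))
                        (ℚ.≤-trans (ℚ.≤-reflexive (Σ<-*ˡ m d (delayed B))) (ℚ.*-monoˡ-≤-nonNeg d {{ℚ.∣-∣-nonNeg (a - b)}} (delayed≤C m))))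
                      (expSum-tail-∣∣ (x≤B n) m n) ⟩
      d * C + e
        ≡⟨ ≡.cong₂ _+_ (ℚ.*-comm d C) (≡.sym (ℚ.*-identityˡ e)) ⟩
      C * d + 1ℚ * e ∎
      where
      a = seq x m
      b = seq x n
      d = ∣ a - b ∣
      e = ∣ Σ< m (expTerm B) - Σ< n (expTerm B) ∣

  -- The exponential series: the k-th approximation of exp x is the sum of the
  -- first k terms at the k-th approximation of x.
  exp : ℝ → ℝ
  exp x = real (λ k → Σ< k (expTerm (seq x k))) (exp-cauchy x)

  -- Approximations of log (m + 1) = ∫₁ᵐ⁺¹ dt/t. The K-th approximation is the right Riemann sum
  -- of mesh 1/A with A = K + 1: its i-th term (1/A) · 1/(1 + (i+1)/A) equals
  -- 1/(A + i + 1).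
  logSum : ℕ → ℕ → ℚ
  logSum m K = Σ< (suc K ℕ.* m) (λ i → recip (suc K ℕ.+ i))

  harmonic : ℕ → ℚ
  harmonic n = Σ< n recip

  Σ<-+ : ∀ a b f → Σ< (a ℕ.+ b) f ≡ Σ< a f + Σ< b (λ i → f (a ℕ.+ i))
  Σ<-+ a zero    f = ≡.trans (≡.cong (λ z → Σ< z f) (ℕ.+-identityʳ a)) (≡.sym (ℚ.+-identityʳ (Σ< a f)))
  Σ<-+ a (suc b) f = ≡.trans (≡.cong (λ z → Σ< z f) (ℕ.+-suc a b))
    (≡.trans (≡.cong (_+ f (a ℕ.+ b)) (Σ<-+ a b f)) (ℚ.+-assoc (Σ< a f) _ _))

  suc-* : ∀ n c → fromℕ n * c + c ≡ fromℕ (suc n) * c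
  suc-* n c = ≡.trans (solve 2 (λ x y → x :* y :+ y := (con 1ℚ :+ x) :* y) ≡.refl (fromℕ n) c)
    (≡.cong (_* c) (fromℕ-+ 1 n))

  Σ<-upper : ∀ n f c → (∀ i → i ℕ.< n → f i ≤ c) → Σ< n f ≤ fromℕ n * c
  Σ<-upper zero    f c le = ℚ.≤-reflexive (≡.sym (ℚ.*-zeroˡ c))
  Σ<-upper (suc n) f c le = ℚ.≤-trans
    (ℚ.+-mono-≤ (Σ<-upper n f c (λ i i<n → le i (ℕ.m<n⇒m<1+n i<n))) (le n (ℕ.n<1+n n))) (ℚ.≤-reflexive (suc-* n c))

  Σ<-lower : ∀ n f c → (∀ i → i ℕ.< n → c ≤ f i) → fromℕ n * c ≤ Σ< n f
  Σ<-lower zero    f c le = ℚ.≤-reflexive (ℚ.*-zeroˡ c)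
  Σ<-lower (suc n) f c le = ℚ.≤-trans (ℚ.≤-reflexive (≡.sym (suc-* n c)))
    (ℚ.+-mono-≤ (Σ<-lower n f c (λ i i<n → le i (ℕ.m<n⇒m<1+n i<n))) (le n (ℕ.n<1+n n)))

  scale-recip : ∀ a b P → suc P ≡ suc a ℕ.* suc b → fromℕ (suc a) * recip P ≡ recip b
  scale-recip a b P eq = begin-equality
    x * p                ≡⟨ ℚ.*-identityʳ (x * p) ⟨
    x * p * 1ℚ           ≡⟨ ≡.cong (x * p *_) (fromℕ-recip b) ⟨
    x * p * (y * r)      ≡⟨ solve 4 (λ x p y r → x :* p :* (y :* r) := r :* ((x :* y) :* p)) ≡.refl x p y r ⟩
    r * ((x * y) * p)    ≡⟨ ≡.cong (λ z → r * (z * p)) (≡.trans (fromℕ-* (suc a) (suc b)) (≡.cong fromℕ (≡.sym eq))) ⟩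
    r * (fromℕ (suc P) * p) ≡⟨ ≡.cong (r *_) (fromℕ-recip P) ⟩
    r * 1ℚ               ≡⟨ ℚ.*-identityʳ r ⟩
    r                    ∎
    where
    x = fromℕ (suc a)
    y = fromℕ (suc b)
    p = recip P
    r = recip b

  -- a + 1 consecutive terms of the harmonic series, starting just after
  -- (a + 1) (b + 1), lie between 1 / (b + 2) and 1 / (b + 1)
  block : ℕ → ℕ → ℚ
  block a b = Σ< (suc a) (λ i → recip (suc a ℕ.* suc b ℕ.+ i))

  block-≤ : ∀ a b → block a b ≤ recip b
  block-≤ a b = ℚ.≤-trans
    (Σ<-upper (suc a) _ (recip P) (λ i _ → recip-antitone (ℕ.≤-trans (ℕ.n≤1+n P) (ℕ.m≤m+n (suc P) i))))
    (ℚ.≤-reflexive (scale-recip a b P ≡.refl))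
    where P = b ℕ.+ a ℕ.* suc b

  block-≥ : ∀ a b → recip (suc b) ≤ block a b
  block-≥ a b = ℚ.≤-trans (ℚ.≤-reflexive (≡.sym (scale-recip a (suc b) Q eq)))
    (Σ<-lower (suc a) _ (recip Q) (λ i i<a → recip-antitone (ℕ.+-monoʳ-≤ (suc a ℕ.* suc b) (ℕ.s≤s⁻¹ i<a))))
    where
    Q = suc a ℕ.* suc b ℕ.+ a
    eq : suc Q ≡ suc a ℕ.* suc (suc b)
    eq = ≡.trans (≡.sym (ℕ.+-suc (suc a ℕ.* suc b) a))
           (≡.trans (ℕ.+-comm (suc a ℕ.* suc b) (suc a)) (≡.sym (ℕ.*-suc (suc a) (suc b))))

  block-dist : ∀ a b → ∣ block a b - recip (suc b) ∣ ≤ recip b - recip (suc b)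
  block-dist a b = ℚ.≤-trans (ℚ.≤-reflexive (ℚ.0≤p⇒∣p∣≡p (0≤- (block-≥ a b)))) (ℚ.+-monoˡ-≤ (- recip (suc b)) (block-≤ a b))

  harmonic-logSum : ∀ m K → harmonic (suc K ℕ.* suc m) ≡ harmonic (suc K) + logSum m K
  harmonic-logSum m K = ≡.trans (≡.cong harmonic (ℕ.*-suc (suc K) m)) (Σ<-+ (suc K) (suc K ℕ.* m) recip)

  logSum-stepK : ∀ m K → logSum m (suc K) - logSum m K ≡ block m K - recip (suc K)
  logSum-stepK m K = begin-equality
    L′ - L                                          ≡⟨ solve 4 (λ l l′ h r → l′ :- l := (h :+ r :+ l′) :- (h :+ l) :- r) ≡.refl L L′ h r ⟩
    (harmonic (suc (suc K)) + L′) - (h + L) - r     ≡⟨ ≡.cong₂ (λ y z → y - z - r) (harmonic-logSum m (suc K)) (harmonic-logSum m K) ⟨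
    harmonic (suc (suc K) ℕ.* suc m) - harmonic (suc K ℕ.* suc m) - r
                                                    ≡⟨ ≡.cong₂ (λ y z → harmonic y - harmonic z - r)
                                                         (≡.trans (ℕ.*-comm (suc (suc K)) (suc m)) (≡.trans (ℕ.*-suc (suc m) (suc K)) (ℕ.+-comm (suc m) _)))
                                                         (ℕ.*-comm (suc K) (suc m)) ⟩
    harmonic (P ℕ.+ suc m) - harmonic P - r         ≡⟨ ≡.cong (λ z → z - harmonic P - r) (Σ<-+ P (suc m) recip) ⟩
    (harmonic P + block m K) - harmonic P - r       ≡⟨ solve 3 (λ p b r → (p :+ b) :- p :- r := b :- r) ≡.refl (harmonic P) (block m K) r ⟩
    block m K - r                                   ∎
    where
    L = logSum m K
    L′ = logSum m (suc K)
    h = harmonic (suc K)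
    r = recip (suc K)
    P = suc m ℕ.* suc K

  logSum-stepm : ∀ m K → logSum (suc m) K ≡ logSum m K + block K m
  logSum-stepm m K = begin-equality
    logSum (suc m) K                             ≡⟨ ≡.cong (λ z → Σ< z f) (≡.trans (ℕ.*-suc (suc K) m) (ℕ.+-comm (suc K) (suc K ℕ.* m))) ⟩
    Σ< (suc K ℕ.* m ℕ.+ suc K) f                 ≡⟨ Σ<-+ (suc K ℕ.* m) (suc K) f ⟩
    logSum m K + Σ< (suc K) (λ i → f (suc K ℕ.* m ℕ.+ i)) ≡⟨ ≡.cong (λ z → logSum m K + z) (Σ<-cong (suc K) (λ i → ≡.cong recip (shift i))) ⟩
    logSum m K + block K m                       ∎
    where
    f : ℕ → ℚ
    f i = recip (suc K ℕ.+ i)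
    shift : ∀ i → suc K ℕ.+ (suc K ℕ.* m ℕ.+ i) ≡ suc K ℕ.* suc m ℕ.+ i
    shift i = ≡.trans (≡.sym (ℕ.+-assoc (suc K) (suc K ℕ.* m) i)) (≡.cong (ℕ._+ i) (≡.sym (ℕ.*-suc (suc K) m)))
    Σ<-cong : ∀ n {f g} → (∀ i → f i ≡ g i) → Σ< n f ≡ Σ< n g
    Σ<-cong zero    e = ≡.refl
    Σ<-cong (suc n) e = ≡.cong₂ _+_ (Σ<-cong n e) (e n)

  log1+ : ℕ → ℝ
  log1+ m = real (logSum m) (telescoping-cauchy (logSum m) recip 0 step (λ n _ → recip-nonNeg n) (λ _ → archimedean))
    where
    step : ∀ K → 0 ℕ.≤ K → ∣ logSum m K - logSum m (suc K) ∣ ≤ recip K - recip (suc K)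
    step K _ = ℚ.≤-trans (ℚ.≤-reflexive (≡.trans (∣-∣-sym (logSum m K) (logSum m (suc K))) (≡.cong ∣_∣ (logSum-stepK m K)))) (block-dist m K)

  -- γ-seq m = (1 + 1/2 + … + 1/M) - log M with M = m + 1.
  γ-seq : ℕ → ℝ
  γ-seq m = fromℚ (harmonic (suc m)) -ℝ log1+ m

  gap : ℕ → ℕ → ℚ
  gap K m = harmonic (suc m) - logSum m K

  gap-step : ∀ K m → gap K m - gap K (suc m) ≡ block K m - recip (suc m)
  gap-step K m = ≡.trans (≡.cong (λ z → (harmonic (suc m) - logSum m K) - (harmonic (suc (suc m)) - z)) (logSum-stepm m K))
    (solve 4 (λ h l b r → (h :- l) :- ((h :+ r) :- (l :+ b)) := b :- r) ≡.refl (harmonic (suc m)) (logSum m K) (block K m) (recip (suc m)))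

  gap-dist : ∀ K m → ∣ gap K m - gap K (suc m) ∣ ≤ recip m - recip (suc m)
  gap-dist K m = ℚ.≤-trans (ℚ.≤-reflexive (≡.cong ∣_∣ (gap-step K m))) (block-dist K m)

  gap-lower : ∀ K m → recip m ≤ gap K m
  gap-lower K zero    = ℚ.≤-reflexive (≡.sym (≡.cong (λ z → harmonic 1 - Σ< z (λ i → recip (suc K ℕ.+ i))) (ℕ.*-zeroʳ (suc K))))
  gap-lower K (suc m) = begin
    recip (suc m)                          ≡⟨ solve 2 (λ x y → y := x :- (x :- y)) ≡.refl (recip m) (recip (suc m)) ⟩
    recip m - (recip m - recip (suc m))    ≤⟨ ℚ.+-mono-≤ (gap-lower K m) (ℚ.neg-antimono-≤ (ℚ.≤-trans (≤-∣∣ _) (gap-dist K m))) ⟩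
    gap K m - (gap K m - gap K (suc m))    ≡⟨ solve 2 (λ x y → x :- (x :- y) := y) ≡.refl (gap K m) (gap K (suc m)) ⟩
    gap K (suc m)                          ∎

  gap-cauchy : IsCauchyℝ γ-seq
  gap-cauchy ε 0<ε = proj₁ arch , λ m n hm hn → half ε , half-pos 0<ε , 0 , λ K _ → begin
    ∣ gap K m - gap K n ∣ + half ε   ≤⟨ ℚ.+-monoˡ-≤ (half ε) (dist K m n hm hn (ℕ.≤-total m n)) ⟩
    half ε + half ε                  ≡⟨ half+half ε ⟩
    ε                                ∎
    where
    arch = archimedean (half-pos 0<ε)
    dist : ∀ K m n → proj₁ arch ℕ.≤ m → proj₁ arch ℕ.≤ n → m ℕ.≤ n ⊎ n ℕ.≤ m → ∣ gap K m - gap K n ∣ ≤ half ε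
    dist K m n hm hn (inj₁ m≤n) = ℚ.≤-trans
      (telescoping (gap K) recip 0 (λ i _ → gap-dist K i) (λ i _ → recip-nonNeg i) m n z≤n m≤n) (ℚ.<⇒≤ (proj₂ arch m hm))
    dist K m n hm hn (inj₂ n≤m) = ℚ.≤-trans (ℚ.≤-reflexive (∣-∣-sym (gap K m) (gap K n))) (ℚ.≤-trans
      (telescoping (gap K) recip 0 (λ i _ → gap-dist K i) (λ i _ → recip-nonNeg i) n m z≤n n≤m) (ℚ.<⇒≤ (proj₂ arch n hn)))

  γ : ℝ
  γ = lim γ-seq gap-cauchy

  expSum-≥1 : ∀ {a} → 0ℚ ≤ a → ∀ k → 1ℚ ≤ Σ< (suc k) (expTerm a)
  expSum-≥1 0≤a zero    = ℚ.≤-refl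
  expSum-≥1 {a} 0≤a (suc k) = ℚ.≤-trans (ℚ.≤-reflexive (≡.sym (ℚ.+-identityʳ 1ℚ)))
    (ℚ.+-mono-≤ (expSum-≥1 0≤a k) (expTerm-nonNeg 0≤a (suc k)))

  0≤γ : ∀ k → 0ℚ ≤ seq γ k
  0≤γ = lim-lower γ-seq gap-cauchy (λ m K → ℚ.≤-trans (recip-nonNeg m) (gap-lower K m))

  expγ*suc-pos : ∀ n → fromℚ 0ℚ <ℝ exp γ *ℝ fromℚ (fromℕ (suc n))
  expγ*suc-pos n = 1ℚ , 0<1 , 1 , bound
    where
    1≤suc : 1ℚ ≤ fromℕ (suc n)
    1≤suc = ℚ.≤-trans (ℚ.≤-trans (ℚ.≤-reflexive (≡.sym (ℚ.+-identityʳ 1ℚ))) (ℚ.+-monoʳ-≤ 1ℚ (fromℕ-nonNeg n))) (ℚ.≤-reflexive (fromℕ-+ 1 n))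
    bound : ∀ k → 1 ℕ.≤ k → 0ℚ + 1ℚ ≤ Σ< k (expTerm (seq γ k)) * fromℕ (suc n)
    bound (suc k) _ = *-mono (ℚ.<⇒≤ 0<1) (fromℕ-nonNeg (suc n)) (expSum-≥1 (0≤γ (suc k)) k) 1≤suc

{-# OPTIONS --safe #-}
module Submission where

-- Put x = 1 / q and let π d count the monic irreducibles of degree d. Summing the degrees of all
-- irreducible factors of all monic f of degree m in two ways gives Gauss' Σ_{d ∣ j} d π(d) = q ^ j, so
-- in - log ∏ (1 - 1 / ‖p‖) = Σ_{d ≤ n} π(d) Σ_k x^(d k) / k the terms with d k ≤ n sum to the harmonic
-- number H_n. Those with d k > n contribute less than 1 / (2 (n + 1)), by d π(d) ≤ q ^ d - q, while the
-- trapezoidal rule gives γ + log (n + 1) ≥ H_n + 1 / (2 (n + 1)). The remaining pairs (q , n) = (2 , 2),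
-- (2 , 3), (3 , 1) follow from e^γ > 1.778 and the exact values of π.
-- Logarithms are avoided: y ≤ e^x is certified by finite products ∏ (1 + hᵢ) ≥ y with Σ hᵢ ≤ x, obtained
-- from Riemann sums, and the partial sums of the exponential series are compared with such products.

open import Defs
open import Algebra.Bundles using (CommutativeMonoid; CommutativeRing)
import Algebra.Definitions.RawSemiring as RawSemiringDefs
import Algebra.Properties.CommutativeMonoid.Mult as Mult
import Algebra.Properties.CommutativeSemigroup as CommutativeSemigroupProperties
import Algebra.Properties.Ring as RingProperties
open import Data.Empty using (⊥-elim)
open import Data.Fin.Base as Fin using (Fin)
import Data.Fin.Properties as Fin
open import Data.List.Base using (List; []; _∷_; [_]; _++_; map; foldr; filter; length; concatMap; cartesianProductWith; allFin; upTo; applyUpTo)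
import Data.List.Properties as List
open import Data.List.Membership.Propositional using (_∈_; find; lose)
open import Data.List.Membership.Propositional.Properties using (∈-map⁺; ∈-map⁻; ∈-concatMap⁺; ∈-concatMap⁻; ∈-upTo⁺; ∈-upTo⁻; ∈-cartesianProductWith⁻; ∈-filter⁺; ∈-filter⁻)
open import Data.List.Relation.Unary.All as All using ()
import Data.List.Relation.Unary.All.Properties as All
open import Data.List.Relation.Unary.AllPairs using ([]; _∷_)
import Data.List.Relation.Unary.AllPairs.Properties as AllPairs
open import Data.List.Relation.Unary.Any using (Any; any?; here; there)
open import Data.List.Relation.Unary.Unique.Propositional using (Unique)
import Data.List.Relation.Unary.Unique.Propositional.Properties as Unique
open import Data.Nat.Base as ℕ using (ℕ; zero; suc; z≤n; s≤s)
import Data.Nat.DivMod as ℕ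
import Data.Nat.Properties as ℕ
open import Data.Product.Base using (∃-syntax; _×_; _,_; proj₁; proj₂)
open import Data.Rational.Base as ℚ using (ℚ; 0ℚ; 1ℚ; ½)
import Data.Rational.Properties as ℚ
open import Data.Rational.Solver using (module +-*-Solver)
open import Data.Sum.Base using (_⊎_; inj₁; inj₂)
open import Data.Vec.Base using (Vec; []; _∷_)
open import Data.Vec.Properties using (∷-injective)
open import Function.Base using (_∘_)
open import Function.Bundles using (Inverse)
open import Level using (Level) renaming (_⊔_ to _⊔ˡ_)
open import Relation.Binary.Definitions using (tri<; tri≈; tri>)
open import Relation.Binary.PropositionalEquality as ≡ using (_≡_)
import Relation.Binary.Reasoning.Setoid as SetoidReasoning
open import Relation.Nullary using (¬_; Dec; yes; no)
open import Relation.Nullary.Decidable using (map′; True; toWitness)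

-- Polynomials over a finite field

-- The two sides agree to leading order: - log of the product is H_n plus a tail, and γ + log (n +
-- 1) exceeds H_n only by about 1 / (2 (n + 1)). The whole margin is this trapezoidal correction, so
-- the tail times n + 1 has to stay below ½. For a few small pairs the estimate of the tail is too
-- coarse for that, and there the product is evaluated exactly. The reals are Cauchy sequences, and
-- the k-th approximation of `exp γ` is a k-term partial sum at the k-th approximation of γ.
-- Analytic inequalities are therefore proved between rationals, for the partial sums `E k` with k
-- arbitrary; of the functional equation of exp only two one-sided estimates for adding h to the
-- argument remain. The result is a strict inequality of reals, so one fixed rational gap must hold
-- for all late approximations.

module PolynomialRing {c ℓ : Level} {q : ℕ} (F : FiniteField c ℓ q) where

  open FiniteField F
  open Polynomials F
  open SetoidReasoning setoid
  open CommutativeSemigroupProperties +-commutativeSemigroup using (interchange)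

  conv-+ˡ : ∀ f f′ g i → conv (λ j → f j + f′ j) g i ≈ conv f g i + conv f′ g i
  conv-+ˡ f f′ g zero    = distribʳ _ _ _
  conv-+ˡ f f′ g (suc i) = trans (+-cong (distribʳ _ _ _) (conv-+ˡ (f ∘ suc) (f′ ∘ suc) g i)) (interchange _ _ _ _)

  -- Splits off the last term of the convolution, where `conv` itself splits off the first; the two
  -- recursions together give commutativity.
  conv-suc : ∀ f g i → conv f g (suc i) ≈ conv f (g ∘ suc) i + f (suc i) * g 0
  conv-suc f g zero    = refl
  conv-suc f g (suc i) = trans (+-congˡ (conv-suc (f ∘ suc) g i)) (sym (+-assoc _ _ _))

  conv-comm : ∀ f g i → conv f g i ≈ conv g f i
  conv-comm f g zero    = *-comm _ _
  conv-comm f g (suc i) = begin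
    f 0 * g (suc i) + conv (f ∘ suc) g i    ≈⟨ +-cong (*-comm _ _) (conv-comm (f ∘ suc) g i) ⟩
    g (suc i) * f 0 + conv g (f ∘ suc) i    ≈⟨ +-comm _ _ ⟩
    conv g (f ∘ suc) i + g (suc i) * f 0    ≈⟨ conv-suc g f i ⟨
    conv g f (suc i)                        ∎

  conv-assoc : ∀ f g h i → conv (conv f g) h i ≈ conv f (conv g h) i
  conv-assoc f g h zero    = *-assoc _ _ _
  conv-assoc f g h (suc i) = begin
    f 0 * g 0 * h (suc i) + conv (λ j → f 0 * g (suc j) + conv (f ∘ suc) g j) h i
      ≈⟨ +-cong (*-assoc _ _ _) (conv-+ˡ (λ j → f 0 * g (suc j)) (conv (f ∘ suc) g) h i) ⟩
    f 0 * (g 0 * h (suc i)) + (conv (λ j → f 0 * g (suc j)) h i + conv (conv (f ∘ suc) g) h i)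
      ≈⟨ +-congˡ (+-cong (conv-scaleˡ (f 0) i) (conv-assoc (f ∘ suc) g h i)) ⟩
    f 0 * (g 0 * h (suc i)) + (f 0 * conv (g ∘ suc) h i + conv (f ∘ suc) (conv g h) i)
      ≈⟨ +-assoc _ _ _ ⟨
    f 0 * (g 0 * h (suc i)) + f 0 * conv (g ∘ suc) h i + conv (f ∘ suc) (conv g h) i
      ≈⟨ +-congʳ (distribˡ _ _ _) ⟨
    f 0 * conv g h (suc i) + conv (f ∘ suc) (conv g h) i ∎

  coeff-[0#] : ∀ i → coeff [ 0# ] i ≈ 0#
  coeff-[0#] zero    = refl
  coeff-[0#] (suc i) = refl

  [x]*-coeff : ∀ x p i → coeff ([ x ] *ₚ p) i ≈ x * coeff p i
  [x]*-coeff x p i = trans (coeff-+ (map (x *_) p) [ 0# ] i)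
    (trans (+-cong (coeff-scale x p i) (coeff-[0#] i)) (+-identityʳ _))

  -ₚ_ : Poly → Poly
  -ₚ p = map (- 1# *_) p

  -- ≈ₚ is a function type, from which Agda cannot infer the two polynomials.
  infix 4 _≋_
  record _≋_ (p r : Poly) : Set ℓ where
    constructor pointwise
    field
      at : p ≈ₚ r

  open _≋_ public

  polyCommutativeRing : CommutativeRing c ℓ
  polyCommutativeRing = record
    { Carrier = Poly ; _≈_ = _≋_ ; _+_ = _+ₚ_ ; _*_ = _*ₚ_ ; -_ = -ₚ_ ; 0# = [] ; 1# = [ 1# ]
    ; isCommutativeRing = record
      { isRing = record
        { +-isAbelianGroup = record
          { isGroup = record
            { isMonoid = record
              { isSemigroup = record
                { isMagma = record
                  { isEquivalence = record
                    { refl  = pointwise λ _ → refl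
                    ; sym   = λ e → pointwise λ i → sym (at e i)
                    ; trans = λ e e′ → pointwise λ i → trans (at e i) (at e′ i)
                    }
                  ; ∙-cong = λ {p} {p′} {r} {r′} e e′ → pointwise λ i →
                      trans (coeff-+ p r i) (trans (+-cong (at e i) (at e′ i)) (sym (coeff-+ p′ r′ i)))
                  }
                ; assoc = λ p r s → pointwise λ i → begin
                    coeff (p +ₚ r +ₚ s) i                 ≈⟨ trans (coeff-+ (p +ₚ r) s i) (+-congʳ (coeff-+ p r i)) ⟩
                    coeff p i + coeff r i + coeff s i     ≈⟨ +-assoc _ _ _ ⟩
                    coeff p i + (coeff r i + coeff s i)   ≈⟨ trans (coeff-+ p (r +ₚ s) i) (+-congˡ (coeff-+ r s i)) ⟨
                    coeff (p +ₚ (r +ₚ s)) i               ∎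
                }
              ; identity = (λ _ → pointwise λ _ → refl) , λ p → pointwise λ i → trans (coeff-+ p [] i) (+-identityʳ _)
              }
            ; inverse = (λ p → pointwise (inverseˡ p)) ,
                λ p → pointwise λ i → trans (+ₚ-comm p (-ₚ p) i) (inverseˡ p i)
            ; ⁻¹-cong = λ {p} {r} e → pointwise λ i →
                trans (coeff-scale _ p i) (trans (*-congˡ (at e i)) (sym (coeff-scale _ r i)))
            }
          ; comm = λ p r → pointwise (+ₚ-comm p r)
          }
        ; *-cong = λ {p} {p′} {r} {r′} e e′ → pointwise λ i →
            trans (coeff-* p r i) (trans (conv-cong (at e) (at e′) i) (sym (coeff-* p′ r′ i)))
        ; *-assoc = λ p r s → pointwise λ i → begin
            coeff (p *ₚ r *ₚ s) i                          ≈⟨ coeff-* (p *ₚ r) s i ⟩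
            conv (coeff (p *ₚ r)) (coeff s) i              ≈⟨ conv-cong (coeff-* p r) (λ _ → refl) i ⟩
            conv (conv (coeff p) (coeff r)) (coeff s) i    ≈⟨ conv-assoc (coeff p) (coeff r) (coeff s) i ⟩
            conv (coeff p) (conv (coeff r) (coeff s)) i    ≈⟨ conv-cong (λ _ → refl) (coeff-* r s) i ⟨
            conv (coeff p) (coeff (r *ₚ s)) i              ≈⟨ coeff-* p (r *ₚ s) i ⟨
            coeff (p *ₚ (r *ₚ s)) i                        ∎
        ; *-identity = (λ p → pointwise (identityˡ p)) , λ p → pointwise λ i → trans (*ₚ-comm p [ 1# ] i) (identityˡ p i)
        ; distrib = (λ p r s → pointwise λ i → begin
              coeff (p *ₚ (r +ₚ s)) i                   ≈⟨ *ₚ-comm p (r +ₚ s) i ⟩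
              coeff ((r +ₚ s) *ₚ p) i                   ≈⟨ distrib-ʳ p r s i ⟩
              coeff (r *ₚ p +ₚ s *ₚ p) i                ≈⟨ coeff-+ (r *ₚ p) (s *ₚ p) i ⟩
              coeff (r *ₚ p) i + coeff (s *ₚ p) i       ≈⟨ +-cong (*ₚ-comm r p i) (*ₚ-comm s p i) ⟩
              coeff (p *ₚ r) i + coeff (p *ₚ s) i       ≈⟨ coeff-+ (p *ₚ r) (p *ₚ s) i ⟨
              coeff (p *ₚ r +ₚ p *ₚ s) i                ∎)
            , λ p r s → pointwise (distrib-ʳ p r s)
        }
      ; *-comm = λ p r → pointwise (*ₚ-comm p r)
      }
    }
    where
    inverseˡ : ∀ p → (-ₚ p) +ₚ p ≈ₚ []
    inverseˡ p i = begin
      coeff ((-ₚ p) +ₚ p) i              ≈⟨ coeff-+ (-ₚ p) p i ⟩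
      coeff (-ₚ p) i + coeff p i         ≈⟨ +-cong (coeff-scale (- 1#) p i) (sym (*-identityˡ _)) ⟩
      - 1# * coeff p i + 1# * coeff p i  ≈⟨ distribʳ _ _ _ ⟨
      (- 1# + 1#) * coeff p i            ≈⟨ trans (*-congʳ (-‿inverseˡ 1#)) (zeroˡ _) ⟩
      0#                                 ∎
    +ₚ-comm : ∀ p r → p +ₚ r ≈ₚ r +ₚ p
    +ₚ-comm p r i = trans (coeff-+ p r i) (trans (+-comm _ _) (sym (coeff-+ r p i)))
    *ₚ-comm : ∀ p r → p *ₚ r ≈ₚ r *ₚ p
    *ₚ-comm p r i = trans (coeff-* p r i) (trans (conv-comm (coeff p) (coeff r) i) (sym (coeff-* r p i)))
    identityˡ : ∀ p → [ 1# ] *ₚ p ≈ₚ p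
    identityˡ p i = trans ([x]*-coeff 1# p i) (*-identityˡ _)
    distrib-ʳ : ∀ p r s → (r +ₚ s) *ₚ p ≈ₚ r *ₚ p +ₚ s *ₚ p
    distrib-ʳ p r s i = begin
      coeff ((r +ₚ s) *ₚ p) i                                                ≈⟨ coeff-* (r +ₚ s) p i ⟩
      conv (coeff (r +ₚ s)) (coeff p) i                                      ≈⟨ conv-cong (coeff-+ r s) (λ _ → refl) i ⟩
      conv (λ j → coeff r j + coeff s j) (coeff p) i                         ≈⟨ conv-+ˡ (coeff r) (coeff s) (coeff p) i ⟩
      conv (coeff r) (coeff p) i + conv (coeff s) (coeff p) i                ≈⟨ +-cong (coeff-* r p i) (coeff-* s p i) ⟨
      coeff (r *ₚ p) i + coeff (s *ₚ p) i                                    ≈⟨ coeff-+ (r *ₚ p) (s *ₚ p) i ⟨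
      coeff (r *ₚ p +ₚ s *ₚ p) i                                             ∎

  module P where
    open CommutativeRing polyCommutativeRing public
    open RingProperties (CommutativeRing.ring polyCommutativeRing) public using (-‿distribˡ-*)

-- Division with remainder and Euclid's lemma

module Divisibility {c ℓ : Level} {q : ℕ} (F : FiniteField c ℓ q) where

  open FiniteField F
  open Polynomials F
  open PolynomialRing F
  open RawSemiringDefs polyRawSemiring using () renaming (_∣_ to _∣ᵣ_)
  open RingProperties ring using (-‿distribˡ-*)

  -- Division in Horner form: f = s P + r gives a + x f = (x s) P + (a + x r), and the coefficient
  -- `t` of degree `deg P` is then cleared by subtracting t P. As P is monic, `t` itself is the new
  -- coefficient of the quotient.
  divide : ∀ (P : MonicPoly) f → ∃[ s ] ∃[ r ] f ≋ s *ₚ poly P +ₚ r × Below (deg P) (coeff r)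
  divide P []      = [] , [] , P.refl , λ _ _ → refl
  divide P (a ∷ f) with divide P f
  ... | s , r , f≈ , r-below = t ∷ s , (a ∷ r) +ₚ (-ₚ tP) , equation , remainder-below
    where
    e = deg P
    t = coeff (a ∷ r) e
    tP = map (t *_) (poly P)
    shifted : (0# ∷ s *ₚ poly P) +ₚ (a ∷ r) ≋ a ∷ f
    shifted = pointwise λ { zero → +-identityˡ a ; (suc i) → sym (at f≈ i) }
    equation : a ∷ f ≋ (tP +ₚ (0# ∷ s *ₚ poly P)) +ₚ ((a ∷ r) +ₚ (-ₚ tP))
    equation = P.sym (begin
      (tP +ₚ v) +ₚ (u +ₚ (-ₚ tP))      ≈⟨ P.+-assoc (tP +ₚ v) u (-ₚ tP) ⟨
      ((tP +ₚ v) +ₚ u) +ₚ (-ₚ tP)      ≈⟨ P.+-congʳ (P.+-assoc tP v u) ⟩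
      (tP +ₚ (v +ₚ u)) +ₚ (-ₚ tP)      ≈⟨ P.+-congʳ (P.+-comm tP (v +ₚ u)) ⟩
      ((v +ₚ u) +ₚ tP) +ₚ (-ₚ tP)      ≈⟨ P.+-assoc (v +ₚ u) tP (-ₚ tP) ⟩
      (v +ₚ u) +ₚ (tP +ₚ (-ₚ tP))      ≈⟨ P.+-cong {v +ₚ u} P.refl (P.-‿inverseʳ tP) ⟩
      (v +ₚ u) +ₚ []                   ≈⟨ P.+-identityʳ (v +ₚ u) ⟩
      v +ₚ u                           ≈⟨ shifted ⟩
      a ∷ f                            ∎)
      where
      open SetoidReasoning P.setoid
      v = 0# ∷ s *ₚ poly P
      u = a ∷ r
    coeff-r : ∀ i → coeff ((a ∷ r) +ₚ (-ₚ tP)) i ≈ coeff (a ∷ r) i + - 1# * (t * coeff (poly P) i)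
    coeff-r i = trans (coeff-+ (a ∷ r) (-ₚ tP) i)
      (+-congˡ (trans (coeff-scale (- 1#) tP i) (*-congˡ (coeff-scale t (poly P) i))))
    remainder-below : Below e (coeff ((a ∷ r) +ₚ (-ₚ tP)))
    remainder-below i e≤i with ℕ.m≤n⇒m<n∨m≡n e≤i
    ... | inj₂ ≡.refl = begin
      coeff ((a ∷ r) +ₚ (-ₚ tP)) e                 ≈⟨ coeff-r e ⟩
      t + - 1# * (t * coeff (poly P) e)            ≈⟨ +-congˡ (*-congˡ (trans (*-congˡ (monic-lead (lower P))) (*-identityʳ t))) ⟩
      t + - 1# * t                                 ≈⟨ +-congˡ (trans (sym (-‿distribˡ-* 1# t)) (-‿cong (*-identityˡ t))) ⟩
      t + - t                                      ≈⟨ -‿inverseʳ t ⟩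
      0#                                           ∎
      where open SetoidReasoning setoid
    remainder-below (suc j) e≤i | inj₁ (s≤s e≤j) = begin
      coeff ((a ∷ r) +ₚ (-ₚ tP)) (suc j)               ≈⟨ coeff-r (suc j) ⟩
      coeff r j + - 1# * (t * coeff (poly P) (suc j))  ≈⟨ +-cong (r-below j e≤j) (*-congˡ (trans (*-congˡ (monic-below (lower P) (suc j) (s≤s e≤j))) (zeroʳ t))) ⟩
      0# + - 1# * 0#                                   ≈⟨ trans (+-identityˡ _) (zeroʳ _) ⟩
      0#                                               ∎
      where open SetoidReasoning setoid

  infix 4 _∣_
  _∣_ : Poly → Poly → Set (c ⊔ˡ ℓ)
  x ∣ y = ∃[ z ] z *ₚ x ≋ y

  ∣-respʳ : ∀ {x y z} → y ≋ z → x ∣ y → x ∣ z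
  ∣-respʳ y≈z (w , e) = w , P.trans e y≈z

  ∣-*ˡ : ∀ {x y} z → x ∣ y → x ∣ z *ₚ y
  ∣-*ˡ {x} z (w , e) = z *ₚ w , P.trans (P.*-assoc z w x) (P.*-cong {z} P.refl e)

  ∣-remainder : ∀ {x y u r} → y ≋ u +ₚ r → x ∣ y → x ∣ u → x ∣ r
  ∣-remainder {x} {y} {u} {r} y≈ (w , wx≈y) (v , vx≈u) = w +ₚ (-ₚ v) , (begin
    (w +ₚ (-ₚ v)) *ₚ x          ≈⟨ P.distribʳ x w (-ₚ v) ⟩
    w *ₚ x +ₚ (-ₚ v) *ₚ x       ≈⟨ P.+-cong wx≈y (P.sym (P.-‿distribˡ-* v x)) ⟩
    y +ₚ (-ₚ (v *ₚ x))          ≈⟨ P.+-cong (P.trans y≈ (P.+-comm u r)) (P.-‿cong vx≈u) ⟩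
    (r +ₚ u) +ₚ (-ₚ u)          ≈⟨ P.+-assoc r u (-ₚ u) ⟩
    r +ₚ (u +ₚ (-ₚ u))          ≈⟨ P.trans (P.+-cong {r} P.refl (P.-‿inverseʳ u)) (P.+-identityʳ r) ⟩
    r                           ∎)
    where open SetoidReasoning P.setoid

  unit-degree : ∀ {p m} → HasDegree p m → p ∣ᵣ [ 1# ] → m ≡ 0
  unit-degree {p} {zero}  _ _   = ≡.refl
  unit-degree {p} {suc m} h p∣1 = ⊥-elim (nonunit p (s≤s z≤n) h p∣1)

  degree-unique : ∀ {p m n} → HasDegree p m → HasDegree p n → m ≡ n
  degree-unique {m = m} {n} h k with ℕ.<-cmp m n
  ... | tri< m<n _ _ = ⊥-elim (HasDegree.lead k (HasDegree.below h n m<n))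
  ... | tri≈ _ m≡n _ = m≡n
  ... | tri> _ _ n<m = ⊥-elim (HasDegree.lead h (HasDegree.below k m n<m))

  -- A remainder need not be monic; scaling by the inverse of its leading coefficient yields a monic
  -- polynomial of the same degree with which Euclid's algorithm can continue.
  ∣-associate : ∀ {x r m} → HasDegree r m → ∃[ a ] deg a ≡ m × (∀ b → x ∣ r *ₚ b → x ∣ poly a *ₚ b)
  ∣-associate {x} {r} h@(hasDegree _ lead) with monic-rep r h ℕ.≤-refl
  ... | a , _ , deg-a , a≈ = a , deg-a , λ b x∣rb → ∣-respʳ (scaled b) (∣-*ˡ [ inv lead ] x∣rb)
    where
    scaled : ∀ b → [ inv lead ] *ₚ (r *ₚ b) ≋ poly a *ₚ b
    scaled b = P.trans (P.sym (P.*-assoc [ inv lead ] r b)) (P.*-cong {[ inv lead ] *ₚ r} {poly a} {b} (pointwise λ i →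
      trans ([x]*-coeff (inv lead) r i) (sym (a≈ i))) P.refl)

  ∣-modulo : ∀ {x y} s a r b → y ≋ s *ₚ a +ₚ r → x ∣ y *ₚ b → x ∣ a *ₚ b → x ∣ r *ₚ b
  ∣-modulo s a r b y≈ x∣yb x∣ab = ∣-remainder
    (P.trans (P.*-congʳ y≈) (P.trans (P.distribʳ b (s *ₚ a) r) (P.+-congʳ (P.*-assoc s a b)))) x∣yb (∣-*ˡ s x∣ab)

  ∣-self : ∀ x b → x ∣ x *ₚ b
  ∣-self x b = b , P.*-comm b x

  -- Replacing a by p mod a lowers the degree, until a is a unit.
  euclid-monic : ∀ n p → Irreducible (poly p) → ∀ a → deg a ℕ.≤ n → deg a ℕ.< deg p →
                 ∀ b → poly p ∣ poly a *ₚ b → poly p ∣ b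
  euclid-monic n p irr a@(monic zero []) a≤n a<p b p∣ab = ∣-respʳ (P.*-identityˡ b) p∣ab
  euclid-monic (suc n) p irr a@(monic (suc d) v) (s≤s d≤n) a<p b p∣ab with divide a (poly p)
  ... | s , r , p≈ , r-below with degree? r
  -- A zero remainder would make `p` the product of `s` and `a` with deg a strictly between 0 and
  -- deg p, so that neither factor could be a unit.
  ...   | inj₁ r≈0 = ⊥-elim (cases (Irreducible.split-∣1 irr (at p≈sa)))
    where
    p≈sa : poly p ≋ s *ₚ poly a
    p≈sa = P.trans p≈ (P.trans (P.+-cong {s *ₚ poly a} {_} {r} {[]} P.refl (pointwise r≈0)) (P.+-identityʳ _))
    cases : ¬ (s ∣ᵣ [ 1# ] ⊎ poly a ∣ᵣ [ 1# ])
    cases (inj₂ a∣1) with () ← unit-degree (monic-degree a) a∣1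
    cases (inj₁ s∣1) with Factorisation.factors≢0 p (at p≈sa)
    ... | m , k , hs , ha with unit-degree hs s∣1 | degree-unique ha (monic-degree a)
    ...   | ≡.refl | ≡.refl = ℕ.<⇒≢ a<p (Factorisation.degree-sum p (at p≈sa) hs ha)
  ...   | inj₂ (m , h) with ∣-associate h
  ...     | a′ , ≡.refl , step = euclid-monic n p irr a′ (ℕ.≤-trans (ℕ.s≤s⁻¹ m<a) d≤n) (ℕ.<-trans m<a a<p) b
                                   (step b (∣-modulo s (poly a) r b p≈ (∣-self (poly p) b) p∣ab))
    where
    m<a : m ℕ.< suc d
    m<a = ℕ.≰⇒> λ a≤m → HasDegree.lead h (r-below m a≤m)

  -- If the remainder `r` of `x` modulo `p` vanishes, `p` divides `x`; otherwise `p` divides r b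
  -- with deg r < deg p, the case treated by `euclid-monic`.
  irreducible⇒prime : ∀ p → Irreducible (poly p) → ∀ x b → poly p ∣ x *ₚ b → poly p ∣ x ⊎ poly p ∣ b
  irreducible⇒prime p irr x b p∣xb with divide p x
  ... | s , r , x≈ , r-below with degree? r
  ...   | inj₁ r≈0 = inj₁ (s , P.sym (P.trans x≈ (P.trans (P.+-cong {s *ₚ poly p} {_} {r} {[]} P.refl (pointwise r≈0)) (P.+-identityʳ _))))
  ...   | inj₂ (m , h) with ∣-associate h
  ...     | a , ≡.refl , step = inj₂ (euclid-monic m p irr a ℕ.≤-refl
              (ℕ.≰⇒> λ p≤m → HasDegree.lead h (r-below m p≤m)) b (step b (∣-modulo s (poly p) r b x≈ p∣xb (∣-self (poly p) b))))

  -- `MonicPoly` fixes the shape of the coefficient list, whereas products and quotients may carry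
  -- trailing zeros; for these, monicity has to be a property invariant under `≋`.
  record IsMonic (x : Poly) (e : ℕ) : Set ℓ where
    constructor isMonic
    field
      below : Below (suc e) (coeff x)
      lead  : coeff x e ≈ 1#

  poly-isMonic : ∀ f → IsMonic (poly f) (deg f)
  poly-isMonic f = isMonic (monic-below (lower f)) (monic-lead (lower f))

  isMonic⇒hasDegree : ∀ {x e} → IsMonic x e → HasDegree x e
  isMonic⇒hasDegree (isMonic b l) = hasDegree b λ l≈0 → 1≉0 (trans (sym l) l≈0)

  below-* : ∀ {x y m n} → Below (suc m) (coeff x) → Below (suc n) (coeff y) → Below (suc (m ℕ.+ n)) (coeff (x *ₚ y))
  below-* {x} {y} bx by i le = trans (coeff-* x y i) (conv-below _ _ _ _ bx by i le)

  lead-* : ∀ {x y m n} → Below (suc m) (coeff x) → Below (suc n) (coeff y) → coeff (x *ₚ y) (m ℕ.+ n) ≈ coeff x m * coeff y n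
  lead-* {x} {y} {m} {n} bx by = trans (coeff-* x y (m ℕ.+ n)) (conv-top m n _ _ bx by)

  isMonic-* : ∀ {x y m n} → IsMonic x m → IsMonic y n → IsMonic (x *ₚ y) (m ℕ.+ n)
  isMonic-* {x} {y} (isMonic bx lx) (isMonic by ly) =
    isMonic (below-* {x} {y} bx by) (trans (lead-* {x} {y} bx by) (trans (*-cong lx ly) (*-identityˡ 1#)))

  hasDegree-* : ∀ {x y m n} → HasDegree x m → HasDegree y n → HasDegree (x *ₚ y) (m ℕ.+ n)
  hasDegree-* {x} {y} (hasDegree bx lx) (hasDegree by ly) =
    hasDegree (below-* {x} {y} bx by) λ e → *-nonzero lx ly (trans (sym (lead-* {x} {y} bx by)) e)

  hasDegree-resp : ∀ {x y m} → x ≋ y → HasDegree x m → HasDegree y m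
  hasDegree-resp e (hasDegree b l) = hasDegree (λ i le → trans (sym (at e i)) (b i le)) (λ l≈0 → l (trans (at e _) l≈0))

  isMonic-cofactor : ∀ {x y z m e} → IsMonic y m → IsMonic x e → z *ₚ x ≋ y → ∃[ k ] IsMonic z k × k ℕ.+ e ≡ m
  isMonic-cofactor {x} {y} {z} {m} {e} hy hx zx≈y with degree? z
  ... | inj₁ z≈0 = ⊥-elim (1≉0 (trans (sym (IsMonic.lead hy)) (trans (sym (at zx≈y m))
                     (trans (coeff-* z x m) (conv-zeroˡ {g = coeff x} z≈0 m)))))
  ... | inj₂ (k , hz) with degree-unique (hasDegree-resp zx≈y (hasDegree-* hz (isMonic⇒hasDegree hx))) (isMonic⇒hasDegree hy)
  ...   | ≡.refl = k , isMonic (HasDegree.below hz) lead-z , ≡.refl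
    where
    open SetoidReasoning setoid
    lead-z : coeff z k ≈ 1#
    lead-z = begin
      coeff z k                     ≈⟨ *-identityʳ _ ⟨
      coeff z k * 1#                ≈⟨ *-congˡ (IsMonic.lead hx) ⟨
      coeff z k * coeff x e         ≈⟨ lead-* {z} {x} (HasDegree.below hz) (IsMonic.below hx) ⟨
      coeff (z *ₚ x) (k ℕ.+ e)      ≈⟨ at zx≈y _ ⟩
      coeff y (k ℕ.+ e)             ≈⟨ IsMonic.lead hy ⟩
      1#                            ∎

  -- There are no zero divisors: if y - z had a degree, so would (y - z) x, which is zero.
  *-cancelʳ-monic : ∀ {x y z e} → IsMonic x e → y *ₚ x ≋ z *ₚ x → y ≋ z
  *-cancelʳ-monic {x} {y} {z} hx yx≈zx with degree? (y +ₚ (-ₚ z))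
  ... | inj₂ (m , h) = ⊥-elim (HasDegree.lead (hasDegree-* h (isMonic⇒hasDegree hx)) (at zero-product _))
    where
    zero-product : (y +ₚ (-ₚ z)) *ₚ x ≋ []
    zero-product = P.trans (P.distribʳ x y (-ₚ z))
      (P.trans (P.+-cong yx≈zx (P.sym (P.-‿distribˡ-* z x))) (P.-‿inverseʳ (z *ₚ x)))
  ... | inj₁ d≈0 = begin
    y                        ≈⟨ P.+-identityʳ y ⟨
    y +ₚ []                  ≈⟨ P.+-cong {y} P.refl (P.-‿inverseˡ z) ⟨
    y +ₚ ((-ₚ z) +ₚ z)       ≈⟨ P.+-assoc y (-ₚ z) z ⟨
    (y +ₚ (-ₚ z)) +ₚ z       ≈⟨ P.+-cong {y +ₚ (-ₚ z)} {[]} (pointwise d≈0) P.refl ⟩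
    z                        ∎
    where open SetoidReasoning P.setoid

-- Finite sums

module ListSum {c ℓ : Level} (M : CommutativeMonoid c ℓ) where

  open CommutativeMonoid M renaming (_∙_ to _+_; ε to 0#; ∙-cong to +-cong; identityˡ to +-identityˡ; identityʳ to +-identityʳ; assoc to +-assoc; commutativeSemigroup to +-commutativeSemigroup)
  open Mult M public using () renaming (_×_ to _·_)
  open CommutativeSemigroupProperties +-commutativeSemigroup using (interchange)

  private variable
    a b : Level
    A : Set a
    B : Set b

  -- The monoid is a parameter because the same lemmas serve sums in ℕ, sums in ℚ and, with
  -- multiplication as the operation, products in ℚ.
  ∑ : List A → (A → Carrier) → Carrier
  ∑ []       f = 0#
  ∑ (x ∷ xs) f = f x + ∑ xs f

  ∑-cong : ∀ (xs : List A) {f g} → (∀ {x} → x ∈ xs → f x ≈ g x) → ∑ xs f ≈ ∑ xs g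
  ∑-cong []       e = refl
  ∑-cong (x ∷ xs) e = +-cong (e (here ≡.refl)) (∑-cong xs (e ∘ there))

  ∑-0 : ∀ (xs : List A) → ∑ xs (λ _ → 0#) ≈ 0#
  ∑-0 []       = refl
  ∑-0 (x ∷ xs) = trans (+-identityˡ _) (∑-0 xs)

  ∑-+ : ∀ (xs : List A) f g → ∑ xs (λ x → f x + g x) ≈ ∑ xs f + ∑ xs g
  ∑-+ []       f g = sym (+-identityˡ 0#)
  ∑-+ (x ∷ xs) f g = trans (+-cong refl (∑-+ xs f g)) (interchange _ _ _ _)

  ∑-swap : ∀ (xs : List A) (ys : List B) (f : A → B → Carrier) → ∑ xs (λ x → ∑ ys (f x)) ≈ ∑ ys (λ y → ∑ xs (λ x → f x y))
  ∑-swap []       ys f = sym (∑-0 ys)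
  ∑-swap (x ∷ xs) ys f = trans (+-cong refl (∑-swap xs ys f)) (sym (∑-+ ys (f x) (λ y → ∑ xs (λ x → f x y))))

  ∑-++ : ∀ (xs ys : List A) f → ∑ (xs ++ ys) f ≈ ∑ xs f + ∑ ys f
  ∑-++ []       ys f = sym (+-identityˡ _)
  ∑-++ (x ∷ xs) ys f = trans (+-cong refl (∑-++ xs ys f)) (sym (+-assoc _ _ _))

  ∑-concatMap : ∀ (h : B → List A) ys f → ∑ (concatMap h ys) f ≈ ∑ ys (λ y → ∑ (h y) f)
  ∑-concatMap h []       f = refl
  ∑-concatMap h (y ∷ ys) f = trans (∑-++ (h y) (concatMap h ys) f) (+-cong refl (∑-concatMap h ys f))

  ∑-const : ∀ (xs : List A) x → ∑ xs (λ _ → x) ≡ length xs · x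
  ∑-const []       x = ≡.refl
  ∑-const (_ ∷ xs) x = ≡.cong (x +_) (∑-const xs x)

  ∑-upTo-suc : ∀ n f → ∑ (upTo (suc n)) f ≈ ∑ (upTo n) f + f n
  ∑-upTo-suc n f = trans (reflexive (≡.cong (λ xs → ∑ xs f) (≡.sym (List.upTo-∷ʳ n))))
    (trans (∑-++ (upTo n) [ n ] f) (+-cong refl (+-identityʳ _)))

  -- `upTo (suc n)` unfolds to 0 followed by `applyUpTo suc n`, which is not literally a `map` over
  -- `upTo n`; both sides are compared with a sum defined by recursion on n.
  ∑-applyUpTo : ∀ (h : ℕ → A) n f → ∑ (applyUpTo h n) f ≡ ∑ (upTo n) (f ∘ h)
  ∑-applyUpTo h n f = ≡.trans (go h n f) (≡.sym (go (λ i → i) n (f ∘ h)))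
    where
    sum : ℕ → (ℕ → Carrier) → Carrier
    sum zero    g = 0#
    sum (suc n) g = g 0 + sum n (g ∘ suc)
    go : ∀ {a} {A : Set a} (h : ℕ → A) n f → ∑ (applyUpTo h n) f ≡ sum n (f ∘ h)
    go h zero    f = ≡.refl
    go h (suc n) f = ≡.cong (f (h 0) +_) (go (h ∘ suc) n f)

  ∑-upTo-0 : ∀ n f → ∑ (upTo (suc n)) f ≡ f 0 + ∑ (upTo n) (f ∘ suc)
  ∑-upTo-0 n f = ≡.cong (f 0 +_) (∑-applyUpTo suc n f)

module _ {c ℓ c′ ℓ′ : Level} (M : CommutativeMonoid c ℓ) (N : CommutativeMonoid c′ ℓ′) where

  private
    module M = CommutativeMonoid M
    module N = CommutativeMonoid N

  ∑-homo : ∀ {a} {A : Set a} (h : M.Carrier → N.Carrier) → h M.ε N.≈ N.ε → (∀ x y → h (x M.∙ y) N.≈ h x N.∙ h y) →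
           ∀ (xs : List A) f → h (ListSum.∑ M xs f) N.≈ ListSum.∑ N xs (h ∘ f)
  ∑-homo h h-ε h-∙ []       f = h-ε
  ∑-homo h h-ε h-∙ (x ∷ xs) f = N.trans (h-∙ _ _) (N.∙-cong N.refl (∑-homo h h-ε h-∙ xs f))

module Indicator where

  open ListSum ℕ.+-0-commutativeMonoid using (∑; ∑-cong; ∑-0)

  𝟙 : ∀ {p} {P : Set p} → Dec P → ℕ
  𝟙 (yes _) = 1
  𝟙 (no _)  = 0

  𝟙-yes : ∀ {p} {P : Set p} → P → (d : Dec P) → 𝟙 d ≡ 1
  𝟙-yes p (yes _) = ≡.refl
  𝟙-yes p (no ¬p) = ⊥-elim (¬p p)

  𝟙-no : ∀ {p} {P : Set p} → ¬ P → (d : Dec P) → 𝟙 d ≡ 0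
  𝟙-no ¬p (yes p) = ⊥-elim (¬p p)
  𝟙-no ¬p (no _)  = ≡.refl

  𝟙-cong : ∀ {p r} {P : Set p} {R : Set r} → (P → R) → (R → P) → (d : Dec P) (e : Dec R) → 𝟙 d ≡ 𝟙 e
  𝟙-cong f g (yes p) e = ≡.sym (𝟙-yes (f p) e)
  𝟙-cong f g (no ¬p) e = ≡.sym (𝟙-no (¬p ∘ g) e)

  ∑-none : ∀ {a p} {A : Set a} {P : A → Set p} (P? : ∀ x → Dec (P x)) (xs : List A) →
           (∀ {y} → y ∈ xs → ¬ P y) → ∑ xs (𝟙 ∘ P?) ≡ 0
  ∑-none P? xs none = ≡.trans (∑-cong xs (λ {y} y∈ → 𝟙-no (none y∈) (P? y))) (∑-0 xs)

  -- Turns existence and uniqueness of a witness into a numerical equality, the form in which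
  -- bijections enter the double counts below.
  ∑-unique : ∀ {a p} {A : Set a} {P : A → Set p} (P? : ∀ x → Dec (P x)) {xs : List A} {x} → Unique xs →
             x ∈ xs → P x → (∀ {y} → y ∈ xs → P y → y ≡ x) → ∑ xs (𝟙 ∘ P?) ≡ 1
  ∑-unique P? {x ∷ xs} (x∉ ∷ uniq) (here ≡.refl) px only = ≡.cong₂ ℕ._+_ (𝟙-yes px (P? x))
    (∑-none P? xs λ y∈ py → All.lookup x∉ y∈ (≡.sym (only (there y∈) py)))
  ∑-unique P? {z ∷ xs} {x} (z∉ ∷ uniq) (there x∈) px only = ≡.cong₂ ℕ._+_
    (𝟙-no (λ pz → All.lookup z∉ x∈ (only (here ≡.refl) pz)) (P? z)) (∑-unique P? uniq x∈ px (only ∘ there))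

open Indicator using (𝟙; 𝟙-yes; 𝟙-no; 𝟙-cong; ∑-none; ∑-unique)

-- Counting irreducible polynomials

module CanonicalMonics {c ℓ : Level} {q : ℕ} (F : FiniteField c ℓ q) where

  open FiniteField F
  open Polynomials F
  open PolynomialRing F
  open Divisibility F

  -- Setoid equality of coefficients is coarser than `≡`, but the enumeration lists one
  -- representative per class. This is what allows entries of the lists to be counted with `Unique`.
  elements-canonical : ∀ {x y} → x ∈ elements → y ∈ elements → x ≈ y → x ≡ y
  elements-canonical x∈ y∈ x≈y with ∈-map⁻ from x∈ | ∈-map⁻ from y∈
  ... | i , _ , ≡.refl | j , _ , ≡.refl = ≡.cong from
    (≡.trans (≡.sym (Inverse.inverseˡ enumeration refl)) (≡.trans (Inverse.to-cong enumeration x≈y) (Inverse.inverseˡ enumeration refl)))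

  vectors-canonical : ∀ d {v w} → v ∈ vectors d → w ∈ vectors d → poly (monic d v) ≈ₚ poly (monic d w) → v ≡ w
  vectors-canonical zero    {[]} {[]} v∈ w∈ e = ≡.refl
  vectors-canonical (suc d) v∈ w∈ e
    with ∈-cartesianProductWith⁻ _∷_ elements (vectors d) v∈ | ∈-cartesianProductWith⁻ _∷_ elements (vectors d) w∈
  ... | x , v , x∈ , v∈′ , ≡.refl | y , w , y∈ , w∈′ , ≡.refl =
    ≡.cong₂ _∷_ (elements-canonical x∈ y∈ (e 0)) (vectors-canonical d v∈′ w∈′ (e ∘ suc))

  ∈-degree : ∀ {m f} → f ∈ monicsOfDegree m → deg f ≡ m
  ∈-degree f∈ with ∈-map⁻ (monic _) f∈
  ... | _ , _ , ≡.refl = ≡.refl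

  canonical : ∀ {m n f g} → f ∈ monicsOfDegree m → g ∈ monicsOfDegree n → poly f ≋ poly g → f ≡ g
  canonical {f = f} {g} f∈ g∈ e with ∈-map⁻ (monic _) f∈ | ∈-map⁻ (monic _) g∈
  ... | v , v∈ , ≡.refl | w , w∈ , ≡.refl
    with degree-unique (hasDegree-resp e (monic-degree f)) (monic-degree g)
  ...   | ≡.refl = ≡.cong (monic _) (vectors-canonical _ v∈ w∈ (at e))

  representative : ∀ {x e} → IsMonic x e → ∃[ f ] f ∈ monicsOfDegree e × poly f ≋ x
  representative {x} {e} (isMonic b l) =
    monic e (truncate e (coeff x)) , ∈-map⁺ (monic e) (truncate-∈ e (coeff x)) , pointwise (truncate-≈ e (coeff x) l b)

  ∈-monics≤ : ∀ {m n f} → m ℕ.≤ n → f ∈ monicsOfDegree m → f ∈ monics≤ n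
  ∈-monics≤ m≤n f∈ = ∈-concatMap⁺ monicsOfDegree (lose (∈-upTo⁺ (s≤s m≤n)) f∈)

  monics≤-∈⁻ : ∀ n {f} → f ∈ monics≤ n → deg f ℕ.≤ n × f ∈ monicsOfDegree (deg f)
  monics≤-∈⁻ n f∈ with find (∈-concatMap⁻ monicsOfDegree {xs = upTo (suc n)} f∈)
  ... | m , m∈ , f∈m with ∈-degree f∈m
  ...   | ≡.refl = ℕ.s≤s⁻¹ (∈-upTo⁻ m∈) , f∈m

  elements-unique : Unique elements
  elements-unique = Unique.map⁺ (λ {i} {j} e → ≡.trans (≡.sym (Inverse.inverseˡ enumeration refl))
    (≡.trans (≡.cong to e) (Inverse.inverseˡ enumeration refl))) (Unique.allFin⁺ q)

  vectors-unique : ∀ d → Unique (vectors d)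
  vectors-unique zero    = All.[] ∷ []
  vectors-unique (suc d) = Unique.cartesianProductWith⁺ _∷_ ∷-injective elements-unique (vectors-unique d)

  monicsOfDegree-unique : ∀ d → Unique (monicsOfDegree d)
  monicsOfDegree-unique d = Unique.map⁺ (λ { ≡.refl → ≡.refl }) (vectors-unique d)

  monics≤-unique : ∀ n → Unique (monics≤ n)
  monics≤-unique n = Unique.concat⁺ (All.map⁺ (All.universal monicsOfDegree-unique (upTo (suc n))))
    (AllPairs.map⁺ (AllPairs.applyUpTo⁺₁ (λ i → i) (suc n)
      (λ i<j _ (f∈i , f∈j) → ℕ.<⇒≢ i<j (≡.trans (≡.sym (∈-degree f∈i)) (∈-degree f∈j)))))

  length-cartesian : ∀ {a b c} {A : Set a} {B : Set b} {C : Set c} (f : A → B → C) xs ys →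
                     length (cartesianProductWith f xs ys) ≡ length xs ℕ.* length ys
  length-cartesian f []       ys = ≡.refl
  length-cartesian f (x ∷ xs) ys = ≡.trans (List.length-++ (map (f x) ys))
    (≡.cong₂ ℕ._+_ (List.length-map (f x) ys) (length-cartesian f xs ys))

  length-monicsOfDegree : ∀ d → length (monicsOfDegree d) ≡ q ℕ.^ d
  length-monicsOfDegree d = ≡.trans (List.length-map (monic d) (vectors d)) (length-vectors d)
    where
    length-vectors : ∀ d → length (vectors d) ≡ q ℕ.^ d
    length-vectors zero    = ≡.refl
    length-vectors (suc d) = ≡.trans (length-cartesian _∷_ elements (vectors d))
      (≡.cong₂ ℕ._*_ (≡.trans (List.length-map from (allFin q)) (List.length-tabulate {n = q} (λ i → i))) (length-vectors d))

  _≋?_ : ∀ x y → Dec (x ≋ y)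
  x ≋? y = map′ pointwise at (poly≈? x y)

  cofactor : ∀ {x e} → IsMonic x e → ∀ f → x ∣ poly f →
             ∃[ k ] k ℕ.+ e ≡ deg f × (∃[ g ] g ∈ monicsOfDegree k × poly g *ₚ x ≋ poly f)
  cofactor {x} hx f (z , zx≈f) with isMonic-cofactor {z = z} (poly-isMonic f) hx zx≈f
  ... | k , hz , k+e≡ with representative hz
  ...   | g , g∈ , g≈z = k , k+e≡ , g , g∈ , P.trans (P.*-cong {poly g} {z} {x} g≈z P.refl) zx≈f

  -- The cofactor of a monic divisor is monic of degree at most `deg f`, so an exhaustive search
  -- through the representatives decides divisibility.
  divides? : ∀ {x e} → IsMonic x e → ∀ f → Dec (x ∣ poly f)
  divides? {x} {e} hx f = map′ (λ a → let g , _ , gx≈f = find a in poly g , gx≈f) complete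
    (any? (λ g → (poly g *ₚ x) ≋? poly f) (monics≤ (deg f)))
    where
    complete : x ∣ poly f → Any (λ g → poly g *ₚ x ≋ poly f) (monics≤ (deg f))
    complete x∣f with cofactor hx f x∣f
    ... | k , k+e≡ , g , g∈ , gx≈f = lose (∈-monics≤ (ℕ.≤-trans (ℕ.m≤m+n k e) (ℕ.≤-reflexive k+e≡)) g∈) gx≈f

  open ListSum ℕ.+-0-commutativeMonoid

  -- The number of monic polynomials of degree m divisible by a given one of degree e.
  multiples : ℕ → ℕ → ℕ
  multiples zero    m       = q ℕ.^ m
  multiples (suc e) zero    = 0
  multiples (suc e) (suc m) = multiples e m

  multiples-+ : ∀ k e → multiples e (k ℕ.+ e) ≡ q ℕ.^ k
  multiples-+ k zero    = ≡.cong (q ℕ.^_) (ℕ.+-identityʳ k)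
  multiples-+ k (suc e) = ≡.trans (≡.cong (multiples (suc e)) (ℕ.+-suc k e)) (multiples-+ k e)

  multiples-> : ∀ {e m} → m ℕ.< e → multiples e m ≡ 0
  multiples-> {suc e} {zero}  _         = ≡.refl
  multiples-> {suc e} {suc m} (s≤s m<e) = multiples-> m<e

  -- Double count of the pairs (f , g) with g x ≋ f and g monic of degree m - e: each multiple f has
  -- exactly one cofactor g by cancellation, and each g has exactly one product f.
  count-multiples : ∀ {x e} (hx : IsMonic x e) m → ∑ (monicsOfDegree m) (λ f → 𝟙 (divides? hx f)) ≡ multiples e m
  count-multiples {x} {e} hx m with e ℕ.≤? m
  ... | no e≰m = ≡.trans (∑-none (divides? hx) (monicsOfDegree m) none) (≡.sym (multiples-> (ℕ.≰⇒> e≰m)))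
    where
    none : ∀ {f} → f ∈ monicsOfDegree m → ¬ x ∣ poly f
    none {f} f∈ x∣f with cofactor hx f x∣f
    ... | k , k+e≡ , _ = e≰m (ℕ.≤-trans (ℕ.m≤n+m e k) (ℕ.≤-reflexive (≡.trans k+e≡ (∈-degree f∈))))
  ... | yes e≤m = begin
    ∑ L (λ f → 𝟙 (divides? hx f))                            ≡⟨ ∑-cong L by-cofactor ⟩
    ∑ L (λ f → ∑ G (λ g → 𝟙 ((poly g *ₚ x) ≋? poly f)))      ≡⟨ ∑-swap L G (λ f g → 𝟙 ((poly g *ₚ x) ≋? poly f)) ⟩
    ∑ G (λ g → ∑ L (λ f → 𝟙 ((poly g *ₚ x) ≋? poly f)))      ≡⟨ ∑-cong G by-multiple ⟩
    ∑ G (λ _ → 1)                                            ≡⟨ ∑-1 G ⟩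
    length G                                                 ≡⟨ length-monicsOfDegree k ⟩
    q ℕ.^ k                                                  ≡⟨ multiples-+ k e ⟨
    multiples e (k ℕ.+ e)                                    ≡⟨ ≡.cong (multiples e) k+e≡m ⟩
    multiples e m                                            ∎
    where
    open ≡.≡-Reasoning
    k = m ℕ.∸ e
    k+e≡m : k ℕ.+ e ≡ m
    k+e≡m = ℕ.m∸n+n≡m e≤m
    L = monicsOfDegree m
    G = monicsOfDegree k
    ∑-1 : ∀ (xs : List MonicPoly) → ∑ xs (λ _ → 1) ≡ length xs
    ∑-1 []       = ≡.refl
    ∑-1 (_ ∷ xs) = ≡.cong suc (∑-1 xs)
    by-cofactor : ∀ {f} → f ∈ L → 𝟙 (divides? hx f) ≡ ∑ G (λ g → 𝟙 ((poly g *ₚ x) ≋? poly f))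
    by-cofactor {f} f∈ with divides? hx f
    ... | no x∤f = ≡.sym (∑-none (λ g → (poly g *ₚ x) ≋? poly f) G (λ {g} _ gx≈f → x∤f (poly g , gx≈f)))
    ... | yes x∣f with cofactor hx f x∣f
    ...   | k′ , k′+e≡ , g , g∈ , gx≈f with ℕ.+-cancelʳ-≡ e k′ k (≡.trans k′+e≡ (≡.trans (∈-degree f∈) (≡.sym k+e≡m)))
    ...     | ≡.refl = ≡.sym (∑-unique (λ g → (poly g *ₚ x) ≋? poly f) (monicsOfDegree-unique k) g∈ gx≈f
                (λ g′∈ g′x≈f → canonical g′∈ g∈ (*-cancelʳ-monic hx (P.trans g′x≈f (P.sym gx≈f)))))
    by-multiple : ∀ {g} → g ∈ G → ∑ L (λ f → 𝟙 ((poly g *ₚ x) ≋? poly f)) ≡ 1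
    by-multiple {g} g∈ with representative (isMonic-* (poly-isMonic g) hx)
    ... | f , f∈ , f≈gx = ∑-unique (λ f → (poly g *ₚ x) ≋? poly f) (monicsOfDegree-unique m)
        (≡.subst (λ d → f ∈ monicsOfDegree d) (≡.trans (≡.cong (ℕ._+ e) (∈-degree g∈)) k+e≡m) f∈) (P.sym f≈gx)
        (λ f′∈ gx≈f′ → canonical f′∈ f∈ (P.trans (P.sym gx≈f′) (P.sym f≈gx)))

-- Multiplicities of irreducible factors

module PrimeCounting {c ℓ : Level} {q : ℕ} (F : FiniteField c ℓ q) where

  open FiniteField F using (1#)
  open Polynomials F
  open PolynomialRing F
  open Divisibility F
  open CanonicalMonics F
  open ListSum ℕ.+-0-commutativeMonoid

  pow : Poly → ℕ → Poly
  pow x zero    = [ 1# ]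
  pow x (suc k) = x *ₚ pow x k

  isMonic-pow : ∀ {x e} → IsMonic x e → ∀ k → IsMonic (pow x k) (k ℕ.* e)
  isMonic-pow h zero    = poly-isMonic (monic 0 [])
  isMonic-pow h (suc k) = isMonic-* h (isMonic-pow h k)

  ∣-degree : ∀ {x e m f} → IsMonic x e → f ∈ monicsOfDegree m → x ∣ poly f → e ℕ.≤ m
  ∣-degree {e = e} {f = f} hx f∈ x∣f with cofactor hx f x∣f
  ... | k , k+e≡ , _ = ℕ.≤-trans (ℕ.m≤n+m e k) (ℕ.≤-reflexive (≡.trans k+e≡ (∈-degree f∈)))

  irreducible-degree : ∀ p → Irreducible (poly p) → 1 ℕ.≤ deg p
  irreducible-degree (monic zero v)    irr = ⊥-elim (Irreducible.p∤1 irr (unit _ (monic-degree (monic zero v))))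
  irreducible-degree (monic (suc _) _) irr = s≤s z≤n

  ∣-trans-*ʳ : ∀ {x a b y} → y ≋ a *ₚ b → x ∣ a → x ∣ y
  ∣-trans-*ʳ {x} {a} {b} y≈ab x∣a = ∣-respʳ (P.trans (P.*-comm b a) (P.sym y≈ab)) (∣-*ˡ b x∣a)

  irreducibles≤-∈⁻ : ∀ n {p} → p ∈ irreducibles≤ n → deg p ℕ.≤ n × p ∈ monicsOfDegree (deg p) × Irreducible (poly p)
  irreducibles≤-∈⁻ n p∈ with ∈-filter⁻ irreducible? {xs = monics≤ n} p∈
  ... | p∈′ , irr with monics≤-∈⁻ n p∈′
  ...   | p≤n , p∈d = p≤n , p∈d , irr

  irreducible-factor : ∀ n {m f} → 1 ℕ.≤ m → m ℕ.≤ n → f ∈ monicsOfDegree m →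
                       ∃[ p ] p ∈ irreducibles≤ n × poly p ∣ poly f
  irreducible-factor n {m} {f} 1≤m m≤n f∈ with ∈-degree f∈
  ... | ≡.refl with reducible? f
  ...   | no ¬red = f , ∈-filter⁺ irreducible? (∈-monics≤ m≤n f∈)
            (mkIrred (nonunit (poly f) 1≤m (monic-degree f)) (λ f≈xy → Factorisation.split f f≈xy ¬red))
            , [ 1# ] , P.*-identityˡ (poly f)
  irreducible-factor zero 1≤m m≤n f∈ | ≡.refl | yes red = ⊥-elim (ℕ.<⇒≱ 1≤m m≤n)
  irreducible-factor (suc n) {f = f} 1≤m m≤n f∈ | ≡.refl | yes red with find red
  ... | a , a∈ , red′ with find red′
  ...   | b , _ , 1≤a , 1≤b , f≈ab with irreducible-factor n 1≤a a≤n (proj₂ (monics≤-∈⁻ (deg f) a∈))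
    where
    a≤n : deg a ℕ.≤ n
    a≤n = ℕ.s≤s⁻¹ (begin
      suc (deg a)       ≡⟨ ℕ.+-comm 1 (deg a) ⟩
      deg a ℕ.+ 1       ≤⟨ ℕ.+-monoʳ-≤ (deg a) 1≤b ⟩
      deg a ℕ.+ deg b   ≡⟨ Factorisation.degree-sum f f≈ab (monic-degree a) (monic-degree b) ⟩
      deg f             ≤⟨ m≤n ⟩
      suc n             ∎)
      where open ℕ.≤-Reasoning
  ...     | p , p∈ , p∣a with irreducibles≤-∈⁻ n p∈
  ...       | p≤n , p∈d , irr = p , ∈-filter⁺ irreducible? (∈-monics≤ (ℕ.m≤n⇒m≤1+n p≤n) p∈d) irr , ∣-trans-*ʳ {b = poly b} (pointwise f≈ab) p∣a

  -- The cofactor is a unit by irreducibility, and a monic unit is 1; `canonical` then turns `≋`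
  -- into `≡`.
  irreducible-∣-irreducible : ∀ {m n p r} → p ∈ monicsOfDegree m → r ∈ monicsOfDegree n →
                              Irreducible (poly p) → Irreducible (poly r) → poly p ∣ poly r → p ≡ r
  irreducible-∣-irreducible {p = p} {r} p∈ r∈ irr-p irr-r (z , zp≈r) with Irreducible.split-∣1 irr-r (at (P.sym zp≈r))
  ... | inj₂ p∣1 = ⊥-elim (Irreducible.p∤1 irr-p p∣1)
  ... | inj₁ z∣1 with isMonic-cofactor {z = z} (poly-isMonic r) (poly-isMonic p) zp≈r
  ...   | k , hz , _ with unit-degree (isMonic⇒hasDegree hz) z∣1
  ...     | ≡.refl = canonical p∈ r∈ (P.trans (P.sym (P.*-identityˡ (poly p))) (P.trans (P.*-cong {[ 1# ]} {z} (P.sym z≈1) P.refl) zp≈r))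
    where
    z≈1 : z ≋ [ 1# ]
    z≈1 = pointwise λ { zero → IsMonic.lead hz ; (suc i) → IsMonic.below hz (suc i) (s≤s z≤n) }

  -- One factor `p` is removed at a time: primality moves it into `y`, and cancelling it leaves the
  -- same claim for the exponent k.
  pow-coprime : ∀ p → Irreducible (poly p) → ∀ {r} → ¬ poly p ∣ r → ∀ k y → pow (poly p) k ∣ y *ₚ r → pow (poly p) k ∣ y
  pow-coprime p irr p∤r zero    y _ = y , P.*-identityʳ y
  pow-coprime p irr {r} p∤r (suc k) y (z , zpp≈yr) with irreducible⇒prime p irr y r (∣-respʳ zpp≈yr′ (z *ₚ pow (poly p) k , P.refl))
    where
    zpp≈yr′ : (z *ₚ pow (poly p) k) *ₚ poly p ≋ y *ₚ r
    zpp≈yr′ = P.trans (P.*-assoc z _ (poly p)) (P.trans (P.*-cong {z} P.refl (P.*-comm _ (poly p))) zpp≈yr)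
  ... | inj₂ p∣r = ⊥-elim (p∤r p∣r)
  ... | inj₁ (w , wp≈y) with pow-coprime p irr p∤r k w (z , *-cancelʳ-monic (poly-isMonic p) (begin
    (z *ₚ pk) *ₚ poly p    ≈⟨ P.*-assoc z pk (poly p) ⟩
    z *ₚ (pk *ₚ poly p)    ≈⟨ P.*-cong {z} P.refl (P.*-comm pk (poly p)) ⟩
    z *ₚ (poly p *ₚ pk)    ≈⟨ zpp≈yr ⟩
    y *ₚ r                 ≈⟨ P.*-cong wp≈y P.refl ⟨
    (w *ₚ poly p) *ₚ r     ≈⟨ P.*-assoc w (poly p) r ⟩
    w *ₚ (poly p *ₚ r)     ≈⟨ P.*-cong {w} P.refl (P.*-comm (poly p) r) ⟩
    w *ₚ (r *ₚ poly p)     ≈⟨ P.*-assoc w r (poly p) ⟨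
    (w *ₚ r) *ₚ poly p     ∎))
    where
    open SetoidReasoning P.setoid
    pk = pow (poly p) k
  ...   | u , upk≈w = u , P.trans (P.*-cong {u} P.refl (P.*-comm (poly p) _))
            (P.trans (P.sym (P.*-assoc u _ (poly p))) (P.trans (P.*-cong upk≈w P.refl) wp≈y))

  power-divides? : ∀ p k f → Dec (pow (poly p) k ∣ poly f)
  power-divides? p k = divides? (isMonic-pow (poly-isMonic p) k)

  -- The exponent of p in f, provided it is at most N.
  multiplicity : ℕ → MonicPoly → MonicPoly → ℕ
  multiplicity N p f = ∑ (upTo N) (λ k → 𝟙 (power-divides? p (suc k) f))

  module _ {N m k : ℕ} {f g r : MonicPoly} (m≤N : m ℕ.≤ N) (f∈ : f ∈ monicsOfDegree m) (g∈ : g ∈ monicsOfDegree k)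
           (r∈ : r ∈ irreducibles≤ N) (k+r≡m : k ℕ.+ deg r ≡ m) (gr≈f : poly g *ₚ poly r ≋ poly f) where

    private
      r∈′ = proj₂ (irreducibles≤-∈⁻ N r∈)
      1≤r = irreducible-degree r (proj₂ r∈′)

    -- As r^(j + 1) divides f = g r exactly when r^j divides g, the indicator sum is shifted by one
    -- place: it gains the term for j = 0, which is 1, and loses the last one, which is 0 by
    -- degrees.
    multiplicity-self : multiplicity N r f ≡ multiplicity N r g ℕ.+ 1
    multiplicity-self = go N ≡.refl
      where
      open SetoidReasoning P.setoid
      r^ = pow (poly r)
      divides-suc : ∀ j → r^ (suc j) ∣ poly f → r^ j ∣ poly g
      divides-suc j (z , e) = z , *-cancelʳ-monic (poly-isMonic r) (begin
        (z *ₚ r^ j) *ₚ poly r      ≈⟨ P.*-assoc z (r^ j) (poly r) ⟩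
        z *ₚ (r^ j *ₚ poly r)      ≈⟨ P.*-cong {z} P.refl (P.*-comm (r^ j) (poly r)) ⟩
        z *ₚ r^ (suc j)            ≈⟨ P.trans e (P.sym gr≈f) ⟩
        poly g *ₚ poly r           ∎)
      suc-divides : ∀ j → r^ j ∣ poly g → r^ (suc j) ∣ poly f
      suc-divides j (z , e) = z , (begin
        z *ₚ (poly r *ₚ r^ j)      ≈⟨ P.*-cong {z} P.refl (P.*-comm (poly r) (r^ j)) ⟩
        z *ₚ (r^ j *ₚ poly r)      ≈⟨ P.*-assoc z (r^ j) (poly r) ⟨
        (z *ₚ r^ j) *ₚ poly r      ≈⟨ P.*-cong e P.refl ⟩
        poly g *ₚ poly r           ≈⟨ gr≈f ⟩
        poly f                     ∎)
      k<N : k ℕ.< N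
      k<N = ℕ.<-≤-trans (ℕ.<-≤-trans (ℕ.m<m+n k 1≤r) (ℕ.≤-reflexive k+r≡m)) m≤N
      -- `N` is a parameter of the module and is therefore matched through an equation; N = 0
      -- contradicts k < N.
      go : ∀ M → M ≡ N → multiplicity M r f ≡ multiplicity M r g ℕ.+ 1
      go zero    ≡.refl with () ← k<N
      go (suc M) ≡.refl = ≡.trans (∑-cong (upTo (suc M)) (λ {j} _ → 𝟙-cong (divides-suc j) (suc-divides j)
                                     (power-divides? r (suc j) f) (power-divides? r j g)))
        (≡.trans (∑-upTo-0 M (λ j → 𝟙 (power-divides? r j g)))
        (≡.trans (≡.cong (ℕ._+ multiplicity M r g) (𝟙-yes (poly g , P.*-identityʳ (poly g)) (power-divides? r 0 g)))
        (≡.trans (ℕ.+-comm 1 (multiplicity M r g)) (≡.cong (ℕ._+ 1)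
        (≡.sym (≡.trans (∑-upTo-suc M (λ j → 𝟙 (power-divides? r (suc j) g)))
          (≡.trans (≡.cong (multiplicity M r g ℕ.+_) (𝟙-no too-big (power-divides? r (suc M) g))) (ℕ.+-identityʳ _))))))))
        where
        too-big : ¬ r^ (suc M) ∣ poly g
        too-big d = ℕ.<⇒≱ k<N (ℕ.≤-trans (ℕ.m≤m*n (suc M) (deg r) {{ℕ.>-nonZero 1≤r}})
          (∣-degree (isMonic-pow (poly-isMonic r) (suc M)) g∈ d))

    multiplicity-other : ∀ {p} → p ∈ irreducibles≤ N → ¬ p ≡ r → multiplicity N p f ≡ multiplicity N p g
    multiplicity-other {p} p∈ p≢r = ∑-cong (upTo N) λ {j} _ → 𝟙-cong
      (λ d → pow-coprime p (proj₂ p∈′) p∤r (suc j) (poly g) (∣-respʳ (P.sym gr≈f) d))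
      (∣-trans-*ʳ {b = poly r} (P.sym gr≈f)) (power-divides? p (suc j) f) (power-divides? p (suc j) g)
      where
      p∈′ = proj₂ (irreducibles≤-∈⁻ N p∈)
      p∤r : ¬ poly p ∣ poly r
      p∤r = p≢r ∘ irreducible-∣-irreducible (proj₁ p∈′) (proj₁ r∈′) (proj₂ p∈′) (proj₂ r∈′)

  irreducibles≤-unique : ∀ N → Unique (irreducibles≤ N)
  irreducibles≤-unique N = Unique.filter⁺ irreducible? (monics≤-unique N)

  ∑-*ˡ : ∀ {a} {A : Set a} x (xs : List A) f → x ℕ.* ∑ xs f ≡ ∑ xs (λ y → x ℕ.* f y)
  ∑-*ˡ x = ∑-homo ℕ.+-0-commutativeMonoid ℕ.+-0-commutativeMonoid (x ℕ.*_) (ℕ.*-zeroʳ x) (ℕ.*-distribˡ-+ x)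

  -- Peeling one irreducible factor `r` off `f` raises the multiplicity of `r` by one and leaves the
  -- others alone, so the sum changes by `deg r`. The recursion runs on `n`, while `N` stays fixed
  -- so that the lists of irreducibles and exponents do not vary.
  degree-multiplicities : ∀ N n {m f} → m ℕ.≤ n → m ℕ.≤ N → f ∈ monicsOfDegree m →
                          ∑ (irreducibles≤ N) (λ p → deg p ℕ.* multiplicity N p f) ≡ m
  degree-multiplicities N n {zero} {f} _ _ f∈ = ≡.trans (∑-cong (irreducibles≤ N) λ {p} p∈ →
      ≡.trans (≡.cong (deg p ℕ.*_) (∑-none (λ k → power-divides? p (suc k) f) (upTo N) λ {k} _ d →
        ℕ.<⇒≱ (ℕ.≤-trans (irreducible-degree p (proj₂ (proj₂ (irreducibles≤-∈⁻ N p∈)))) (ℕ.m≤m+n (deg p) (k ℕ.* deg p)))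
          (∣-degree (isMonic-pow (poly-isMonic p) (suc k)) f∈ d)))
      (ℕ.*-zeroʳ (deg p))) (∑-0 (irreducibles≤ N))
  degree-multiplicities N (suc n) {m@(suc _)} {f} m≤n m≤N f∈ with irreducible-factor N (s≤s z≤n) m≤N f∈
  ... | r , r∈ , r∣f with cofactor (poly-isMonic r) f r∣f
  ...   | k , k+r≡ , g , g∈ , gr≈f = begin
    ∑ I (λ p → deg p ℕ.* multiplicity N p f)
      ≡⟨ ∑-cong I step ⟩
    ∑ I (λ p → deg p ℕ.* multiplicity N p g ℕ.+ deg r ℕ.* 𝟙 (poly p ≋? poly r))
      ≡⟨ ∑-+ I _ _ ⟩
    ∑ I (λ p → deg p ℕ.* multiplicity N p g) ℕ.+ ∑ I (λ p → deg r ℕ.* 𝟙 (poly p ≋? poly r))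
      ≡⟨ ≡.cong₂ ℕ._+_ (degree-multiplicities N n k≤n (ℕ.≤-trans k≤m m≤N) g∈) (≡.sym (∑-*ˡ (deg r) I _)) ⟩
    k ℕ.+ deg r ℕ.* ∑ I (λ p → 𝟙 (poly p ≋? poly r))
      ≡⟨ ≡.cong (λ z → k ℕ.+ deg r ℕ.* z) (∑-unique (λ p → poly p ≋? poly r) (irreducibles≤-unique N) r∈ P.refl (≋⇒≡ r∈)) ⟩
    k ℕ.+ deg r ℕ.* 1
      ≡⟨ ≡.trans (≡.cong (k ℕ.+_) (ℕ.*-identityʳ (deg r))) k+r≡m ⟩
    m ∎
    where
    open ≡.≡-Reasoning
    I = irreducibles≤ N
    k+r≡m : k ℕ.+ deg r ≡ m
    k+r≡m = ≡.trans k+r≡ (∈-degree f∈)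
    k<m : k ℕ.< m
    k<m = ℕ.<-≤-trans (ℕ.m<m+n k (irreducible-degree r (proj₂ (proj₂ (irreducibles≤-∈⁻ N r∈))))) (ℕ.≤-reflexive k+r≡m)
    k≤m = ℕ.<⇒≤ k<m
    k≤n : k ℕ.≤ n
    k≤n = ℕ.s≤s⁻¹ (ℕ.≤-trans k<m m≤n)
    ≋⇒≡ : ∀ {p r} → r ∈ I → p ∈ I → poly p ≋ poly r → p ≡ r
    ≋⇒≡ r∈ p∈ = canonical (proj₁ (proj₂ (irreducibles≤-∈⁻ N p∈))) (proj₁ (proj₂ (irreducibles≤-∈⁻ N r∈)))
    step : ∀ {p} → p ∈ I → deg p ℕ.* multiplicity N p f ≡ deg p ℕ.* multiplicity N p g ℕ.+ deg r ℕ.* 𝟙 (poly p ≋? poly r)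
    step {p} p∈ with poly p ≋? poly r
    ... | no p≉r = ≡.trans (≡.cong (deg p ℕ.*_) (multiplicity-other m≤N f∈ g∈ r∈ k+r≡m gr≈f p∈ λ { ≡.refl → p≉r P.refl }))
      (≡.sym (≡.trans (≡.cong (deg p ℕ.* multiplicity N p g ℕ.+_) (ℕ.*-zeroʳ (deg r))) (ℕ.+-identityʳ _)))
    ... | yes p≈r with ≋⇒≡ r∈ p∈ p≈r
    ...   | ≡.refl = ≡.trans (≡.cong (deg p ℕ.*_) (multiplicity-self m≤N f∈ g∈ r∈ k+r≡m gr≈f)) (ℕ.*-distribˡ-+ (deg p) _ 1)

  π : ℕ → ℕ
  π d = length (filter irreducible? (monicsOfDegree d))

-- Gauss' formula for the number of irreducibles

module PrimePolynomialTheorem {c ℓ : Level} {q : ℕ} (F : FiniteField c ℓ q) where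

  open Polynomials F
  open Divisibility F
  open CanonicalMonics F
  open PrimeCounting F

  module _ {c′ ℓ′ : Level} (M : CommutativeMonoid c′ ℓ′) where

    open CommutativeMonoid M using (_≈_; _∙_; ε; ∙-cong; refl; sym; trans; reflexive; identityˡ; assoc; setoid) renaming (Carrier to C)
    open ListSum M

    -- Stated for any commutative monoid, since it is applied to weights in ℕ, to logarithms in ℚ
    -- and to the product itself.
    ∑-by-degree : ∀ N (φ : ℕ → C) → ∑ (irreducibles≤ N) (φ ∘ deg) ≈ ∑ (upTo (suc N)) (λ d → π d · φ d)
    ∑-by-degree N φ = trans (reflexive (≡.cong (λ ps → ∑ ps (φ ∘ deg)) (filter-concatMap (upTo (suc N)))))
      (trans (∑-concatMap (filter irreducible? ∘ monicsOfDegree) (upTo (suc N)) (φ ∘ deg))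
        (∑-cong (upTo (suc N)) λ {d} _ → trans (∑-cong (filter irreducible? (monicsOfDegree d))
          λ p∈ → reflexive (≡.cong φ (∈-degree (proj₁ (∈-filter⁻ irreducible? {xs = monicsOfDegree d} p∈)))))
          (reflexive (∑-const (filter irreducible? (monicsOfDegree d)) (φ d)))))
      where
      filter-concatMap : ∀ ds → filter irreducible? (concatMap monicsOfDegree ds) ≡ concatMap (filter irreducible? ∘ monicsOfDegree) ds
      filter-concatMap []       = ≡.refl
      filter-concatMap (d ∷ ds) = ≡.trans (List.filter-++ irreducible? (monicsOfDegree d) (concatMap monicsOfDegree ds))
        (≡.cong (filter irreducible? (monicsOfDegree d) ++_) (filter-concatMap ds))

  open ListSum ℕ.+-0-commutativeMonoid

  ·≡* : ∀ n x → n · x ≡ n ℕ.* x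
  ·≡* zero    x = ≡.refl
  ·≡* (suc n) x = ≡.cong (x ℕ.+_) (·≡* n x)

  -- The count for degree m + 1 is q times the one for degree m, apart from a new contribution when
  -- e = m + 1. Subtracting q times the identity for degree m from that for m + 1 thus isolates the
  -- prime powers of degree exactly m + 1.
  multiples-suc : ∀ e m → multiples e (suc m) ≡ q ℕ.* multiples e m ℕ.+ 𝟙 (e ℕ.≟ suc m)
  multiples-suc zero          m       = ≡.sym (ℕ.+-identityʳ _)
  multiples-suc (suc zero)    zero    = ≡.sym (≡.cong (ℕ._+ 1) (ℕ.*-zeroʳ q))
  multiples-suc (suc (suc e)) zero    = ≡.sym (≡.trans (ℕ.+-identityʳ _) (ℕ.*-zeroʳ q))
  multiples-suc (suc e)       (suc m) = ≡.trans (multiples-suc e m) (≡.cong (q ℕ.* multiples e m ℕ.+_)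
    (𝟙-cong (≡.cong suc) ℕ.suc-injective (e ℕ.≟ suc m) (suc e ℕ.≟ suc (suc m))))

  -- For h = multiples _ m this sums deg p over all f of degree m and all prime powers dividing f.
  weighted : ℕ → (ℕ → ℕ) → ℕ
  weighted N h = ∑ (upTo (suc N)) (λ d → π d ℕ.* (d ℕ.* ∑ (upTo N) (λ k → h (suc k ℕ.* d))))

  weighted-multiples : ∀ N m → m ℕ.≤ N → weighted N (λ e → multiples e m) ≡ m ℕ.* q ℕ.^ m
  weighted-multiples N m m≤N = begin
    weighted N (λ e → multiples e m)
      ≡⟨ ∑-cong (upTo (suc N)) (λ {d} _ → ·≡* (π d) (φ d)) ⟨
    ∑ (upTo (suc N)) (λ d → π d · φ d)
      ≡⟨ ∑-by-degree ℕ.+-0-commutativeMonoid N φ ⟨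
    ∑ I (φ ∘ deg)
      ≡⟨ ∑-cong I (λ {p} _ → ≡.cong (deg p ℕ.*_) (∑-cong (upTo N) λ {k} _ → count-multiples (isMonic-pow (poly-isMonic p) (suc k)) m)) ⟨
    ∑ I (λ p → deg p ℕ.* ∑ (upTo N) (λ k → ∑ L (λ f → 𝟙 (power-divides? p (suc k) f))))
      ≡⟨ ∑-cong I (λ {p} _ → ≡.cong (deg p ℕ.*_) (∑-swap (upTo N) L (λ k f → 𝟙 (power-divides? p (suc k) f)))) ⟩
    ∑ I (λ p → deg p ℕ.* ∑ L (λ f → multiplicity N p f))
      ≡⟨ ∑-cong I (λ {p} _ → ∑-*ˡ (deg p) L (multiplicity N p)) ⟩
    ∑ I (λ p → ∑ L (λ f → deg p ℕ.* multiplicity N p f))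
      ≡⟨ ∑-swap I L (λ p f → deg p ℕ.* multiplicity N p f) ⟩
    ∑ L (λ f → ∑ I (λ p → deg p ℕ.* multiplicity N p f))
      ≡⟨ ∑-cong L (degree-multiplicities N m ℕ.≤-refl m≤N) ⟩
    ∑ L (λ _ → m)
      ≡⟨ ≡.trans (∑-const L m) (·≡* (length L) m) ⟩
    length L ℕ.* m
      ≡⟨ ≡.trans (≡.cong (ℕ._* m) (length-monicsOfDegree m)) (ℕ.*-comm (q ℕ.^ m) m) ⟩
    m ℕ.* q ℕ.^ m ∎
    where
    open ≡.≡-Reasoning
    I = irreducibles≤ N
    L = monicsOfDegree m
    φ : ℕ → ℕ
    φ d = d ℕ.* ∑ (upTo N) (λ k → multiples (suc k ℕ.* d) m)

  weighted-+ : ∀ N g h → weighted N (λ e → g e ℕ.+ h e) ≡ weighted N g ℕ.+ weighted N h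
  weighted-+ N g h = ≡.trans (∑-cong (upTo (suc N)) λ {d} _ → ≡.trans
      (≡.cong (λ z → π d ℕ.* (d ℕ.* z)) (∑-+ (upTo N) (λ k → g (suc k ℕ.* d)) (λ k → h (suc k ℕ.* d))))
      (≡.trans (≡.cong (π d ℕ.*_) (ℕ.*-distribˡ-+ d (inner g d) (inner h d))) (ℕ.*-distribˡ-+ (π d) (d ℕ.* inner g d) (d ℕ.* inner h d))))
    (∑-+ (upTo (suc N)) (λ d → π d ℕ.* (d ℕ.* inner g d)) (λ d → π d ℕ.* (d ℕ.* inner h d)))
    where
    inner : (ℕ → ℕ) → ℕ → ℕ
    inner h d = ∑ (upTo N) (λ k → h (suc k ℕ.* d))

  weighted-*ˡ : ∀ N x h → weighted N (λ e → x ℕ.* h e) ≡ x ℕ.* weighted N h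
  weighted-*ˡ N x h = ≡.sym (≡.trans (∑-*ˡ x (upTo (suc N)) _) (∑-cong (upTo (suc N)) λ {d} _ →
    ≡.trans (x∙yz≈y∙xz x (π d) _) (≡.cong (π d ℕ.*_) (≡.trans (x∙yz≈y∙xz x d _) (≡.cong (d ℕ.*_) (∑-*ˡ x (upTo N) _))))))
    where open CommutativeSemigroupProperties ℕ.*-commutativeSemigroup using (x∙yz≈y∙xz)

  -- Gauss: Σ d π(d) = q ^ j, summed over the divisors d of j.
  prime-polynomial-theorem : ∀ N j → 1 ℕ.≤ j → j ℕ.≤ N → weighted N (λ e → 𝟙 (e ℕ.≟ j)) ≡ q ℕ.^ j
  -- The degree sums are (m + 1) q^(m + 1) and q times m q^m; their difference is q^(m + 1).
  prime-polynomial-theorem N (suc m) _ m<N = ℕ.+-cancelˡ-≡ (q ℕ.* (m ℕ.* q ℕ.^ m)) _ _ (begin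
    q ℕ.* (m ℕ.* q ℕ.^ m) ℕ.+ D                                     ≡⟨ ≡.cong (λ z → q ℕ.* z ℕ.+ D) (weighted-multiples N m (ℕ.<⇒≤ m<N)) ⟨
    q ℕ.* weighted N (λ e → multiples e m) ℕ.+ D                    ≡⟨ ≡.cong (ℕ._+ D) (weighted-*ˡ N q (λ e → multiples e m)) ⟨
    weighted N (λ e → q ℕ.* multiples e m) ℕ.+ D                    ≡⟨ weighted-+ N (λ e → q ℕ.* multiples e m) (λ e → 𝟙 (e ℕ.≟ suc m)) ⟨
    weighted N (λ e → q ℕ.* multiples e m ℕ.+ 𝟙 (e ℕ.≟ suc m))      ≡⟨ ∑-cong (upTo (suc N)) (λ {d} _ → ≡.cong (λ z → π d ℕ.* (d ℕ.* z))
                                                                         (∑-cong (upTo N) λ {k} _ → multiples-suc (suc k ℕ.* d) m)) ⟨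
    weighted N (λ e → multiples e (suc m))                          ≡⟨ weighted-multiples N (suc m) m<N ⟩
    suc m ℕ.* (q ℕ.* q ℕ.^ m)                                       ≡⟨ ≡.cong (λ z → q ℕ.* q ℕ.^ m ℕ.+ z) (x∙yz≈y∙xz m q (q ℕ.^ m)) ⟩
    q ℕ.* q ℕ.^ m ℕ.+ q ℕ.* (m ℕ.* q ℕ.^ m)                         ≡⟨ ℕ.+-comm (q ℕ.* q ℕ.^ m) _ ⟩
    q ℕ.* (m ℕ.* q ℕ.^ m) ℕ.+ q ℕ.* q ℕ.^ m                         ∎)
    where
    open ≡.≡-Reasoning
    open CommutativeSemigroupProperties ℕ.*-commutativeSemigroup using (x∙yz≈y∙xz)
    D = weighted N (λ e → 𝟙 (e ℕ.≟ suc m))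

  π-1 : π 1 ≡ q
  π-1 = begin
    π 1                                       ≡⟨ ℕ.*-identityʳ (π 1) ⟨
    π 1 ℕ.* 1                                 ≡⟨ ℕ.+-identityʳ _ ⟨
    π 1 ℕ.* 1 ℕ.+ 0                           ≡⟨ ≡.cong (ℕ._+ (π 1 ℕ.* 1 ℕ.+ 0)) (ℕ.*-zeroʳ (π 0)) ⟨
    weighted 1 (λ e → 𝟙 (e ℕ.≟ 1))            ≡⟨ prime-polynomial-theorem 1 1 ℕ.≤-refl ℕ.≤-refl ⟩
    q ℕ.* 1                                   ≡⟨ ℕ.*-identityʳ q ⟩
    q                                         ∎
    where open ≡.≡-Reasoning

  ∈⇒≤∑ : ∀ {a} {A : Set a} {xs : List A} {x} f → x ∈ xs → f x ℕ.≤ ∑ xs f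
  ∈⇒≤∑ f (here ≡.refl) = ℕ.m≤m+n _ _
  ∈⇒≤∑ f (there x∈)    = ℕ.≤-trans (∈⇒≤∑ f x∈) (ℕ.m≤n+m _ _)

  -- Keeps only the divisors 1 and d in Gauss' identity. The contribution of 1 is what later yields
  -- d π(d) ≤ q^d - 1, matching the denominator of 1 / (1 - 1 / q^d) = q^d / (q^d - 1).
  π-bound : ∀ d → 2 ℕ.≤ d → q ℕ.+ d ℕ.* π d ℕ.≤ q ℕ.^ d
  π-bound d@(suc (suc d′)) 2≤d@(s≤s (s≤s _)) = begin
    q ℕ.+ d ℕ.* π d                 ≤⟨ ℕ.+-mono-≤ linear top ⟩
    ∑ (upTo d) term ℕ.+ term d      ≡⟨ ∑-upTo-suc d term ⟨
    weighted d (λ e → 𝟙 (e ℕ.≟ d))  ≡⟨ prime-polynomial-theorem d d (s≤s z≤n) ℕ.≤-refl ⟩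
    q ℕ.^ d                         ∎
    where
    open ℕ.≤-Reasoning
    term : ℕ → ℕ
    term e = π e ℕ.* (e ℕ.* ∑ (upTo d) (λ k → 𝟙 (suc k ℕ.* e ℕ.≟ d)))
    hit : ∀ e k → k ℕ.< d → suc k ℕ.* e ≡ d → π e ℕ.* e ℕ.≤ term e
    hit e k k<d eq = begin
      π e ℕ.* e                                    ≡⟨ ≡.cong (π e ℕ.*_) (ℕ.*-identityʳ e) ⟨
      π e ℕ.* (e ℕ.* 1)                            ≡⟨ ≡.cong (λ z → π e ℕ.* (e ℕ.* z)) (𝟙-yes eq (suc k ℕ.* e ℕ.≟ d)) ⟨
      π e ℕ.* (e ℕ.* 𝟙 (suc k ℕ.* e ℕ.≟ d))       ≤⟨ ℕ.*-monoʳ-≤ (π e) (ℕ.*-monoʳ-≤ e (∈⇒≤∑ (λ k → 𝟙 (suc k ℕ.* e ℕ.≟ d)) (∈-upTo⁺ k<d))) ⟩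
      term e                                       ∎
    linear : q ℕ.≤ ∑ (upTo d) term
    linear = begin
      q                  ≡⟨ π-1 ⟨
      π 1                ≡⟨ ℕ.*-identityʳ (π 1) ⟨
      π 1 ℕ.* 1          ≤⟨ hit 1 (suc d′) ℕ.≤-refl (ℕ.*-identityʳ d) ⟩
      term 1             ≤⟨ ∈⇒≤∑ term (∈-upTo⁺ 2≤d) ⟩
      ∑ (upTo d) term    ∎
    top : d ℕ.* π d ℕ.≤ term d
    top = begin
      d ℕ.* π d   ≡⟨ ℕ.*-comm d (π d) ⟩
      π d ℕ.* d   ≤⟨ hit d 0 (s≤s z≤n) (ℕ.*-identityˡ d) ⟩
      term d      ∎

-- The exponential function and Euler's constant

module ExponentialBounds where

  open import Data.Rational.Base using (_+_; _*_; _-_; -_; _≤_; _<_)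
  open Real
  open ℚ.≤-Reasoning
  open +-*-Solver

  ≤-+ʳ : ∀ {a b} → 0ℚ ≤ b → a ≤ a + b
  ≤-+ʳ {a} {b} 0≤b = begin
    a        ≡⟨ ℚ.+-identityʳ a ⟨
    a + 0ℚ   ≤⟨ ℚ.+-monoʳ-≤ a 0≤b ⟩
    a + b    ∎

  *-monoˡ : ∀ {a b c} → 0ℚ ≤ c → a ≤ b → c * a ≤ c * b
  *-monoˡ {c = c} 0≤c = ℚ.*-monoˡ-≤-nonNeg c {{ℚ.nonNegative 0≤c}}

  *-monoʳ : ∀ {a b c} → 0ℚ ≤ c → a ≤ b → a * c ≤ b * c
  *-monoʳ {c = c} 0≤c = ℚ.*-monoʳ-≤-nonNeg c {{ℚ.nonNegative 0≤c}}

  fromℕ-suc : ∀ n → fromℕ (suc n) ≡ 1ℚ + fromℕ n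
  fromℕ-suc n = ≡.sym (fromℕ-+ 1 n)

  fromℕ-pos : ∀ n → 0ℚ < fromℕ (suc n)
  fromℕ-pos n = ℚ.<-≤-trans 0<1 (ℚ.≤-trans (≤-+ʳ (fromℕ-nonNeg n)) (ℚ.≤-reflexive (≡.sym (fromℕ-suc n))))

  fromℕ-mono : ∀ {m n} → m ℕ.≤ n → fromℕ m ≤ fromℕ n
  fromℕ-mono {m} {n} m≤n = ℚ.≤-trans (≤-+ʳ {fromℕ m} {fromℕ (n ℕ.∸ m)} (fromℕ-nonNeg (n ℕ.∸ m)))
    (ℚ.≤-reflexive (≡.trans (fromℕ-+ m (n ℕ.∸ m)) (≡.cong fromℕ (ℕ.m+[n∸m]≡n m≤n))))

  E : ℕ → ℚ → ℚ
  E k a = Σ< k (expTerm a)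

  expTerm-mono : ∀ {a b} → 0ℚ ≤ a → a ≤ b → ∀ j → expTerm a j ≤ expTerm b j
  expTerm-mono 0≤a a≤b zero    = ℚ.≤-refl
  expTerm-mono {a} {b} 0≤a a≤b (suc j) = *-monoʳ (recip-nonNeg j)
    (*-mono (expTerm-nonNeg 0≤a j) (ℚ.≤-trans 0≤a a≤b) (expTerm-mono 0≤a a≤b j) a≤b)

  E-mono : ∀ {a b} → 0ℚ ≤ a → a ≤ b → ∀ k → E k a ≤ E k b
  E-mono 0≤a a≤b zero    = ℚ.≤-refl
  E-mono 0≤a a≤b (suc k) = ℚ.+-mono-≤ (E-mono 0≤a a≤b k) (expTerm-mono 0≤a a≤b k)

  E-monoᵏ : ∀ {a k l} → 0ℚ ≤ a → k ℕ.≤ l → E k a ≤ E l a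
  E-monoᵏ {a} 0≤a k≤l = go (ℕ.≤⇒≤′ k≤l)
    where
    go : ∀ {k l} → k ℕ.≤′ l → E k a ≤ E l a
    go ℕ.≤′-refl       = ℚ.≤-refl
    go (ℕ.≤′-step {l} k≤l) = ℚ.≤-trans (go k≤l) (≤-+ʳ (expTerm-nonNeg 0≤a l))

  expTerm-suc : ∀ a j → a * expTerm a j ≡ fromℕ (suc j) * expTerm a (suc j)
  expTerm-suc a j = begin-equality
    a * t                      ≡⟨ ℚ.*-identityˡ (a * t) ⟨
    1ℚ * (a * t)               ≡⟨ ≡.cong (_* (a * t)) (fromℕ-recip j) ⟨
    (n * r) * (a * t)          ≡⟨ solve 4 (λ n r a t → (n :* r) :* (a :* t) := n :* (t :* a :* r)) ≡.refl n r a t ⟩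
    n * (t * a * r)            ∎
    where
    t = expTerm a j
    n = fromℕ (suc j)
    r = recip j

  -- The degree-one part of the binomial theorem, in both directions.
  expTerm-+-≥ : ∀ {a h} → 0ℚ ≤ a → 0ℚ ≤ h → ∀ j → expTerm a (suc j) + h * expTerm a j ≤ expTerm (a + h) (suc j)
  expTerm-+-≥ {a} {h} 0≤a 0≤h zero = ℚ.≤-reflexive
    (solve 2 (λ a h → con 1ℚ :* a :* con 1ℚ :+ h :* con 1ℚ := con 1ℚ :* (a :+ h) :* con 1ℚ) ≡.refl a h)
  expTerm-+-≥ {a} {h} 0≤a 0≤h (suc i) = begin
    t₁ * a * r + h * t₁                            ≡⟨ ≡.cong (λ z → t₁ * a * r + z) (begin-equality
        h * t₁                                        ≡⟨ solve 2 (λ h t → h :* t := h :* t :* con 1ℚ) ≡.refl h t₁ ⟩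
        h * t₁ * 1ℚ                                   ≡⟨ ≡.cong (h * t₁ *_) (fromℕ-recip (suc i)) ⟨
        h * t₁ * (fromℕ (suc (suc i)) * r)            ≡⟨ ≡.cong (λ z → h * t₁ * (z * r)) (fromℕ-suc (suc i)) ⟩
        h * t₁ * ((1ℚ + n) * r)                       ≡⟨ solve 4 (λ h t n r → h :* t :* ((con 1ℚ :+ n) :* r) := (h :* t :+ h :* (n :* t)) :* r) ≡.refl h t₁ n r ⟩
        (h * t₁ + h * (n * t₁)) * r                   ≡⟨ ≡.cong (λ z → (h * t₁ + h * z) * r) (expTerm-suc a i) ⟨
        (h * t₁ + h * (a * t₀)) * r                   ∎) ⟩
    t₁ * a * r + (h * t₁ + h * (a * t₀)) * r       ≤⟨ ≤-+ʳ (*-nonNeg (*-nonNeg (*-nonNeg 0≤h 0≤h) (expTerm-nonNeg 0≤a i)) (recip-nonNeg (suc i))) ⟩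
    t₁ * a * r + (h * t₁ + h * (a * t₀)) * r + h * h * t₀ * r
      ≡⟨ solve 5 (λ t a r h s → t :* a :* r :+ (h :* t :+ h :* (a :* s)) :* r :+ h :* h :* s :* r := (t :+ h :* s) :* (a :+ h) :* r) ≡.refl t₁ a r h t₀ ⟩
    (t₁ + h * t₀) * (a + h) * r                    ≤⟨ *-monoʳ (recip-nonNeg (suc i)) (*-monoʳ (ℚ.+-mono-≤ 0≤a 0≤h) (expTerm-+-≥ 0≤a 0≤h i)) ⟩
    expTerm (a + h) (suc i) * (a + h) * r          ∎
    where
    t₀ = expTerm a i
    t₁ = expTerm a (suc i)
    n = fromℕ (suc i)
    r = recip (suc i)

  expTerm-+-≤ : ∀ {a h} → 0ℚ ≤ a → 0ℚ ≤ h → ∀ j → expTerm (a + h) (suc j) ≤ expTerm a (suc j) + h * expTerm (a + h) j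
  expTerm-+-≤ {a} {h} 0≤a 0≤h zero = ℚ.≤-reflexive
    (solve 2 (λ a h → con 1ℚ :* (a :+ h) :* con 1ℚ := con 1ℚ :* a :* con 1ℚ :+ h :* con 1ℚ) ≡.refl a h)
  expTerm-+-≤ {a} {h} 0≤a 0≤h (suc i) = begin
    u₁ * b * r                                     ≡⟨ solve 4 (λ u a h r → u :* (a :+ h) :* r := u :* a :* r :+ h :* u :* r) ≡.refl u₁ a h r ⟩
    u₁ * a * r + h * u₁ * r                        ≤⟨ ℚ.+-monoˡ-≤ (h * u₁ * r) (*-monoʳ (recip-nonNeg (suc i)) (*-monoʳ 0≤a (expTerm-+-≤ 0≤a 0≤h i))) ⟩
    (t₁ + h * u₀) * a * r + h * u₁ * r             ≤⟨ ≤-+ʳ (*-nonNeg (*-nonNeg (*-nonNeg 0≤h 0≤h) (expTerm-nonNeg (ℚ.+-mono-≤ 0≤a 0≤h) i)) (recip-nonNeg (suc i))) ⟩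
    (t₁ + h * u₀) * a * r + h * u₁ * r + h * h * u₀ * r
      ≡⟨ solve 6 (λ t h u a r v → (t :+ h :* u) :* a :* r :+ h :* v :* r :+ h :* h :* u :* r := t :* a :* r :+ (h :* v :+ h :* ((a :+ h) :* u)) :* r) ≡.refl t₁ h u₀ a r u₁ ⟩
    t₁ * a * r + (h * u₁ + h * (b * u₀)) * r       ≡⟨ ≡.cong (λ z → t₁ * a * r + z) (begin-equality
        (h * u₁ + h * (b * u₀)) * r                   ≡⟨ ≡.cong (λ z → (h * u₁ + h * z) * r) (expTerm-suc b i) ⟩
        (h * u₁ + h * (n * u₁)) * r                   ≡⟨ solve 4 (λ h t n r → h :* t :* ((con 1ℚ :+ n) :* r) := (h :* t :+ h :* (n :* t)) :* r) ≡.refl h u₁ n r ⟨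
        h * u₁ * ((1ℚ + n) * r)                       ≡⟨ ≡.cong (λ z → h * u₁ * (z * r)) (fromℕ-suc (suc i)) ⟨
        h * u₁ * (fromℕ (suc (suc i)) * r)            ≡⟨ ≡.cong (h * u₁ *_) (fromℕ-recip (suc i)) ⟩
        h * u₁ * 1ℚ                                   ≡⟨ solve 2 (λ h t → h :* t := h :* t :* con 1ℚ) ≡.refl h u₁ ⟨
        h * u₁                                        ∎) ⟩
    t₁ * a * r + h * u₁                            ∎
    where
    b = a + h
    t₁ = expTerm a (suc i)
    u₀ = expTerm b i
    u₁ = expTerm b (suc i)
    n = fromℕ (suc i)
    r = recip (suc i)

  -- Truncated form of e^a (1 + h) ≤ e^(a + h). Multiplication by 1 + h raises the degree by one,
  -- hence one more term on the right.
  E-+-≥ : ∀ {a h} → 0ℚ ≤ a → 0ℚ ≤ h → ∀ k → E k a * (1ℚ + h) ≤ E (suc k) (a + h)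
  E-+-≥ {a} {h} 0≤a 0≤h k = begin
    E k a * (1ℚ + h)               ≡⟨ solve 2 (λ e h → e :* (con 1ℚ :+ h) := e :+ h :* e) ≡.refl (E k a) h ⟩
    E k a + h * E k a              ≤⟨ ℚ.+-monoˡ-≤ (h * E k a) (E-monoᵏ 0≤a (ℕ.n≤1+n k)) ⟩
    E (suc k) a + h * E k a        ≤⟨ go k ⟩
    E (suc k) (a + h)              ∎
    where
    go : ∀ k → E (suc k) a + h * E k a ≤ E (suc k) (a + h)
    go zero    = ℚ.≤-reflexive (solve 1 (λ h → con 0ℚ :+ con 1ℚ :+ h :* con 0ℚ := con 0ℚ :+ con 1ℚ) ≡.refl h)
    go (suc k) = begin
      E (suc k) a + expTerm a (suc k) + h * (E k a + expTerm a k)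
        ≡⟨ solve 5 (λ e t h e′ t′ → e :+ t :+ h :* (e′ :+ t′) := e :+ h :* e′ :+ (t :+ h :* t′)) ≡.refl (E (suc k) a) (expTerm a (suc k)) h (E k a) (expTerm a k) ⟩
      E (suc k) a + h * E k a + (expTerm a (suc k) + h * expTerm a k)
        ≤⟨ ℚ.+-mono-≤ (go k) (expTerm-+-≥ 0≤a 0≤h k) ⟩
      E (suc k) (a + h) + expTerm (a + h) (suc k) ∎

  -- Truncated form of 1 - h ≤ e^(-h), obtained from E k b ≤ E k a + h E k b with b = a + h. The
  -- number of terms is the same on both sides, so any number of steps can be chained at a fixed k.
  E-+-≤ : ∀ {a h} → 0ℚ ≤ a → 0ℚ ≤ h → ∀ k → (1ℚ - h) * E k (a + h) ≤ E k a
  E-+-≤ {a} {h} 0≤a 0≤h k = begin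
    (1ℚ - h) * E k b            ≡⟨ solve 2 (λ e h → (con 1ℚ :- h) :* e := e :- h :* e) ≡.refl (E k b) h ⟩
    E k b - h * E k b           ≤⟨ ℚ.+-monoˡ-≤ (- (h * E k b)) (go k) ⟩
    E k a + h * E k b - h * E k b ≡⟨ solve 2 (λ x y → x :+ y :- y := x) ≡.refl (E k a) (h * E k b) ⟩
    E k a                       ∎
    where
    b = a + h
    0≤b = ℚ.+-mono-≤ 0≤a 0≤h
    go′ : ∀ k → E (suc k) b ≤ E (suc k) a + h * E k b
    go′ zero    = ℚ.≤-reflexive (solve 1 (λ h → con 0ℚ :+ con 1ℚ := con 0ℚ :+ con 1ℚ :+ h :* con 0ℚ) ≡.refl h)
    go′ (suc k) = begin
      E (suc k) b + expTerm b (suc k)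
        ≤⟨ ℚ.+-mono-≤ (go′ k) (expTerm-+-≤ 0≤a 0≤h k) ⟩
      E (suc k) a + h * E k b + (expTerm a (suc k) + h * expTerm b k)
        ≡⟨ solve 5 (λ e t h e′ t′ → e :+ h :* e′ :+ (t :+ h :* t′) := e :+ t :+ h :* (e′ :+ t′)) ≡.refl (E (suc k) a) (expTerm a (suc k)) h (E k b) (expTerm b k) ⟩
      E (suc k) a + expTerm a (suc k) + h * (E k b + expTerm b k) ∎
    go : ∀ k → E k b ≤ E k a + h * E k b
    go zero    = ℚ.≤-reflexive (solve 1 (λ h → con 0ℚ := con 0ℚ :+ h :* con 0ℚ) ≡.refl h)
    go (suc k) = ℚ.≤-trans (go′ k) (ℚ.+-monoʳ-≤ (E (suc k) a) (*-monoˡ 0≤h (E-monoᵏ 0≤b (ℕ.n≤1+n k))))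

  -- y ≤exp x certifies y ≤ eˣ by writing y as a product of factors 1 + hᵢ with Σ hᵢ = x.
  infix 4 _≤exp_
  data _≤exp_ : ℚ → ℚ → Set where
    one  : 1ℚ ≤exp 0ℚ
    step : ∀ {y x h} → y ≤exp x → 0ℚ ≤ h → y * (1ℚ + h) ≤exp x + h

  ≤exp-nonNeg : ∀ {y x} → y ≤exp x → 0ℚ ≤ x
  ≤exp-nonNeg one          = ℚ.≤-refl
  ≤exp-nonNeg (step c 0≤h) = ℚ.+-mono-≤ (≤exp-nonNeg c) 0≤h

  ≤exp-* : ∀ {y x y′ x′} → y ≤exp x → y′ ≤exp x′ → y * y′ ≤exp x + x′
  ≤exp-* {y} {x} c one = ≡.subst₂ _≤exp_ (≡.sym (ℚ.*-identityʳ y)) (≡.sym (ℚ.+-identityʳ x)) c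
  ≤exp-* {y} {x} c (step {y′} {x′} {h} c′ 0≤h) = ≡.subst₂ _≤exp_ (ℚ.*-assoc y y′ (1ℚ + h)) (ℚ.+-assoc x x′ h) (step (≤exp-* c c′) 0≤h)

  -- Each factor of the certificate costs one term of the series by `E-+-≥`, so the threshold is one
  -- more than the number of factors.
  ≤exp⇒≤E : ∀ {y x} → y ≤exp x → ∃[ N ] (∀ k → N ℕ.≤ k → y ≤ E k x)
  ≤exp⇒≤E one = 1 , λ { (suc k) _ → expSum-≥1 ℚ.≤-refl k }
  ≤exp⇒≤E (step {y} {x} {h} c 0≤h) with ≤exp⇒≤E c
  ... | N , bound = suc N , λ { (suc k) (s≤s N≤k) → ℚ.≤-trans
    (*-monoʳ (ℚ.≤-trans (ℚ.<⇒≤ 0<1) (≤-+ʳ 0≤h)) (bound k N≤k)) (E-+-≥ (≤exp-nonNeg c) 0≤h k) }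

-- Lower bounds for Euler's constant

module GammaBounds where

  open import Data.Rational.Base using (_+_; _*_; _-_; -_; _≤_; _<_; ∣_∣)
  open Real
  open ExponentialBounds
  open ℚ.≤-Reasoning
  open +-*-Solver

  *-cancelˡ : ∀ {a b c} → 0ℚ < c → c * a ≤ c * b → a ≤ b
  *-cancelˡ {c = c} 0<c = ℚ.*-cancelˡ-≤-pos c {{ℚ.positive 0<c}}

  logSumTo : ℕ → ℕ → ℚ
  logSumTo K i = Σ< i (λ i → recip (suc K ℕ.+ i))

  Σ<-nonNeg : ∀ n {f} → (∀ i → 0ℚ ≤ f i) → 0ℚ ≤ Σ< n f
  Σ<-nonNeg zero    0≤f = ℚ.≤-refl
  Σ<-nonNeg (suc n) 0≤f = ℚ.+-mono-≤ (Σ<-nonNeg n 0≤f) (0≤f n)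

  -- logSumTo K i is a lower Riemann sum for log ((K + 1 + i) / (K + 1)).
  E-logSumTo : ∀ {a} → 0ℚ ≤ a → ∀ k K i → fromℕ (suc K) * E k (a + logSumTo K i) ≤ fromℕ (suc K ℕ.+ i) * E k a
  E-logSumTo {a} 0≤a k K zero = ℚ.≤-reflexive (≡.cong₂ (λ m x → fromℕ m * E k x) (≡.sym (ℕ.+-identityʳ (suc K))) (ℚ.+-identityʳ a))
  -- Moving the upper end from m = K + 1 + i to m + 1 adds r = 1 / (m + 1) to the argument, and m /
  -- (m + 1) = 1 - r is exactly the factor in `E-+-≤`.
  E-logSumTo {a} 0≤a k K (suc i) = *-cancelˡ (fromℕ-pos (K ℕ.+ i)) (begin
    m * (A * E k (a + (l + r)))              ≡⟨ ≡.cong (λ z → m * (A * E k z)) (ℚ.+-assoc a l r) ⟨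
    m * (A * E k (a + l + r))                ≡⟨ ≡.cong (_* (A * E k (a + l + r))) m≡ ⟩
    (m+1 * (1ℚ - r)) * (A * E k (a + l + r)) ≡⟨ solve 4 (λ m r a e → (m :* r) :* (a :* e) := (m :* a) :* (r :* e)) ≡.refl m+1 (1ℚ - r) A (E k (a + l + r)) ⟩
    (m+1 * A) * ((1ℚ - r) * E k (a + l + r)) ≤⟨ *-monoˡ (*-nonNeg (fromℕ-nonNeg (suc (suc K ℕ.+ i))) (fromℕ-nonNeg (suc K)))
                                                  (E-+-≤ (ℚ.+-mono-≤ 0≤a (Σ<-nonNeg i (λ i → recip-nonNeg (suc K ℕ.+ i)))) (recip-nonNeg (suc K ℕ.+ i)) k) ⟩
    (m+1 * A) * E k (a + l)                  ≡⟨ ℚ.*-assoc m+1 A _ ⟩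
    m+1 * (A * E k (a + l))                  ≤⟨ *-monoˡ (fromℕ-nonNeg (suc (suc K ℕ.+ i))) (E-logSumTo 0≤a k K i) ⟩
    m+1 * (m * E k a)                        ≡⟨ solve 3 (λ x y z → x :* (y :* z) := y :* (x :* z)) ≡.refl m+1 m (E k a) ⟩
    m * (m+1 * E k a)                        ≡⟨ ≡.cong (λ z → m * (fromℕ z * E k a)) (ℕ.+-suc (suc K) i) ⟨
    m * (fromℕ (suc K ℕ.+ suc i) * E k a)    ∎)
    where
    A = fromℕ (suc K)
    l = logSumTo K i
    m = fromℕ (suc K ℕ.+ i)
    m+1 = fromℕ (suc (suc K ℕ.+ i))
    r = recip (suc K ℕ.+ i)
    m≡ : m ≡ m+1 * (1ℚ - r)
    m≡ = ≡.sym (begin-equality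
      m+1 * (1ℚ - r)          ≡⟨ solve 2 (λ m r → m :* (con 1ℚ :- r) := m :- m :* r) ≡.refl m+1 r ⟩
      m+1 - m+1 * r           ≡⟨ ≡.cong₂ _-_ (fromℕ-suc (suc K ℕ.+ i)) (fromℕ-recip (suc K ℕ.+ i)) ⟩
      1ℚ + m - 1ℚ             ≡⟨ solve 1 (λ m → con 1ℚ :+ m :- con 1ℚ := m) ≡.refl m ⟩
      m                       ∎)

  -- Stands in for e^(a + log (n + 1)) = (n + 1) e^a; the direction ≤ is the one that fits, because
  -- a right Riemann sum of 1 / t lies below the integral.
  E-logSum : ∀ {a} → 0ℚ ≤ a → ∀ k n K → E k (a + logSum n K) ≤ fromℕ (suc n) * E k a
  E-logSum {a} 0≤a k n K = *-cancelˡ (fromℕ-pos K) (begin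
    fromℕ (suc K) * E k (a + logSum n K)                  ≤⟨ E-logSumTo 0≤a k K (suc K ℕ.* n) ⟩
    fromℕ (suc K ℕ.+ suc K ℕ.* n) * E k a                 ≡⟨ ≡.cong (λ z → fromℕ z * E k a) (ℕ.*-suc (suc K) n) ⟨
    fromℕ (suc K ℕ.* suc n) * E k a                       ≡⟨ ≡.cong (_* E k a) (fromℕ-* (suc K) (suc n)) ⟨
    fromℕ (suc K) * fromℕ (suc n) * E k a                 ≡⟨ ℚ.*-assoc (fromℕ (suc K)) (fromℕ (suc n)) (E k a) ⟩
    fromℕ (suc K) * (fromℕ (suc n) * E k a)               ∎)

  logSum-mono : ∀ n {K L} → K ℕ.≤ L → logSum n K ≤ logSum n L
  logSum-mono n K≤L = go (ℕ.≤⇒≤′ K≤L)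
    where
    go : ∀ {K L} → K ℕ.≤′ L → logSum n K ≤ logSum n L
    go ℕ.≤′-refl           = ℚ.≤-refl
    go (ℕ.≤′-step {L} K≤L) = ℚ.≤-trans (go K≤L)
      (-≤0 (ℚ.≤-trans (0≤- (block-≥ n L)) (ℚ.≤-reflexive (≡.sym (logSum-stepK n L)))))

  -- The approximations increase with the mesh index, and their remaining growth after `K`
  -- telescopes to at most 1 / (K + 1).
  logSum-upper : ∀ n K L → logSum n L ≤ logSum n K + recip K
  logSum-upper n K L with ℕ.≤-total L K
  ... | inj₁ L≤K = ℚ.≤-trans (logSum-mono n L≤K) (≤-+ʳ (recip-nonNeg K))
  ... | inj₂ K≤L = begin
    logSum n L                                   ≡⟨ solve 2 (λ x y → x := y :+ (x :- y)) ≡.refl (logSum n L) (logSum n K) ⟩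
    logSum n K + (logSum n L - logSum n K)       ≤⟨ ℚ.+-monoʳ-≤ (logSum n K) (ℚ.≤-trans (≤-∣∣ _)
      (ℚ.≤-trans (ℚ.≤-reflexive (∣-∣-sym (logSum n L) (logSum n K))) (telescoping (logSum n) recip 0 distance (λ i _ → recip-nonNeg i) K L z≤n K≤L))) ⟩
    logSum n K + recip K                         ∎
    where
    distance : ∀ K → 0 ℕ.≤ K → ∣ logSum n K - logSum n (suc K) ∣ ≤ recip K - recip (suc K)
    distance K _ = ℚ.≤-trans (ℚ.≤-reflexive (≡.trans (∣-∣-sym (logSum n K) (logSum n (suc K))) (≡.cong ∣_∣ (logSum-stepK n K)))) (block-dist n K)

  ½*½-sum : ∀ n → fromℕ n * fromℕ n * ½ + fromℕ (suc n) ≡ fromℕ (suc n) * fromℕ (suc n) * ½ + ½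
  ½*½-sum n = ≡.trans (≡.cong (λ z → x * x * ½ + z) (fromℕ-suc n))
    (≡.trans (solve 1 (λ x → x :* x :* con ½ :+ (con 1ℚ :+ x) := (con 1ℚ :+ x) :* (con 1ℚ :+ x) :* con ½ :+ con ½) ≡.refl x)
      (≡.cong (λ z → z * z * ½ + ½) (≡.sym (fromℕ-suc n))))
    where x = fromℕ n

  -- Rests on 1 + ... + n ≥ n² / 2. Dropping the linear part n / 2 is what removes the mesh from the
  -- trapezoidal bound.
  Σ<-linear : ∀ n c {d} → 0ℚ ≤ d → Σ< n (λ i → c - fromℕ (suc i) * d) ≤ fromℕ n * c - fromℕ n * fromℕ n * ½ * d
  Σ<-linear zero    c {d} 0≤d = ℚ.≤-reflexive (solve 2 (λ c d → con 0ℚ := con 0ℚ :* c :- con 0ℚ :* con 0ℚ :* con ½ :* d) ≡.refl c d)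
  Σ<-linear (suc n) c {d} 0≤d = begin
    Σ< n _ + (c - m * d)                              ≤⟨ ℚ.+-monoˡ-≤ (c - m * d) (Σ<-linear n c 0≤d) ⟩
    x * c - x * x * ½ * d + (c - m * d)               ≡⟨ solve 4 (λ x c d m → x :* c :- x :* x :* con ½ :* d :+ (c :- m :* d) := x :* c :+ c :- (x :* x :* con ½ :+ m) :* d) ≡.refl x c d m ⟩
    x * c + c - (x * x * ½ + m) * d                   ≡⟨ ≡.cong₂ (λ y z → y - z * d) (suc-* n c) (½*½-sum n) ⟩
    m * c - (m * m * ½ + ½) * d                       ≤⟨ ≤-+ʳ (*-nonNeg (ℚ.<⇒≤ 0<½) 0≤d) ⟩
    m * c - (m * m * ½ + ½) * d + ½ * d               ≡⟨ solve 3 (λ m c d → m :* c :- (m :* m :* con ½ :+ con ½) :* d :+ con ½ :* d := m :* c :- m :* m :* con ½ :* d) ≡.refl m c d ⟩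
    m * c - m * m * ½ * d                             ∎
    where
    x = fromℕ n
    m = fromℕ (suc n)

  recip-difference : ∀ b → recip b - recip (suc b) ≡ recip b * recip (suc b)
  recip-difference b = begin-equality
    r - s                                 ≡⟨ solve 2 (λ r s → r :- s := r :* con 1ℚ :- con 1ℚ :* s) ≡.refl r s ⟩
    r * 1ℚ - 1ℚ * s                       ≡⟨ ≡.cong₂ (λ y z → r * y - z * s) (≡.sym (fromℕ-recip (suc b))) (≡.sym (fromℕ-recip b)) ⟩
    r * (fromℕ (suc (suc b)) * s) - (n * r) * s ≡⟨ ≡.cong (λ z → r * (z * s) - (n * r) * s) (fromℕ-suc (suc b)) ⟩
    r * ((1ℚ + n) * s) - (n * r) * s      ≡⟨ solve 3 (λ r n s → r :* ((con 1ℚ :+ n) :* s) :- (n :* r) :* s := r :* s) ≡.refl r n s ⟩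
    r * s                                 ∎
    where
    r = recip b
    s = recip (suc b)
    n = fromℕ (suc b)

  -- The chord of 1/t over [b + 1, b + 2] lies above the graph.
  chord : ∀ a b i → i ℕ.< suc a →
          recip (suc a ℕ.* suc b ℕ.+ i) ≤ recip a * recip b - fromℕ (suc i) * (recip a * recip a * (recip b * recip (suc b)))
  -- Write τ = j / A, which is at most 1. Multiplying the chord by M = A (B + τ) gives 1 + τ (1 - τ)
  -- / (B (B + 1)) ≥ 1. The factors `1ℚ` are inserted so that they can be rewritten as A rA and B
  -- rb.
  chord a b i i<A = *-cancelˡ (fromℕ-pos (suc a ℕ.* suc b ℕ.+ i)) (begin
    M * recip (suc a ℕ.* suc b ℕ.+ i)                   ≡⟨ fromℕ-recip (suc a ℕ.* suc b ℕ.+ i) ⟩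
    1ℚ                                                  ≤⟨ ≤-+ʳ (*-nonNeg (*-nonNeg (*-nonNeg (fromℕ-nonNeg (suc i)) (recip-nonNeg a)) (*-nonNeg (recip-nonNeg b) (recip-nonNeg (suc b)))) (0≤- jrA≤1)) ⟩
    1ℚ + (j * rA) * (rb * rb′) * (1ℚ - j * rA)
      ≡⟨ solve 4 (λ j r b c → con 1ℚ :+ (j :* r) :* (b :* c) :* (con 1ℚ :- j :* r) := con 1ℚ :* con 1ℚ :+ (j :* r) :* (b :* c) :- con 0ℚ :- (j :* r) :* (j :* r) :* (b :* c)) ≡.refl j rA rb rb′ ⟩
    1ℚ * 1ℚ + (j * rA) * (rb * rb′) - 0ℚ - (j * rA) * (j * rA) * (rb * rb′)
      ≡⟨ ≡.cong (λ z → 1ℚ * 1ℚ + (j * rA) * z - 0ℚ - (j * rA) * (j * rA) * (rb * rb′)) (recip-difference b) ⟨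
    1ℚ * 1ℚ + (j * rA) * (rb - rb′) - 0ℚ - (j * rA) * (j * rA) * (rb * rb′)
      ≡⟨ solve 4 (λ j r b c → con 1ℚ :* con 1ℚ :+ (j :* r) :* (b :- c) :- con 0ℚ :- (j :* r) :* (j :* r) :* (b :* c)
            := con 1ℚ :* con 1ℚ :+ j :* r :* b :- j :* r :* c :* (con 1ℚ :* con 1ℚ) :- (j :* r) :* (j :* r) :* (b :* c)) ≡.refl j rA rb rb′ ⟩
    1ℚ * 1ℚ + j * rA * rb - j * rA * rb′ * (1ℚ * 1ℚ) - (j * rA) * (j * rA) * (rb * rb′)
      ≡⟨ ≡.cong₂ (λ y z → y * z + j * rA * rb - j * rA * rb′ * (y * z) - (j * rA) * (j * rA) * (rb * rb′)) (≡.sym (fromℕ-recip a)) (≡.sym (fromℕ-recip b)) ⟩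
    (A * rA) * (B * rb) + j * rA * rb - j * rA * rb′ * ((A * rA) * (B * rb)) - (j * rA) * (j * rA) * (rb * rb′)
      ≡⟨ solve 6 (λ j r b c A B → (A :* r) :* (B :* b) :+ j :* r :* b :- j :* r :* c :* ((A :* r) :* (B :* b)) :- (j :* r) :* (j :* r) :* (b :* c)
            := (A :* B :+ j) :* (r :* b :- j :* (r :* r :* (b :* c)))) ≡.refl j rA rb rb′ A B ⟩
    (A * B + j) * y                                     ≡⟨ ≡.cong (_* y) M≡ ⟨
    M * y                                               ∎)
    where
    A = fromℕ (suc a)
    B = fromℕ (suc b)
    M = fromℕ (suc (suc a ℕ.* suc b ℕ.+ i))
    j = fromℕ (suc i)
    rA = recip a
    rb = recip b
    rb′ = recip (suc b)
    y = rA * rb - j * (rA * rA * (rb * rb′))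
    M≡ : M ≡ A * B + j
    M≡ = ≡.trans (≡.cong fromℕ (≡.sym (ℕ.+-suc (suc a ℕ.* suc b) i)))
      (≡.trans (≡.sym (fromℕ-+ (suc a ℕ.* suc b) (suc i))) (≡.cong (_+ j) (≡.sym (fromℕ-* (suc a) (suc b)))))
    jrA≤1 : j * rA ≤ 1ℚ
    jrA≤1 = ℚ.≤-trans (*-monoʳ (recip-nonNeg a) (fromℕ-mono i<A)) (ℚ.≤-reflexive (fromℕ-recip a))

  Σ<-mono : ∀ n {f g} → (∀ i → i ℕ.< n → f i ≤ g i) → Σ< n f ≤ Σ< n g
  Σ<-mono zero    f≤g = ℚ.≤-refl
  Σ<-mono (suc n) f≤g = ℚ.+-mono-≤ (Σ<-mono n (λ i i<n → f≤g i (ℕ.m<n⇒m<1+n i<n))) (f≤g n (ℕ.n<1+n n))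

  -- `block a b` is a right Riemann sum over [b + 1, b + 2] with a + 1 steps. The values of the
  -- chord at the right ends sum to at most its integral, the trapezoid, because the chord descends.
  block-trapezoid : ∀ a b → block a b ≤ half (recip b + recip (suc b))
  block-trapezoid a b = begin
    block a b                                                                ≤⟨ Σ<-mono (suc a) (chord a b) ⟩
    Σ< (suc a) (λ i → rA * rb - fromℕ (suc i) * (rA * rA * (rb * rb′)))      ≤⟨ Σ<-linear (suc a) (rA * rb) (*-nonNeg (*-nonNeg (recip-nonNeg a) (recip-nonNeg a)) (*-nonNeg (recip-nonNeg b) (recip-nonNeg (suc b)))) ⟩
    A * (rA * rb) - A * A * ½ * (rA * rA * (rb * rb′))                       ≡⟨ solve 4 (λ A r b d → A :* (r :* b) :- A :* A :* con ½ :* (r :* r :* d) := (A :* r) :* b :- (A :* r) :* (A :* r) :* con ½ :* d) ≡.refl A rA rb (rb * rb′) ⟩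
    (A * rA) * rb - (A * rA) * (A * rA) * ½ * (rb * rb′)                     ≡⟨ ≡.cong₂ (λ y z → y * rb - y * y * ½ * z) (fromℕ-recip a) (≡.sym (recip-difference b)) ⟩
    1ℚ * rb - 1ℚ * 1ℚ * ½ * (rb - rb′)                                       ≡⟨ solve 2 (λ b c → con 1ℚ :* b :- con 1ℚ :* con 1ℚ :* con ½ :* (b :- c) := con ½ :* (b :+ c)) ≡.refl rb rb′ ⟩
    half (rb + rb′)                                                          ∎
    where
    A = fromℕ (suc a)
    rA = recip a
    rb = recip b
    rb′ = recip (suc b)

  -- `gap K n` drops by at most half of what 1 / (n + 1) drops by, so `gap K n - half (recip n)` is
  -- nondecreasing in n. The estimate is uniform in K and hence survives the passage to γ.
  gap-trapezoid : ∀ K {m n} → n ℕ.≤ m → gap K n - half (recip n) ≤ gap K m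
  gap-trapezoid K {m} {n} n≤m = begin
    gap K n - half (recip n)                             ≤⟨ go (ℕ.≤⇒≤′ n≤m) ⟩
    gap K m - half (recip m)                             ≤⟨ ≤-+ʳ (*-nonNeg (ℚ.<⇒≤ 0<½) (recip-nonNeg m)) ⟩
    gap K m - half (recip m) + half (recip m)            ≡⟨ solve 2 (λ x y → x :- y :+ y := x) ≡.refl (gap K m) (half (recip m)) ⟩
    gap K m                                              ∎
    where
    go : ∀ {m} → n ℕ.≤′ m → gap K n - half (recip n) ≤ gap K m - half (recip m)
    go ℕ.≤′-refl           = ℚ.≤-refl
    go (ℕ.≤′-step {m} n≤m) = ℚ.≤-trans (go n≤m) (begin
      g - ½ * r                          ≡⟨ solve 3 (λ g r s → g :- con ½ :* r := g :- con ½ :* (r :+ s) :+ con ½ :* s) ≡.refl g r s ⟩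
      g - half (r + s) + ½ * s           ≤⟨ ℚ.+-monoˡ-≤ (½ * s) (ℚ.+-monoʳ-≤ g (ℚ.neg-antimono-≤ (block-trapezoid K m))) ⟩
      g - block K m + ½ * s              ≡⟨ solve 3 (λ g b s → g :- b :+ con ½ :* s := g :- (b :- s) :- con ½ :* s) ≡.refl g (block K m) s ⟩
      g - (block K m - s) - ½ * s        ≡⟨ ≡.cong (λ z → g - z - ½ * s) (gap-step K m) ⟨
      g - (g - g′) - ½ * s               ≡⟨ solve 3 (λ g h s → g :- (g :- h) :- con ½ :* s := h :- con ½ :* s) ≡.refl g g′ s ⟩
      g′ - ½ * s                         ∎)
      where
      g = gap K m
      g′ = gap K (suc m)
      r = recip m
      s = recip (suc m)

  -- By the trapezoidal rule γ + log (n + 1) ≥ H_n + 1 / (2 (n + 1)).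
  E-γ-lower : ∀ n K → recip K ≤ half (recip n) → ∀ k → n ℕ.≤ k →
              E k (harmonic n + half (recip n) - recip K) ≤ fromℕ (suc n) * E k (seq γ k)
  E-γ-lower n K rK≤ k n≤k = begin
    E k (H + r - rK)                   ≡⟨ ≡.cong (E k) (solve 4 (λ h r s l → h :+ r :- s := h :+ r :- l :- s :+ l) ≡.refl H r rK (logSum n K)) ⟩
    E k (c + logSum n K)               ≤⟨ E-logSum 0≤c k n K ⟩
    fromℕ (suc n) * E k c              ≤⟨ *-monoˡ (fromℕ-nonNeg (suc n)) (E-mono 0≤c c≤γ k) ⟩
    fromℕ (suc n) * E k (seq γ k)      ∎
    where
    H = harmonic n
    r = half (recip n)
    rK = recip K
    c = H + r - logSum n K - rK
    -- `E-mono` asks for a nonnegative argument. As gap K n ≥ 1 / (n + 1), the difference r - rK is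
    -- a lower bound for c.
    0≤c : 0ℚ ≤ c
    0≤c = begin
      0ℚ                                            ≤⟨ 0≤- rK≤ ⟩
      r - rK                                        ≡⟨ solve 3 (λ r s q → r :- s := q :+ (r :- s :- q)) ≡.refl r rK (recip n) ⟩
      recip n + (r - rK - recip n)                  ≤⟨ ℚ.+-monoˡ-≤ (r - rK - recip n) (gap-lower K n) ⟩
      gap K n + (r - rK - recip n)                  ≡⟨ solve 5 (λ h q l r s → h :+ q :- l :+ (r :- s :- q) := h :+ r :- l :- s) ≡.refl H (recip n) (logSum n K) r rK ⟩
      c                                             ∎
    c≤gap : ∀ L → c ≤ gap L k
    c≤gap L = begin
      H + r - logSum n K - rK                       ≡⟨ solve 4 (λ h r l s → h :+ r :- l :- s := h :+ r :- (l :+ s)) ≡.refl H r (logSum n K) rK ⟩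
      H + r - (logSum n K + rK)                     ≤⟨ ℚ.+-monoʳ-≤ (H + r) (ℚ.neg-antimono-≤ (logSum-upper n K L)) ⟩
      H + r - logSum n L                            ≡⟨ solve 3 (λ h q l → h :+ con ½ :* q :- l := h :+ q :- l :- con ½ :* q) ≡.refl H (recip n) (logSum n L) ⟩
      gap L n - r                                   ≤⟨ gap-trapezoid L n≤k ⟩
      gap L k                                       ∎
    -- The k-th approximation of γ is `gap L k` for an L chosen inside `lim`; hence the bound above
    -- for every L.
    c≤γ : c ≤ seq γ k
    c≤γ = c≤gap (proj₁ (cauchy (γ-seq k) (recip k) (recip-pos k)))

-- From bounds on partial sums to the inequality of reals

module Reduction where

  open import Data.Rational.Base using (_+_; _*_; _-_; -_; _≤_; _<_; _/_)
  open import Data.Integer.Base using (+_)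
  open Real
  open ExponentialBounds
  open GammaBounds
  open ℚ.≤-Reasoning
  open +-*-Solver

  Bound : ℕ → ℚ → Set
  Bound n P = (exp γ *ℝ fromℚ (fromℕ (suc n))) ⁻¹⟨ expγ*suc-pos n ⟩ <ℝ fromℚ P

  1/pos-≤ : ∀ {t P} (0<t : 0ℚ < t) → 1ℚ ≤ t * P → 1/pos 0<t ≤ P
  1/pos-≤ 0<t 1≤tP = *-cancelˡ 0<t (ℚ.≤-trans (ℚ.≤-reflexive (1/pos-inverse 0<t)) 1≤tP)

  E-lower⇒Bound : ∀ n P {Y} → 0ℚ < Y → 1ℚ < Y * P →
                     ∃[ N ] (∀ k → N ℕ.≤ k → Y ≤ E k (seq γ k) * fromℕ (suc n)) → Bound n P
  E-lower⇒Bound n P {Y} 0<Y 1<YP (N , bound) = P - P′ , 0<P-P′ , N , λ k N≤k → begin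
    seq ((exp γ *ℝ fromℚ (fromℕ (suc n))) ⁻¹⟨ expγ*suc-pos n ⟩) k + (P - P′)
      -- The maximum with 1 belongs to the inverse: `expγ*suc-pos` certifies positivity with ε = 1.
      ≤⟨ ℚ.+-monoˡ-≤ (P - P′) (1/pos-≤ {E k (seq γ k) * fromℕ (suc n) ℚ.⊔ 1ℚ} {P′} (ℚ.<-≤-trans 0<1 (ℚ.p≤q⊔p (E k (seq γ k) * fromℕ (suc n)) 1ℚ)) (begin
           1ℚ                                                ≡⟨ 1/pos-inverse 0<Y ⟨
           Y * P′                                            ≤⟨ *-monoʳ 0≤P′ (ℚ.≤-trans (bound k N≤k) (ℚ.p≤p⊔q _ 1ℚ)) ⟩
           (E k (seq γ k) * fromℕ (suc n) ℚ.⊔ 1ℚ) * P′       ∎)) ⟩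
    P′ + (P - P′)    ≡⟨ solve 2 (λ x y → x :+ (y :- x) := y) ≡.refl P′ P ⟩
    P                ∎
    where
    P′ = 1/pos 0<Y
    0≤P′ = ℚ.<⇒≤ (1/pos-pos 0<Y)
    0<P-P′ : 0ℚ < P - P′
    0<P-P′ = begin-strict
      0ℚ               ≡⟨ ℚ.+-inverseʳ P′ ⟨
      P′ - P′          <⟨ ℚ.+-monoˡ-< (- P′) (begin-strict
          P′               ≡⟨ ℚ.*-identityˡ P′ ⟨
          1ℚ * P′          <⟨ ℚ.*-monoˡ-<-pos P′ {{ℚ.positive (1/pos-pos 0<Y)}} 1<YP ⟩
          Y * P * P′       ≡⟨ solve 3 (λ x y z → x :* y :* z := x :* z :* y) ≡.refl Y P P′ ⟩
          Y * P′ * P       ≡⟨ ≡.cong (_* P) (1/pos-inverse 0<Y) ⟩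
          1ℚ * P           ≡⟨ ℚ.*-identityˡ P ⟩
          P                ∎) ⟩
      P - P′           ∎

  -- The slack between x and the bound is split in two halves ρ: one becomes an extra factor 1 + ρ
  -- that makes the inequality strict, the other absorbs the error 1 / (K + 1) of the logarithm.
  ≤exp⇒Bound : ∀ n P {Q x} → 0ℚ < Q → Q * P ≡ 1ℚ → Q ≤exp x → x < harmonic n + half (recip n) → Bound n P
  ≤exp⇒Bound n P {Q} {x} 0<Q QP≡1 Q≤ x< = E-lower⇒Bound n P
    (*-pos 0<Q (ℚ.<-≤-trans 0<1 (≤-+ʳ (ℚ.<⇒≤ 0<ρ)))) (begin-strict
      1ℚ                    <⟨ ℚ.<-≤-trans (ℚ.≤-<-trans (ℚ.≤-reflexive (≡.sym (ℚ.+-identityʳ 1ℚ))) (ℚ.+-monoʳ-< 1ℚ 0<ρ)) ℚ.≤-refl ⟩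
      1ℚ + ρ                ≡⟨ ℚ.*-identityˡ (1ℚ + ρ) ⟨
      1ℚ * (1ℚ + ρ)         ≡⟨ ≡.cong (_* (1ℚ + ρ)) QP≡1 ⟨
      Q * P * (1ℚ + ρ)      ≡⟨ solve 3 (λ x y z → x :* y :* z := x :* z :* y) ≡.refl Q P (1ℚ + ρ) ⟩
      Q * (1ℚ + ρ) * P      ∎)
    (proj₁ large ℕ.⊔ n , λ k le → begin
      Q * (1ℚ + ρ)                          ≤⟨ proj₂ large k (ℕ.m⊔n≤o⇒m≤o (proj₁ large) n le) ⟩
      E k (x + ρ)                           ≤⟨ E-mono (≤exp-nonNeg c) x+ρ≤ k ⟩
      E k (h - recip K)                     ≤⟨ E-γ-lower n K (ℚ.<⇒≤ (proj₂ B K (ℕ.m≤n⊔m (proj₁ A) (proj₁ B)))) k (ℕ.m⊔n≤o⇒n≤o (proj₁ large) n le) ⟩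
      fromℕ (suc n) * E k (seq γ k)         ≡⟨ ℚ.*-comm (fromℕ (suc n)) (E k (seq γ k)) ⟩
      E k (seq γ k) * fromℕ (suc n)         ∎)
    where
    h = harmonic n + half (recip n)
    0<h-x : 0ℚ < h - x
    0<h-x = ℚ.≤-<-trans (ℚ.≤-reflexive (≡.sym (ℚ.+-inverseʳ x))) (ℚ.+-monoˡ-< (- x) x<)
    ρ = half (h - x)
    0<ρ = half-pos 0<h-x
    c = step Q≤ (ℚ.<⇒≤ 0<ρ)
    large = ≤exp⇒≤E c
    A = archimedean 0<ρ
    B = archimedean (half-pos (recip-pos n))
    K = proj₁ A ℕ.⊔ proj₁ B
    x+ρ≤ : x + ρ ≤ h - recip K
    x+ρ≤ = begin
      x + ρ            ≡⟨ solve 2 (λ x h → x :+ con ½ :* (h :- x) := h :- con ½ :* (h :- x)) ≡.refl x h ⟩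
      h - ρ            ≤⟨ ℚ.+-monoʳ-≤ h (ℚ.neg-antimono-≤ (ℚ.<⇒≤ (proj₂ A K (ℕ.m≤m⊔n (proj₁ A) (proj₁ B))))) ⟩
      h - recip K      ∎

  -- A lower bound for eᵞ = 1.78107…, good enough for (q, n) = (2, 2), where 9/16 eᵞ = 1.0018….
  e^γ⁻ : ℚ
  e^γ⁻ = + 889 / 500

  e^γ⁻-lower : ∀ k → 12 ℕ.≤ k → e^γ⁻ ≤ E k (seq γ k)
  e^γ⁻-lower k 12≤k = *-cancelˡ (fromℕ-pos 7) (begin
    fromℕ 8 * e^γ⁻                                        ≤⟨ toWitness {a? = fromℕ 8 * e^γ⁻ ℚ.≤? E 12 c} _ ⟩
    E 12 c                                               ≤⟨ E-monoᵏ 0≤c 12≤k ⟩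
    E k c                                                ≤⟨ E-mono 0≤c (toWitness {a? = c ℚ.≤? harmonic 7 + half (recip 7) - recip 2999} _) k ⟩
    E k (harmonic 7 + half (recip 7) - recip 2999)       ≤⟨ E-γ-lower 7 2999 (toWitness {a? = recip 2999 ℚ.≤? half (recip 7)} _) k (ℕ.≤-trans (ℕ.m≤m+n 7 5) 12≤k) ⟩
    fromℕ 8 * E k (seq γ k)                              ∎)
    where
    -- H_7 + 1/16 - 1/3000 = 2.65502..., and twelve terms of the series at 2.655 already give
    -- 14.2246... > 14.224 = 8 · 1.778.
    c = + 531 / 200
    0≤c : 0ℚ ≤ c
    0≤c = toWitness {a? = 0ℚ ℚ.≤? c} _

  e^γ⇒Bound : ∀ n P → 1ℚ < e^γ⁻ * fromℕ (suc n) * P → Bound n P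
  e^γ⇒Bound n P 1< = E-lower⇒Bound n P (*-pos (toWitness {a? = 0ℚ ℚ.<? e^γ⁻} _) (fromℕ-pos n)) 1<
    (12 , λ k 12≤k → *-monoʳ (fromℕ-nonNeg (suc n)) (e^γ⁻-lower k 12≤k))

-- The logarithm of the Euler product

module GeometricLogarithm where

  open import Data.Rational.Base using (_+_; _*_; _-_; _≤_; _<_)
  open Real
  open ExponentialBounds
  open GammaBounds
  open ℚ.≤-Reasoning
  open +-*-Solver
  open Mult ℚ.*-1-commutativeMonoid using () renaming (_×_ to power)

  infixr 8 _^_
  _^_ : ℚ → ℕ → ℚ
  x ^ n = power n x

  ^-nonNeg : ∀ {x} → 0ℚ ≤ x → ∀ n → 0ℚ ≤ x ^ n
  ^-nonNeg 0≤x zero    = ℚ.<⇒≤ 0<1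
  ^-nonNeg 0≤x (suc n) = *-nonNeg 0≤x (^-nonNeg 0≤x n)

  -- The tangent of t^(k + 1) at v lies below the graph; this is the convexity behind
  -- `logBound-step`.
  bernoulli : ∀ {v w} → 0ℚ ≤ v → 0ℚ ≤ w → ∀ k → v ^ suc k + fromℕ (suc k) * (w * v ^ k) ≤ (v + w) ^ suc k
  bernoulli {v} {w} 0≤v 0≤w zero = ℚ.≤-reflexive
    (solve 2 (λ v w → v :* con 1ℚ :+ con 1ℚ :* (w :* con 1ℚ) := (v :+ w) :* con 1ℚ) ≡.refl v w)
  bernoulli {v} {w} 0≤v 0≤w (suc k) = begin
    v * (v * p) + fromℕ (suc (suc k)) * (w * (v * p))     ≡⟨ ≡.cong (λ z → v * (v * p) + z * (w * (v * p))) (fromℕ-suc (suc k)) ⟩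
    v * (v * p) + (1ℚ + m) * (w * (v * p))                ≤⟨ ≤-+ʳ (*-nonNeg (fromℕ-nonNeg (suc k)) (*-nonNeg 0≤w (*-nonNeg 0≤w (^-nonNeg 0≤v k)))) ⟩
    v * (v * p) + (1ℚ + m) * (w * (v * p)) + m * (w * (w * p))
      ≡⟨ solve 4 (λ v w p m → v :* (v :* p) :+ (con 1ℚ :+ m) :* (w :* (v :* p)) :+ m :* (w :* (w :* p)) := (v :+ w) :* (v :* p :+ m :* (w :* p))) ≡.refl v w p m ⟩
    (v + w) * (v * p + m * (w * p))                       ≤⟨ *-monoˡ (ℚ.+-mono-≤ 0≤v 0≤w) (bernoulli 0≤v 0≤w k) ⟩
    (v + w) * (v + w) ^ suc k                             ∎
    where
    p = v ^ k
    m = fromℕ (suc k)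

  -- An upper bound for - log (1 - v), valid when g ≥ 1 / (1 - v).
  logBound : ℕ → ℚ → ℚ → ℚ
  logBound s g v = Σ< s (λ k → v ^ suc k * recip k) + v ^ suc s * recip s * g

  -- The bracket is the derivative of `logBound s g` at v, and the function is convex as a
  -- combination of powers with nonnegative coefficients.
  logBound-step : ∀ s {g v w} → 0ℚ ≤ g → 0ℚ ≤ v → 0ℚ ≤ w →
                  logBound s g v + w * (Σ< s (λ k → v ^ k) + v ^ s * g) ≤ logBound s g (v + w)
  logBound-step s {g} {v} {w} 0≤g 0≤v 0≤w = begin
    Σ< s (λ k → v ^ suc k * recip k) + v ^ suc s * recip s * g + w * (Σ< s (λ k → v ^ k) + v ^ s * g)
      ≡⟨ solve 6 (λ a b w c p g → a :+ b :* g :+ w :* (c :+ p :* g) := (a :+ w :* c) :+ (b :+ w :* p) :* g) ≡.refl (Σ< s (λ k → v ^ suc k * recip k)) (v ^ suc s * recip s) w (Σ< s (λ k → v ^ k)) (v ^ s) g ⟩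
    Σ< s (λ k → v ^ suc k * recip k) + w * Σ< s (λ k → v ^ k) + (v ^ suc s * recip s + w * v ^ s) * g
      ≤⟨ ℚ.+-mono-≤ (sum s) (*-monoʳ 0≤g (term s)) ⟩
    logBound s g (v + w) ∎
    where
    term : ∀ k → v ^ suc k * recip k + w * v ^ k ≤ (v + w) ^ suc k * recip k
    term k = begin
      v ^ suc k * recip k + w * v ^ k                                        ≡⟨ ≡.cong (λ z → v ^ suc k * recip k + z) (begin-equality
        w * v ^ k                                                              ≡⟨ ℚ.*-identityˡ (w * v ^ k) ⟨
        1ℚ * (w * v ^ k)                                                       ≡⟨ ≡.cong (_* (w * v ^ k)) (fromℕ-recip k) ⟨
        fromℕ (suc k) * recip k * (w * v ^ k)                                  ≡⟨ solve 3 (λ m r x → m :* r :* x := m :* x :* r) ≡.refl (fromℕ (suc k)) (recip k) (w * v ^ k) ⟩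
        fromℕ (suc k) * (w * v ^ k) * recip k                                  ∎) ⟩
      v ^ suc k * recip k + fromℕ (suc k) * (w * v ^ k) * recip k            ≡⟨ ℚ.*-distribʳ-+ (recip k) (v ^ suc k) (fromℕ (suc k) * (w * v ^ k)) ⟨
      (v ^ suc k + fromℕ (suc k) * (w * v ^ k)) * recip k                    ≤⟨ *-monoʳ (recip-nonNeg k) (bernoulli 0≤v 0≤w k) ⟩
      (v + w) ^ suc k * recip k                                              ∎
    sum : ∀ s → Σ< s (λ k → v ^ suc k * recip k) + w * Σ< s (λ k → v ^ k) ≤ Σ< s (λ k → (v + w) ^ suc k * recip k)
    sum zero    = ℚ.≤-reflexive (solve 1 (λ w → con 0ℚ :+ w :* con 0ℚ := con 0ℚ) ≡.refl w)
    sum (suc s) = ℚ.≤-trans (ℚ.≤-reflexive (solve 5 (λ a b w c d → a :+ b :+ w :* (c :+ d) := a :+ w :* c :+ (b :+ w :* d)) ≡.refl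
        (Σ< s (λ k → v ^ suc k * recip k)) (v ^ suc s * recip s) w (Σ< s (λ k → v ^ k)) (v ^ s)))
      (ℚ.+-mono-≤ (sum s) (term s))

  geometric-sum : ∀ v s → (1ℚ - v) * Σ< s (λ k → v ^ k) ≡ 1ℚ - v ^ s
  geometric-sum v zero    = ℚ.*-zeroʳ (1ℚ - v)
  geometric-sum v (suc s) = ≡.trans (ℚ.*-distribˡ-+ (1ℚ - v) _ _) (≡.trans (≡.cong (_+ (1ℚ - v) * v ^ s) (geometric-sum v s))
    (solve 2 (λ v p → con 1ℚ :- p :+ (con 1ℚ :- v) :* p := con 1ℚ :- v :* p) ≡.refl v (v ^ s)))

  inverse-nonNeg : ∀ {a b} → 0ℚ < a → a * b ≡ 1ℚ → 0ℚ ≤ b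
  inverse-nonNeg {a} 0<a ab≡1 = *-cancelˡ 0<a (ℚ.≤-trans (ℚ.≤-reflexive (ℚ.*-zeroʳ a)) (ℚ.≤-trans (ℚ.<⇒≤ 0<1) (ℚ.≤-reflexive (≡.sym ab≡1))))

  -- 1 / (1 - v) is the partial geometric sum plus v^s / (1 - v), and g = 1 / (1 - u) dominates 1 /
  -- (1 - v) for v ≤ u. So `logBound s g` grows at least as fast as - log (1 - v).
  geometric-upper : ∀ s {u v g h} → 0ℚ ≤ v → v ≤ u → 0ℚ < 1ℚ - u → (1ℚ - u) * g ≡ 1ℚ → (1ℚ - v) * h ≡ 1ℚ →
                    h ≤ Σ< s (λ k → v ^ k) + v ^ s * g
  geometric-upper s {u} {v} {g} {h} 0≤v v≤u 0<1-u ug≡1 vh≡1 = *-cancelˡ 0<1-v (begin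
    (1ℚ - v) * h                                        ≡⟨ vh≡1 ⟩
    1ℚ                                                  ≡⟨ solve 1 (λ p → con 1ℚ := con 1ℚ :- p :+ p :* con 1ℚ) ≡.refl p ⟩
    1ℚ - p + p * 1ℚ                                     ≡⟨ ≡.cong (λ z → 1ℚ - p + p * z) ug≡1 ⟨
    1ℚ - p + p * ((1ℚ - u) * g)                         ≤⟨ ℚ.+-monoʳ-≤ (1ℚ - p) (*-monoˡ (^-nonNeg 0≤v s) (*-monoʳ (inverse-nonNeg 0<1-u ug≡1) 1-u≤1-v)) ⟩
    1ℚ - p + p * ((1ℚ - v) * g)                         ≡⟨ ≡.cong (_+ p * ((1ℚ - v) * g)) (geometric-sum v s) ⟨
    (1ℚ - v) * Σ< s (λ k → v ^ k) + p * ((1ℚ - v) * g)  ≡⟨ solve 4 (λ a s p g → a :* s :+ p :* (a :* g) := a :* (s :+ p :* g)) ≡.refl (1ℚ - v) (Σ< s (λ k → v ^ k)) p g ⟩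
    (1ℚ - v) * (Σ< s (λ k → v ^ k) + p * g)             ∎)
    where
    p = v ^ s
    1-u≤1-v : 1ℚ - u ≤ 1ℚ - v
    1-u≤1-v = ℚ.+-monoʳ-≤ 1ℚ (ℚ.neg-antimono-≤ v≤u)
    0<1-v : 0ℚ < 1ℚ - v
    0<1-v = ℚ.<-≤-trans 0<1-u 1-u≤1-v

  -- The telescoping product of (1 - vᵢ) / (1 - vᵢ₊₁) = 1 + w / (1 - vᵢ₊₁), where vᵢ = i w,
  -- has as sum of its increments a Riemann sum of dv / (1 - v).
  telescope-step : ∀ s {u g v w h h′ x} → 0ℚ ≤ v → 0ℚ ≤ w → v + w ≤ u → 0ℚ < 1ℚ - u → (1ℚ - u) * g ≡ 1ℚ →
                   (1ℚ - v) * h ≡ 1ℚ → (1ℚ - (v + w)) * h′ ≡ 1ℚ → h ≤exp x → x ≤ logBound s g v + (w * h - w) →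
                   h′ ≤exp x + w * h′ × x + w * h′ ≤ logBound s g (v + w) + (w * h′ - w)
  telescope-step s {u} {g} {v} {w} {h} {h′} {x} 0≤v 0≤w v+w≤u 0<1-u ug≡1 vh≡1 vh′≡1 c x≤ =
    ≡.subst (_≤exp x + w * h′) product (step c (*-nonNeg 0≤w (inverse-nonNeg 0<1-v-w vh′≡1))) , (begin
      x + w * h′                                              ≤⟨ ℚ.+-monoˡ-≤ (w * h′) x≤ ⟩
      l + (w * h - w) + w * h′                                ≡⟨ solve 4 (λ l w h k → l :+ (w :* h :- w) :+ w :* k := l :+ w :* h :+ (w :* k :- w)) ≡.refl l w h h′ ⟩
      l + w * h + (w * h′ - w)                                ≤⟨ ℚ.+-monoˡ-≤ (w * h′ - w) (ℚ.≤-trans (ℚ.+-monoʳ-≤ l (*-monoˡ 0≤w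
                                                                   (geometric-upper s 0≤v (ℚ.≤-trans (≤-+ʳ 0≤w) v+w≤u) 0<1-u ug≡1 vh≡1)))
                                                                   (logBound-step s (inverse-nonNeg 0<1-u ug≡1) 0≤v 0≤w)) ⟩
      logBound s g (v + w) + (w * h′ - w)                     ∎)
    where
    l = logBound s g v
    0<1-v-w : 0ℚ < 1ℚ - (v + w)
    0<1-v-w = ℚ.<-≤-trans 0<1-u (ℚ.+-monoʳ-≤ 1ℚ (ℚ.neg-antimono-≤ v+w≤u))
    product : h * (1ℚ + w * h′) ≡ h′
    product = begin-equality
      h * (1ℚ + w * h′)                              ≡⟨ ≡.cong (λ z → h * (z + w * h′)) vh′≡1 ⟨
      h * ((1ℚ - (v + w)) * h′ + w * h′)             ≡⟨ solve 4 (λ h v w k → h :* ((con 1ℚ :- (v :+ w)) :* k :+ w :* k) := (con 1ℚ :- v) :* h :* k) ≡.refl h v w h′ ⟩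
      (1ℚ - v) * h * h′                              ≡⟨ ≡.cong (_* h′) vh≡1 ⟩
      1ℚ * h′                                        ≡⟨ ℚ.*-identityˡ h′ ⟩
      h′                                             ∎

  module _ (s : ℕ) {u g w : ℚ} (0≤w : 0ℚ ≤ w) (0<1-u : 0ℚ < 1ℚ - u) (ug≡1 : (1ℚ - u) * g ≡ 1ℚ) where

    -- The increments sample dv / (1 - v) at the right ends of the steps, while convexity controls
    -- the left ends. The difference of the two sums telescopes to the error term w h - w.
    Certified : ℚ → ℚ → Set
    Certified v h = ∃[ x ] h ≤exp x × x ≤ logBound s g v + (w * h - w)

    certify-step : ∀ v v′ h′ → 0ℚ ≤ v → v′ ≡ v + w → v′ ≤ u → (1ℚ - v′) * h′ ≡ 1ℚ →
                   (∀ h → v ≤ u → (1ℚ - v) * h ≡ 1ℚ → Certified v h) → Certified v′ h′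
    certify-step v .(v + w) h′ 0≤v ≡.refl v+w≤u vh′≡1 previous = extend (1/pos 0<1-v) (1/pos-inverse 0<1-v)
      where
      v≤u : v ≤ u
      v≤u = ℚ.≤-trans (≤-+ʳ 0≤w) v+w≤u
      0<1-v : 0ℚ < 1ℚ - v
      0<1-v = ℚ.<-≤-trans 0<1-u (ℚ.+-monoʳ-≤ 1ℚ (ℚ.neg-antimono-≤ v≤u))
      extend : ∀ h → (1ℚ - v) * h ≡ 1ℚ → Certified (v + w) h′
      extend h vh≡1 with previous h v≤u vh≡1
      ... | x , c , x≤ = x + w * h′ , telescope-step s {u} {g} {v} {w} {h} {h′} {x} 0≤v 0≤w v+w≤u 0<1-u ug≡1 vh≡1 vh′≡1 c x≤

    telescope : ∀ i → ∀ v h → v ≡ fromℕ i * w → v ≤ u → (1ℚ - v) * h ≡ 1ℚ → Certified v h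
    telescope zero v h v≡ v≤u vh≡1 = 0ℚ , ≡.subst (_≤exp 0ℚ) (≡.sym h≡1) one , (begin
      0ℚ                                   ≤⟨ ℚ.+-mono-≤ (Σ<-nonNeg s (λ k → *-nonNeg (^-nonNeg 0≤v (suc k)) (recip-nonNeg k)))
                                                (*-nonNeg (*-nonNeg (^-nonNeg 0≤v (suc s)) (recip-nonNeg s)) (inverse-nonNeg 0<1-u ug≡1)) ⟩
      logBound s g v                       ≡⟨ solve 2 (λ l w → l := l :+ (w :* con 1ℚ :- w)) ≡.refl (logBound s g v) w ⟩
      logBound s g v + (w * 1ℚ - w)        ≡⟨ ≡.cong (λ z → logBound s g v + (w * z - w)) h≡1 ⟨
      logBound s g v + (w * h - w)         ∎)
      where
      v≡0 : v ≡ 0ℚ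
      v≡0 = ≡.trans v≡ (ℚ.*-zeroˡ w)
      0≤v : 0ℚ ≤ v
      0≤v = ℚ.≤-reflexive (≡.sym v≡0)
      1≡1-v : 1ℚ ≡ 1ℚ - v
      1≡1-v = ≡.cong (λ z → 1ℚ - z) (≡.sym v≡0)
      h≡1 : h ≡ 1ℚ
      h≡1 = ≡.trans (≡.sym (ℚ.*-identityˡ h)) (≡.trans (≡.cong (_* h) 1≡1-v) vh≡1)
    telescope (suc i) v′ h′ v≡ v≤u vh≡1 = certify-step (fromℕ i * w) v′ h′ (*-nonNeg (fromℕ-nonNeg i) 0≤w)
      (≡.trans v≡ (≡.sym (suc-* i w))) v≤u vh≡1 (λ h → telescope i (fromℕ i * w) h ≡.refl)

  -- The interval from 0 to u is cut into N + 1 steps of width w = u / (N + 1); as u ≤ 1, the error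
  -- w g - w is at most g / (N + 1).
  discretised : ∀ s N {u g} → 0ℚ ≤ u → 0ℚ < 1ℚ - u → (1ℚ - u) * g ≡ 1ℚ → ∃[ x ] g ≤exp x × x ≤ logBound s g u + recip N * g
  discretised s N {u} {g} 0≤u 0<1-u ug≡1 = refine (u * recip N) ≡.refl
    where
    0≤g : 0ℚ ≤ g
    0≤g = inverse-nonNeg 0<1-u ug≡1
    refine : ∀ w → w ≡ u * recip N → ∃[ x ] g ≤exp x × x ≤ logBound s g u + recip N * g
    refine w w≡ = bound (telescope s 0≤w 0<1-u ug≡1 (suc N) u g u≡ ℚ.≤-refl ug≡1)
      where
      0≤w : 0ℚ ≤ w
      0≤w = ℚ.≤-trans (*-nonNeg 0≤u (recip-nonNeg N)) (ℚ.≤-reflexive (≡.sym w≡))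
      u≡ : u ≡ fromℕ (suc N) * w
      u≡ = begin-equality
        u                                ≡⟨ ℚ.*-identityʳ u ⟨
        u * 1ℚ                           ≡⟨ ≡.cong (u *_) (fromℕ-recip N) ⟨
        u * (fromℕ (suc N) * recip N)    ≡⟨ solve 3 (λ n u r → u :* (n :* r) := n :* (u :* r)) ≡.refl (fromℕ (suc N)) u (recip N) ⟩
        fromℕ (suc N) * (u * recip N)    ≡⟨ ≡.cong (fromℕ (suc N) *_) w≡ ⟨
        fromℕ (suc N) * w                ∎
      bound : (∃[ x ] g ≤exp x × x ≤ logBound s g u + (w * g - w)) → ∃[ x ] g ≤exp x × x ≤ logBound s g u + recip N * g
      bound (x , c , x≤) = x , c , ℚ.≤-trans x≤ (ℚ.+-monoʳ-≤ (logBound s g u) (begin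
        w * g - w                  ≤⟨ ≤-+ʳ 0≤w ⟩
        w * g - w + w              ≡⟨ solve 2 (λ w g → w :* g :- w :+ w := w :* g) ≡.refl w g ⟩
        w * g                      ≡⟨ ≡.cong (_* g) w≡ ⟩
        u * recip N * g            ≤⟨ *-monoʳ 0≤g (*-monoʳ (recip-nonNeg N) (-≤0 {u} {1ℚ} (ℚ.<⇒≤ 0<1-u))) ⟩
        1ℚ * recip N * g           ≡⟨ ≡.cong (_* g) (ℚ.*-identityˡ (recip N)) ⟩
        recip N * g                ∎))

  1/1-≤exp : ∀ s {u g ρ} → 0ℚ ≤ u → 0ℚ < 1ℚ - u → (1ℚ - u) * g ≡ 1ℚ → 0ℚ < ρ → ∃[ x ] g ≤exp x × x ≤ logBound s g u + ρ
  1/1-≤exp s {u} {g} {ρ} 0≤u 0<1-u ug≡1 0<ρ = choose (divide {g + 1ℚ} ρ 0<g+1 0<ρ)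
    where
    0<g+1 : 0ℚ < g + 1ℚ
    0<g+1 = ℚ.+-mono-≤-< {0ℚ} {g} {0ℚ} {1ℚ} (inverse-nonNeg {1ℚ - u} {g} 0<1-u ug≡1) 0<1
    choose : (∃[ δ ] 0ℚ < δ × (g + 1ℚ) * δ ≡ ρ) → ∃[ x ] g ≤exp x × x ≤ logBound s g u + ρ
    choose (δ , 0<δ , gδ≡ρ) = widen (discretised s N {u} {g} 0≤u 0<1-u ug≡1)
      where
      N = proj₁ (archimedean 0<δ)
      small : recip N ≤ δ
      small = ℚ.<⇒≤ (proj₂ (archimedean 0<δ) N ℕ.≤-refl)
      g≤g+1 : g ≤ g + 1ℚ
      g≤g+1 = ≤-+ʳ {g} {1ℚ} (ℚ.<⇒≤ 0<1)
      N*g≤ρ : recip N * g ≤ ρ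
      N*g≤ρ = ≡.subst (recip N * g ≤_) (≡.trans (ℚ.*-comm δ (g + 1ℚ)) gδ≡ρ)
        (*-mono {recip N} {δ} {g} {g + 1ℚ} (recip-nonNeg N) (ℚ.<⇒≤ 0<g+1) small g≤g+1)
      widen : (∃[ x ] g ≤exp x × x ≤ logBound s g u + recip N * g) → ∃[ x ] g ≤exp x × x ≤ logBound s g u + ρ
      widen (x , c , x≤) = x , c , ℚ.≤-trans x≤ (ℚ.+-monoʳ-≤ (logBound s g u) N*g≤ρ)

-- Estimates for the tail

module TailBound where

  open import Data.Rational.Base using (_+_; _*_; _-_; _≤_; _/_)
  open import Data.Integer.Base using (+_)
  open Real
  open ExponentialBounds
  open GammaBounds
  open GeometricLogarithm
  open ℚ.≤-Reasoning
  open +-*-Solver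

  ^-mono : ∀ {x y} → 0ℚ ≤ x → x ≤ y → ∀ n → x ^ n ≤ y ^ n
  ^-mono 0≤x x≤y zero    = ℚ.≤-refl
  ^-mono 0≤x x≤y (suc n) = *-mono 0≤x (^-nonNeg (ℚ.≤-trans 0≤x x≤y) n) x≤y (^-mono 0≤x x≤y n)

  ^-antitone : ∀ {x m n} → 0ℚ ≤ x → x ≤ 1ℚ → m ℕ.≤ n → x ^ n ≤ x ^ m
  ^-antitone {x} 0≤x x≤1 m≤n = go (ℕ.≤⇒≤′ m≤n)
    where
    go : ∀ {m n} → m ℕ.≤′ n → x ^ n ≤ x ^ m
    go ℕ.≤′-refl           = ℚ.≤-refl
    go (ℕ.≤′-step {n} m≤n) = ℚ.≤-trans (*-monoʳ (^-nonNeg 0≤x n) x≤1) (ℚ.≤-trans (ℚ.≤-reflexive (ℚ.*-identityˡ (x ^ n))) (go m≤n))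

  -- With x = 1 / q, r = 1 / (q - 1) and n = m + 1 this bounds (n + 1) times the part of
  -- - log ∏ (1 - 1 / ‖p‖) beyond H_n; the sum runs over the degrees d = i + 2.
  tailBound : ℚ → ℚ → ℕ → ℚ
  tailBound x r m = x ^ m * r + Σ< m (λ i → x ^ ((2 ℕ.+ i) ℕ.⊔ (m ℕ.∸ i)))

  tailBound-mono : ∀ {x y r t} → 0ℚ ≤ x → x ≤ y → 0ℚ ≤ t → r ≤ t → ∀ m → tailBound x r m ≤ tailBound y t m
  tailBound-mono 0≤x x≤y 0≤t r≤t m = ℚ.+-mono-≤ (*-mono (^-nonNeg 0≤x m) 0≤t (^-mono 0≤x x≤y m) r≤t)
    (Σ<-mono m (λ i _ → ^-mono 0≤x x≤y ((2 ℕ.+ i) ℕ.⊔ (m ℕ.∸ i))))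

  Σ<-cong : ∀ n {f g} → (∀ i → i ℕ.< n → f i ≡ g i) → Σ< n f ≡ Σ< n g
  Σ<-cong zero    e = ≡.refl
  Σ<-cong (suc n) e = ≡.cong₂ _+_ (Σ<-cong n (λ i i<n → e i (ℕ.m<n⇒m<1+n i<n))) (e n (ℕ.n<1+n n))

  Σ<-0 : ∀ n f → Σ< (suc n) f ≡ f 0 + Σ< n (λ i → f (suc i))
  Σ<-0 zero    f = ℚ.+-comm 0ℚ (f 0)
  Σ<-0 (suc n) f = ≡.trans (≡.cong (_+ f (suc n)) (Σ<-0 n f)) (ℚ.+-assoc (f 0) _ _)

  -- The term i + 1 for m + 2 is half of the term i for m, as max (3 + i, m + 1 - i) = 1 + max (2 +
  -- i, m - i). The new first term joins ½^(m + 2) to form half of ½^m, and the new last term is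
  -- ½^(m + 3).
  tailBound-+2 : ∀ m → tailBound ½ 1ℚ (2 ℕ.+ m) ≡ ½ * tailBound ½ 1ℚ m + ½ ^ (3 ℕ.+ m)
  tailBound-+2 m = begin-equality
    ½ ^ (2 ℕ.+ m) * 1ℚ + (Σ< (suc m) f + ½ ^ ((3 ℕ.+ m) ℕ.⊔ (suc m ℕ.∸ m)))
      ≡⟨ ≡.cong₂ (λ y e → ½ ^ (2 ℕ.+ m) * 1ℚ + (y + ½ ^ e)) (Σ<-0 m f) (ℕ.m≥n⇒m⊔n≡m (ℕ.≤-trans (ℕ.m∸n≤m (suc m) m) (ℕ.m≤n+m (suc m) 2))) ⟩
    ½ ^ (2 ℕ.+ m) * 1ℚ + (½ ^ (2 ℕ.+ m) + Σ< m (λ i → f (suc i)) + ½ ^ (3 ℕ.+ m))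
      ≡⟨ ≡.cong (λ y → ½ ^ (2 ℕ.+ m) * 1ℚ + (½ ^ (2 ℕ.+ m) + y + ½ ^ (3 ℕ.+ m))) middle ⟩
    ½ * (½ * p) * 1ℚ + (½ * (½ * p) + ½ * S + ½ * (½ * (½ * p)))
      ≡⟨ solve 2 (λ p s → con ½ :* (con ½ :* p) :* con 1ℚ :+ (con ½ :* (con ½ :* p) :+ con ½ :* s :+ con ½ :* (con ½ :* (con ½ :* p)))
           := con ½ :* (p :* con 1ℚ :+ s) :+ con ½ :* (con ½ :* (con ½ :* p))) ≡.refl p S ⟩
    ½ * (p * 1ℚ + S) + ½ * (½ * (½ * p)) ∎
    where
    f : ℕ → ℚ
    f i = ½ ^ ((2 ℕ.+ i) ℕ.⊔ ((2 ℕ.+ m) ℕ.∸ i))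
    p = ½ ^ m
    S = Σ< m (λ i → ½ ^ ((2 ℕ.+ i) ℕ.⊔ (m ℕ.∸ i)))
    middle : Σ< m (λ i → f (suc i)) ≡ ½ * S
    middle = ≡.trans (Σ<-cong m (λ i i<m → ≡.cong (λ e → ½ ^ ((3 ℕ.+ i) ℕ.⊔ e)) (ℕ.+-∸-assoc 1 (ℕ.<⇒≤ i<m))))
      (Σ<-*ˡ m ½ (λ i → ½ ^ ((2 ℕ.+ i) ℕ.⊔ (m ℕ.∸ i))))

  -- 7/16 is the exact value at 3 and lies below the ½ granted by the trapezoidal rule. A step of
  -- two preserves it, since 7/32 + 1/8 = 11/32 is smaller; hence two initial values.
  tailBound-½ : ∀ m → tailBound ½ 1ℚ (3 ℕ.+ m) ≤ + 7 / 16
  tailBound-½ zero          = toWitness {a? = tailBound ½ 1ℚ 3 ℚ.≤? + 7 / 16} _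
  tailBound-½ (suc zero)    = toWitness {a? = tailBound ½ 1ℚ 4 ℚ.≤? + 7 / 16} _
  tailBound-½ (suc (suc m)) = begin
    tailBound ½ 1ℚ (5 ℕ.+ m)                               ≡⟨ tailBound-+2 (3 ℕ.+ m) ⟩
    ½ * tailBound ½ 1ℚ (3 ℕ.+ m) + ½ ^ (6 ℕ.+ m)           ≤⟨ ℚ.+-mono-≤ (*-monoˡ (ℚ.<⇒≤ 0<½) (tailBound-½ m))
                                                                (^-antitone {½} {3} (ℚ.<⇒≤ 0<½) (toWitness {a? = ½ ℚ.≤? 1ℚ} _) (ℕ.m≤m+n 3 (3 ℕ.+ m))) ⟩
    ½ * (+ 7 / 16) + ½ ^ 3                                 ≤⟨ toWitness {a? = ½ * (+ 7 / 16) + ½ ^ 3 ℚ.≤? + 7 / 16} _ ⟩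
    + 7 / 16                                               ∎

  -- Indexed by q - 2 and n - 1; the missing cases are q = 2, n ≤ 3 and q = 3, n = 1.
  data Generic : ℕ → ℕ → Set where
    large-n : ∀ q m → Generic q (3 ℕ.+ m)
    n≡1     : ∀ q → Generic (2 ℕ.+ q) 0
    n≡2     : ∀ q → Generic (1 ℕ.+ q) 1
    n≡3     : ∀ q → Generic (1 ℕ.+ q) 2

  -- The bound decreases as q grows, so it is checked at the smallest admissible q. The omitted
  -- pairs (q , n) are those where it reaches ½: its values are 1 at (2 , 1), 3/4 at (2 , 2), 5/8 at
  -- (2 , 3) and ½ at (3 , 1).
  tailBound-generic : ∀ {q m} → Generic q m → tailBound (recip (suc q)) (recip q) m ≤ + 7 / 16
  tailBound-generic (large-n q m) = ℚ.≤-trans (tailBound-mono (recip-nonNeg (suc q)) (recip-antitone {1} {suc q} (s≤s z≤n))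
    (ℚ.<⇒≤ 0<1) (recip-antitone {0} {q} z≤n) (3 ℕ.+ m)) (tailBound-½ m)
  tailBound-generic (n≡1 q) = ℚ.≤-trans (tailBound-mono (recip-nonNeg (3 ℕ.+ q)) (recip-antitone {3} {3 ℕ.+ q} (ℕ.m≤m+n 3 q))
    (recip-nonNeg 2) (recip-antitone {2} {2 ℕ.+ q} (ℕ.m≤m+n 2 q)) 0) (toWitness {a? = tailBound (recip 3) (recip 2) 0 ℚ.≤? + 7 / 16} _)
  tailBound-generic (n≡2 q) = ℚ.≤-trans (tailBound-mono (recip-nonNeg (2 ℕ.+ q)) (recip-antitone {2} {2 ℕ.+ q} (ℕ.m≤m+n 2 q))
    (recip-nonNeg 1) (recip-antitone {1} {1 ℕ.+ q} (ℕ.m≤m+n 1 q)) 1) (toWitness {a? = tailBound (recip 2) (recip 1) 1 ℚ.≤? + 7 / 16} _)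
  tailBound-generic (n≡3 q) = ℚ.≤-trans (tailBound-mono (recip-nonNeg (2 ℕ.+ q)) (recip-antitone {2} {2 ℕ.+ q} (ℕ.m≤m+n 2 q))
    (recip-nonNeg 1) (recip-antitone {1} {1 ℕ.+ q} (ℕ.m≤m+n 1 q)) 2) (toWitness {a? = tailBound (recip 2) (recip 1) 2 ℚ.≤? + 7 / 16} _)

-- Transfer of finite sums to the rationals

module RationalSums where

  open import Data.Rational.Base using (_+_; _*_; _≤_)
  open Real
  open ExponentialBounds

  module ΣN = ListSum ℕ.+-0-commutativeMonoid
  module ΣQ = ListSum ℚ.+-0-commutativeMonoid

  ∑-mono : ∀ {a} {A : Set a} (xs : List A) {f g} → (∀ {x} → x ∈ xs → f x ≤ g x) → ΣQ.∑ xs f ≤ ΣQ.∑ xs g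
  ∑-mono []       f≤g = ℚ.≤-refl
  ∑-mono (x ∷ xs) f≤g = ℚ.+-mono-≤ (f≤g (here ≡.refl)) (∑-mono xs (f≤g ∘ there))

  ∑-nonNeg : ∀ {a} {A : Set a} (xs : List A) {f} → (∀ x → 0ℚ ≤ f x) → 0ℚ ≤ ΣQ.∑ xs f
  ∑-nonNeg []       0≤f = ℚ.≤-refl
  ∑-nonNeg (x ∷ xs) 0≤f = ℚ.+-mono-≤ (0≤f x) (∑-nonNeg xs 0≤f)

  ∈⇒≤∑ : ∀ {a} {A : Set a} {xs : List A} {x} {f : A → ℚ} → (∀ x → 0ℚ ≤ f x) → x ∈ xs → f x ≤ ΣQ.∑ xs f
  ∈⇒≤∑ {xs = x ∷ xs} 0≤f (here ≡.refl) = ≤-+ʳ (∑-nonNeg xs 0≤f)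
  ∈⇒≤∑ {xs = y ∷ xs} {x} {f} 0≤f (there x∈) = ℚ.≤-trans (∈⇒≤∑ 0≤f x∈)
    (ℚ.≤-trans (≤-+ʳ (0≤f y)) (ℚ.≤-reflexive (ℚ.+-comm (ΣQ.∑ xs f) (f y))))

  ∑≡Σ< : ∀ n f → ΣQ.∑ (upTo n) f ≡ Σ< n f
  ∑≡Σ< zero    f = ≡.refl
  ∑≡Σ< (suc n) f = ≡.trans (ΣQ.∑-upTo-suc n f) (≡.cong (_+ f n) (∑≡Σ< n f))

  Σ<-monoⁿ : ∀ {m n} f → (∀ i → 0ℚ ≤ f i) → m ℕ.≤ n → Σ< m f ≤ Σ< n f
  Σ<-monoⁿ f 0≤f m≤n = go (ℕ.≤⇒≤′ m≤n)
    where
    go : ∀ {m n} → m ℕ.≤′ n → Σ< m f ≤ Σ< n f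
    go ℕ.≤′-refl           = ℚ.≤-refl
    go (ℕ.≤′-step {n} m≤n) = ℚ.≤-trans (go m≤n) (≤-+ʳ (0≤f n))

  *-∑ : ∀ {a} {A : Set a} c (xs : List A) f → c * ΣQ.∑ xs f ≡ ΣQ.∑ xs (λ y → c * f y)
  *-∑ c = ∑-homo ℚ.+-0-commutativeMonoid ℚ.+-0-commutativeMonoid (c *_) (ℚ.*-zeroʳ c) (ℚ.*-distribˡ-+ c)

  *-fromℕ-∑ : ∀ {a} {A : Set a} c (xs : List A) f → c * fromℕ (ΣN.∑ xs f) ≡ ΣQ.∑ xs (λ y → c * fromℕ (f y))
  *-fromℕ-∑ c = ∑-homo ℕ.+-0-commutativeMonoid ℚ.+-0-commutativeMonoid (λ n → c * fromℕ n) (ℚ.*-zeroʳ c)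
    (λ m n → ≡.trans (≡.cong (c *_) (≡.sym (fromℕ-+ m n))) (ℚ.*-distribˡ-+ c (fromℕ m) (fromℕ n)))

  ·≡fromℕ-* : ∀ n y → n ΣQ.· y ≡ fromℕ n * y
  ·≡fromℕ-* zero    y = ≡.sym (ℚ.*-zeroˡ y)
  ·≡fromℕ-* (suc n) y = ≡.trans (≡.cong (λ z → y + z) (·≡fromℕ-* n y)) (≡.trans (ℚ.+-comm y (fromℕ n * y)) (suc-* n y))

open RationalSums using (module ΣN; module ΣQ)

-- All that the analysis uses about the field: with `π` abstract, the estimates concern only q and a
-- sequence of numbers.
record PrimeCount (q : ℕ) (π : ℕ → ℕ) : Set where
  field
    π-1     : π 1 ≡ q
    π-bound : ∀ d → 2 ℕ.≤ d → q ℕ.+ d ℕ.* π d ℕ.≤ q ℕ.^ d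
    π-sum   : ∀ n j → 1 ℕ.≤ j → j ℕ.≤ n →
              ΣN.∑ (upTo (suc n)) (λ d → π d ℕ.* (d ℕ.* ΣN.∑ (upTo n) (λ k → 𝟙 (suc k ℕ.* d ℕ.≟ j)))) ≡ q ℕ.^ j

-- Main terms and tails, degree by degree

module EulerProductLogarithm {q″ : ℕ} {π : ℕ → ℕ} (count : PrimeCount (2 ℕ.+ q″) π)
  {x : ℚ} (qx≡1 : Real.fromℕ (2 ℕ.+ q″) ℚ.* x ≡ 1ℚ) where

  open import Data.Rational.Base using (_+_; _*_; _-_; _≤_; _<_)
  open Real
  open ExponentialBounds
  open GammaBounds
  open GeometricLogarithm
  open TailBound
  open RationalSums
  open PrimeCount count
  open ℚ.≤-Reasoning
  open +-*-Solver
  open Mult ℚ.*-1-commutativeMonoid using (×-assocˡ)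

  private
    q = 2 ℕ.+ q″

  inverse-pos : ∀ {a b} → 0ℚ < a → a * b ≡ 1ℚ → 0ℚ < b
  inverse-pos {a} {b} 0<a ab≡1 = ≡.subst (0ℚ <_) (begin-equality
    i                ≡⟨ ℚ.*-identityʳ i ⟨
    i * 1ℚ           ≡⟨ ≡.cong (i *_) ab≡1 ⟨
    i * (a * b)      ≡⟨ solve 3 (λ i a b → i :* (a :* b) := (a :* i) :* b) ≡.refl i a b ⟩
    (a * i) * b      ≡⟨ ≡.cong (_* b) (1/pos-inverse 0<a) ⟩
    1ℚ * b           ≡⟨ ℚ.*-identityˡ b ⟩
    b                ∎) (1/pos-pos 0<a)
    where i = 1/pos 0<a

  0≤x : 0ℚ ≤ x
  0≤x = inverse-nonNeg {fromℕ q} {x} (fromℕ-pos (suc q″)) qx≡1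

  x≤1 : x ≤ 1ℚ
  x≤1 = *-cancelˡ {x} {1ℚ} {fromℕ q} (fromℕ-pos (suc q″)) (begin
    fromℕ q * x       ≡⟨ qx≡1 ⟩
    fromℕ 1           ≤⟨ fromℕ-mono {1} {q} (s≤s z≤n) ⟩
    fromℕ q           ≡⟨ ℚ.*-identityʳ (fromℕ q) ⟨
    fromℕ q * 1ℚ      ∎)

  q^*x^ : ∀ d → fromℕ (q ℕ.^ d) * x ^ d ≡ 1ℚ
  q^*x^ zero    = ≡.refl
  q^*x^ (suc d) = begin-equality
    fromℕ (q ℕ.* q ℕ.^ d) * (x * x ^ d)               ≡⟨ ≡.cong (_* (x * x ^ d)) (fromℕ-* q (q ℕ.^ d)) ⟨
    fromℕ q * fromℕ (q ℕ.^ d) * (x * x ^ d)           ≡⟨ solve 4 (λ a b x y → a :* b :* (x :* y) := (a :* x) :* (b :* y)) ≡.refl (fromℕ q) (fromℕ (q ℕ.^ d)) x (x ^ d) ⟩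
    (fromℕ q * x) * (fromℕ (q ℕ.^ d) * x ^ d)         ≡⟨ ≡.cong₂ _*_ qx≡1 (q^*x^ d) ⟩
    1ℚ                                                ∎

  -- For d ≥ 1 this is 1 / (1 - 1 / qᵈ) = qᵈ / (qᵈ - 1); recall recip k = 1 / (k + 1).
  geometric : ℕ → ℚ
  geometric d = fromℕ (q ℕ.^ d) * recip (q ℕ.^ d ℕ.∸ 2)

  q^-suc : ∀ d → 1 ℕ.≤ d → q ℕ.^ d ≡ 2 ℕ.+ (q ℕ.^ d ℕ.∸ 2)
  q^-suc d 1≤d = ≡.sym (ℕ.m+[n∸m]≡n (ℕ.≤-trans (ℕ.≤-trans (ℕ.m≤m+n 2 q″) (ℕ.≤-reflexive (≡.sym (ℕ.*-identityʳ q)))) (ℕ.^-monoʳ-≤ q 1≤d)))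

  geometric-inverse : ∀ d → 1 ℕ.≤ d → (1ℚ - x ^ d) * geometric d ≡ 1ℚ
  geometric-inverse d 1≤d = generic (fromℕ (q ℕ.^ d)) (x ^ d) (q ℕ.^ d ℕ.∸ 2)
    (≡.trans (≡.cong fromℕ (q^-suc d 1≤d)) (fromℕ-suc (suc (q ℕ.^ d ℕ.∸ 2)))) (q^*x^ d)
    where
    generic : ∀ Q y e → Q ≡ 1ℚ + fromℕ (suc e) → Q * y ≡ 1ℚ → (1ℚ - y) * (Q * recip e) ≡ 1ℚ
    generic Q y e Q≡ Qy≡1 = begin-equality
      (1ℚ - y) * (Q * r)          ≡⟨ solve 3 (λ y Q r → (con 1ℚ :- y) :* (Q :* r) := (Q :- Q :* y) :* r) ≡.refl y Q r ⟩
      (Q - Q * y) * r             ≡⟨ ≡.cong₂ (λ a b → (a - b) * r) Q≡ Qy≡1 ⟩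
      (1ℚ + m - 1ℚ) * r           ≡⟨ solve 2 (λ m r → (con 1ℚ :+ m :- con 1ℚ) :* r := m :* r) ≡.refl m r ⟩
      m * r                       ≡⟨ fromℕ-recip e ⟩
      1ℚ                          ∎
      where
      r = recip e
      m = fromℕ (suc e)

  geometric-pos : ∀ d → 1 ℕ.≤ d → 0ℚ < geometric d
  geometric-pos d 1≤d = *-pos (≡.subst (λ z → 0ℚ < fromℕ z) (≡.sym (q^-suc d 1≤d)) (fromℕ-pos (suc (q ℕ.^ d ℕ.∸ 2)))) (recip-pos (q ℕ.^ d ℕ.∸ 2))

  0<1-x^ : ∀ d → 1 ℕ.≤ d → 0ℚ < 1ℚ - x ^ d
  0<1-x^ d 1≤d = inverse-pos {geometric d} {1ℚ - x ^ d} (geometric-pos d 1≤d)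
    (≡.trans (ℚ.*-comm (geometric d) (1ℚ - x ^ d)) (geometric-inverse d 1≤d))

  module _ (n : ℕ) where

    -- main d and tail d are the parts of Σₖ x^(d k) / k with d k ≤ n and d k > n.
    hits : ℕ → ℕ → ℕ
    hits d j = d ℕ.* ΣN.∑ (upTo n) (λ k → 𝟙 (suc k ℕ.* d ℕ.≟ suc j))

    main : ℕ → ℚ
    main d = ΣQ.∑ (upTo n) (λ j → x ^ suc j * recip j * fromℕ (hits d j))

    tail : ℕ → ℚ
    -- A default value: `upTo (suc n)` starts at degree 0, where the quotient n / d makes no sense.
    tail zero      = 0ℚ
    tail d@(suc _) = (x ^ d) ^ suc (n ℕ./ d) * recip (n ℕ./ d) * geometric d

    -- `main` is indexed by j = d k instead of k so that Gauss' identity applies to each j. The term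
    -- x^(d k) / k reappears as d x^j / j, and the other entries of the double sum are nonnegative.
    main-lower : ∀ d′ s → s ℕ.* suc d′ ℕ.≤ n → Σ< s (λ k → (x ^ suc d′) ^ suc k * recip k) ≤ main (suc d′)
    main-lower d′ s sd≤n = begin
      Σ< s (λ k → (x ^ d) ^ suc k * recip k)                                 ≤⟨ Σ<-mono s hit ⟩
      Σ< s row                                                               ≤⟨ Σ<-monoⁿ row row-nonNeg s≤n ⟩
      Σ< n row                                                               ≡⟨ ∑≡Σ< n row ⟨
      ΣQ.∑ (upTo n) (λ k → ΣQ.∑ (upTo n) (entry k))                          ≡⟨ ΣQ.∑-swap (upTo n) (upTo n) entry ⟩
      ΣQ.∑ (upTo n) (λ j → ΣQ.∑ (upTo n) (λ k → entry k j))                  ≡⟨ ΣQ.∑-cong (upTo n) (λ {j} _ → column j) ⟨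
      main d                                                                 ∎
      where
      d = suc d′
      c : ℕ → ℚ
      c j = x ^ suc j * recip j
      entry : ℕ → ℕ → ℚ
      entry k j = c j * fromℕ d * fromℕ (𝟙 (suc k ℕ.* d ℕ.≟ suc j))
      row : ℕ → ℚ
      row k = ΣQ.∑ (upTo n) (entry k)
      column : ∀ j → c j * fromℕ (hits d j) ≡ ΣQ.∑ (upTo n) (λ k → entry k j)
      column j = ≡.trans (≡.cong (c j *_) (≡.sym (fromℕ-* d (ΣN.∑ (upTo n) (λ k → 𝟙 (suc k ℕ.* d ℕ.≟ suc j))))))
        (≡.trans (≡.sym (ℚ.*-assoc (c j) (fromℕ d) _)) (*-fromℕ-∑ (c j * fromℕ d) (upTo n) (λ k → 𝟙 (suc k ℕ.* d ℕ.≟ suc j))))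
      c-nonNeg : ∀ j → 0ℚ ≤ c j
      c-nonNeg j = *-nonNeg (^-nonNeg 0≤x (suc j)) (recip-nonNeg j)
      entry-nonNeg : ∀ k j → 0ℚ ≤ entry k j
      entry-nonNeg k j = *-nonNeg (*-nonNeg (c-nonNeg j) (fromℕ-nonNeg d)) (fromℕ-nonNeg (𝟙 (suc k ℕ.* d ℕ.≟ suc j)))
      row-nonNeg : ∀ k → 0ℚ ≤ row k
      row-nonNeg k = ∑-nonNeg (upTo n) (entry-nonNeg k)
      s≤n : s ℕ.≤ n
      s≤n = ℕ.≤-trans (ℕ.m≤m*n s d) sd≤n
      hit : ∀ k → k ℕ.< s → (x ^ d) ^ suc k * recip k ≤ row k
      hit k k<s = begin
        (x ^ d) ^ suc k * recip k                          ≡⟨ ≡.cong₂ _*_ (×-assocˡ x (suc k) d) (≡.sym (scale-recip d′ k j (ℕ.*-comm (suc k) d))) ⟩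
        x ^ suc j * (fromℕ d * recip j)                    ≡⟨ solve 3 (λ y m r → y :* (m :* r) := y :* r :* m :* con 1ℚ) ≡.refl (x ^ suc j) (fromℕ d) (recip j) ⟩
        c j * fromℕ d * fromℕ 1                            ≡⟨ ≡.cong (λ z → c j * fromℕ d * fromℕ z) (𝟙-yes ≡.refl (suc k ℕ.* d ℕ.≟ suc j)) ⟨
        entry k j                                          ≤⟨ ∈⇒≤∑ {f = entry k} (entry-nonNeg k) (∈-upTo⁺ (ℕ.≤-trans (ℕ.*-monoˡ-≤ d k<s) sd≤n)) ⟩
        row k                                              ∎
        where j = d′ ℕ.+ k ℕ.* d

    logBound≤ : ∀ d → .{{_ : ℕ.NonZero d}} → logBound (n ℕ./ d) (geometric d) (x ^ d) ≤ main d + tail d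
    logBound≤ d@(suc d′) = ℚ.+-monoˡ-≤ (tail d) (main-lower d′ (n ℕ./ d) (ℕ.m/n*n≤m n d))

    -- For each exponent j from 1 to n, Gauss' identity produces q^j, which cancels x^j and leaves 1
    -- / j.
    main-sum : ΣQ.∑ (upTo (suc n)) (λ d → fromℕ (π d) * main d) ≡ harmonic n
    main-sum = begin-equality
      ΣQ.∑ D (λ d → fromℕ (π d) * main d)
        ≡⟨ ΣQ.∑-cong D (λ {d} _ → *-∑ (fromℕ (π d)) (upTo n) (λ j → c j * fromℕ (hits d j))) ⟩
      ΣQ.∑ D (λ d → ΣQ.∑ (upTo n) (λ j → fromℕ (π d) * (c j * fromℕ (hits d j))))
        ≡⟨ ΣQ.∑-cong D (λ {d} _ → ΣQ.∑-cong (upTo n) (λ {j} _ → combine (π d) (c j) (hits d j))) ⟩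
      ΣQ.∑ D (λ d → ΣQ.∑ (upTo n) (λ j → c j * fromℕ (π d ℕ.* hits d j)))
        ≡⟨ ΣQ.∑-swap D (upTo n) (λ d j → c j * fromℕ (π d ℕ.* hits d j)) ⟩
      ΣQ.∑ (upTo n) (λ j → ΣQ.∑ D (λ d → c j * fromℕ (π d ℕ.* hits d j)))
        ≡⟨ ΣQ.∑-cong (upTo n) (λ {j} j∈ → gauss j (∈-upTo⁻ j∈)) ⟩
      ΣQ.∑ (upTo n) recip
        ≡⟨ ∑≡Σ< n recip ⟩
      harmonic n ∎
      where
      D = upTo (suc n)
      c : ℕ → ℚ
      c j = x ^ suc j * recip j
      combine : ∀ a y b → fromℕ a * (y * fromℕ b) ≡ y * fromℕ (a ℕ.* b)
      combine a y b = ≡.trans (solve 3 (λ a y b → a :* (y :* b) := y :* (a :* b)) ≡.refl (fromℕ a) y (fromℕ b)) (≡.cong (y *_) (fromℕ-* a b))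
      gauss : ∀ j → j ℕ.< n → ΣQ.∑ D (λ d → c j * fromℕ (π d ℕ.* hits d j)) ≡ recip j
      gauss j j<n = begin-equality
        ΣQ.∑ D (λ d → c j * fromℕ (π d ℕ.* hits d j))       ≡⟨ *-fromℕ-∑ (c j) D (λ d → π d ℕ.* hits d j) ⟨
        c j * fromℕ (ΣN.∑ D (λ d → π d ℕ.* hits d j))       ≡⟨ ≡.cong (λ z → c j * fromℕ z) (π-sum n (suc j) (s≤s z≤n) j<n) ⟩
        x ^ suc j * recip j * fromℕ (q ℕ.^ suc j)           ≡⟨ solve 3 (λ y r m → y :* r :* m := r :* (m :* y)) ≡.refl (x ^ suc j) (recip j) (fromℕ (q ℕ.^ suc j)) ⟩
        recip j * (fromℕ (q ℕ.^ suc j) * x ^ suc j)         ≡⟨ ≡.cong (recip j *_) (q^*x^ (suc j)) ⟩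
        recip j * 1ℚ                                        ≡⟨ ℚ.*-identityʳ (recip j) ⟩
        recip j                                             ∎

    recip-≤ : ∀ d s → suc n ℕ.≤ suc s ℕ.* d → recip s ≤ fromℕ d * recip n
    recip-≤ d s n<sd = begin
      recip s                                                ≡⟨ ℚ.*-identityʳ (recip s) ⟨
      recip s * 1ℚ                                           ≡⟨ ≡.cong (recip s *_) (fromℕ-recip n) ⟨
      recip s * (fromℕ (suc n) * recip n)                    ≤⟨ *-monoˡ {fromℕ (suc n) * recip n} {fromℕ (suc s ℕ.* d) * recip n} (recip-nonNeg s)
                                                                  (*-monoʳ {fromℕ (suc n)} {fromℕ (suc s ℕ.* d)} (recip-nonNeg n) (fromℕ-mono n<sd)) ⟩
      recip s * (fromℕ (suc s ℕ.* d) * recip n)              ≡⟨ ≡.cong (λ z → recip s * (z * recip n)) (fromℕ-* (suc s) d) ⟨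
      recip s * (fromℕ (suc s) * fromℕ d * recip n)          ≡⟨ solve 4 (λ r a d t → r :* (a :* d :* t) := a :* r :* (d :* t)) ≡.refl (recip s) (fromℕ (suc s)) (fromℕ d) (recip n) ⟩
      fromℕ (suc s) * recip s * (fromℕ d * recip n)          ≡⟨ ≡.cong (_* (fromℕ d * recip n)) (fromℕ-recip s) ⟩
      1ℚ * (fromℕ d * recip n)                               ≡⟨ ℚ.*-identityˡ (fromℕ d * recip n) ⟩
      fromℕ d * recip n                                      ∎

    -- With A = x^d, Q = q^d and s the floor of n / d, the facts Q A = 1, 1 / (s + 1) ≤ d / (n + 1)
    -- and d π(d) ≤ Q - 1 reduce the tail to A^s / (n + 1).
    tail-≥2 : ∀ d k → 2 ℕ.≤ d → (d≢0 : ℕ.NonZero d) → k ℕ.≤ (n ℕ./ d) {{d≢0}} ℕ.* d → fromℕ (π d) * tail d ≤ recip n * x ^ k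
    tail-≥2 d@(suc d′) k 2≤d _ k≤sd = bound (x ^ d) (fromℕ (q ℕ.^ d)) (q ℕ.^ d ℕ.∸ 2) (^-nonNeg 0≤x d) (fromℕ-nonNeg (q ℕ.^ d)) (q^*x^ d)
      (ℕ.s≤s⁻¹ (ℕ.≤-trans (ℕ.+-monoˡ-≤ (d ℕ.* π d) (s≤s (z≤n {suc q″})))
        (ℕ.≤-trans (π-bound d 2≤d) (ℕ.≤-reflexive (q^-suc d (ℕ.≤-trans (ℕ.n≤1+n 1) 2≤d)))))) xᵈˢ≤
      where
      s = n ℕ./ d
      n<sd+d : n ℕ.< suc s ℕ.* d
      n<sd+d = ℕ.≤-<-trans (ℕ.≤-reflexive (ℕ.m≡m%n+[m/n]*n n d)) (ℕ.+-monoˡ-< (s ℕ.* d) (ℕ.m%n<n n d))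
      xᵈˢ≤ : (x ^ d) ^ s ≤ x ^ k
      xᵈˢ≤ = ℚ.≤-trans (ℚ.≤-reflexive (×-assocˡ x s d)) (^-antitone 0≤x x≤1 k≤sd)
      bound : ∀ A Q e → 0ℚ ≤ A → 0ℚ ≤ Q → Q * A ≡ 1ℚ → d ℕ.* π d ℕ.≤ suc e → A ^ s ≤ x ^ k →
              fromℕ (π d) * (A * A ^ s * recip s * (Q * recip e)) ≤ recip n * x ^ k
      bound A Q e 0≤A 0≤Q QA≡1 dπ≤ Aˢ≤ = begin
        p * (A * A ^ s * recip s * (Q * t))          ≡⟨ solve 6 (λ p A B r Q t → p :* (A :* B :* r :* (Q :* t)) := (p :* (A :* B) :* (Q :* t)) :* r) ≡.refl p A (A ^ s) (recip s) Q t ⟩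
        p * (A * A ^ s) * (Q * t) * recip s          ≤⟨ *-monoˡ {recip s} {fromℕ d * recip n} (*-nonNeg (*-nonNeg (fromℕ-nonNeg (π d)) (*-nonNeg 0≤A (^-nonNeg 0≤A s))) (*-nonNeg 0≤Q (recip-nonNeg e)))
                                                          (recip-≤ d s n<sd+d) ⟩
        p * (A * A ^ s) * (Q * t) * (m * recip n)    ≡⟨ solve 7 (λ p A B Q t m r → p :* (A :* B) :* (Q :* t) :* (m :* r) := r :* B :* ((Q :* A) :* (m :* p :* t))) ≡.refl p A (A ^ s) Q t m (recip n) ⟩
        recip n * A ^ s * ((Q * A) * (m * p * t))    ≡⟨ ≡.cong₂ (λ y z → recip n * A ^ s * (y * (z * t))) QA≡1 (fromℕ-* d (π d)) ⟩
        recip n * A ^ s * (1ℚ * (fromℕ (d ℕ.* π d) * t)) ≤⟨ *-monoˡ {1ℚ * (fromℕ (d ℕ.* π d) * t)} {1ℚ} (*-nonNeg (recip-nonNeg n) (^-nonNeg 0≤A s)) (begin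
            1ℚ * (fromℕ (d ℕ.* π d) * t)               ≡⟨ ℚ.*-identityˡ (fromℕ (d ℕ.* π d) * t) ⟩
            fromℕ (d ℕ.* π d) * t                      ≤⟨ *-monoʳ {fromℕ (d ℕ.* π d)} {fromℕ (suc e)} (recip-nonNeg e) (fromℕ-mono dπ≤) ⟩
            fromℕ (suc e) * t                          ≡⟨ fromℕ-recip e ⟩
            1ℚ                                         ∎) ⟩
        recip n * A ^ s * 1ℚ                         ≡⟨ ℚ.*-identityʳ (recip n * A ^ s) ⟩
        recip n * A ^ s                              ≤⟨ *-monoˡ {A ^ s} {x ^ k} (recip-nonNeg n) Aˢ≤ ⟩
        recip n * x ^ k                              ∎
        where
        p = fromℕ (π d)
        m = fromℕ d
        t = recip e

  -- Degree 1 is computed exactly: π(1) = q exceeds q - 1, so the estimate for d ≥ 2 would fail.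
  tail-1 : ∀ m → fromℕ (π 1) * tail (suc m) 1 ≡ recip (suc m) * (x ^ m * recip q″)
  tail-1 m = begin-equality
    fromℕ (π 1) * ((x ^ 1) ^ suc (n ℕ./ 1) * recip (n ℕ./ 1) * (fromℕ (q ℕ.^ 1) * recip (q ℕ.^ 1 ℕ.∸ 2)))
      ≡⟨ ≡.cong₂ (λ a s → fromℕ a * ((x ^ 1) ^ suc s * recip s * (fromℕ (q ℕ.^ 1) * recip (q ℕ.^ 1 ℕ.∸ 2)))) π-1 (ℕ.n/1≡n n) ⟩
    fromℕ q * ((x ^ 1) ^ suc n * recip n * (fromℕ (q ℕ.^ 1) * recip (q ℕ.^ 1 ℕ.∸ 2)))
      ≡⟨ ≡.cong₂ (λ y Q → fromℕ q * (y * recip n * (fromℕ Q * recip (Q ℕ.∸ 2))))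
           (≡.trans (×-assocˡ x (suc n) 1) (≡.cong (x ^_) (ℕ.*-identityʳ (suc n)))) (ℕ.*-identityʳ q) ⟩
    fromℕ q * (x * (x * x ^ m) * recip n * (fromℕ q * recip q″))
      ≡⟨ solve 5 (λ Q x y r t → Q :* (x :* (x :* y) :* r :* (Q :* t)) := (Q :* x) :* (Q :* x) :* (r :* (y :* t))) ≡.refl (fromℕ q) x (x ^ m) (recip n) (recip q″) ⟩
    (fromℕ q * x) * (fromℕ q * x) * (recip n * (x ^ m * recip q″))
      ≡⟨ ≡.cong (λ z → z * z * (recip n * (x ^ m * recip q″))) qx≡1 ⟩
    1ℚ * 1ℚ * (recip n * (x ^ m * recip q″))
      ≡⟨ ℚ.*-identityˡ (recip n * (x ^ m * recip q″)) ⟩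
    recip n * (x ^ m * recip q″) ∎
    where n = suc m

  tail-sum : ∀ m → ΣQ.∑ (upTo (2 ℕ.+ m)) (λ d → fromℕ (π d) * tail (suc m) d) ≤ recip (suc m) * tailBound x (recip q″) m
  tail-sum m = begin
    ΣQ.∑ (upTo (2 ℕ.+ m)) f                                  ≡⟨ ΣQ.∑-upTo-0 (suc m) f ⟩
    f 0 + ΣQ.∑ (upTo (suc m)) (f ∘ suc)                      ≡⟨ ≡.cong₂ _+_ (ℚ.*-zeroʳ (fromℕ (π 0))) (ΣQ.∑-upTo-0 m (f ∘ suc)) ⟩
    0ℚ + (f 1 + ΣQ.∑ (upTo m) (λ i → f (2 ℕ.+ i)))           ≡⟨ ≡.trans (ℚ.+-identityˡ _) (≡.cong₂ _+_ (tail-1 m) (∑≡Σ< m (λ i → f (2 ℕ.+ i)))) ⟩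
    r * (x ^ m * recip q″) + Σ< m (λ i → f (2 ℕ.+ i))        ≤⟨ ℚ.+-monoʳ-≤ (r * (x ^ m * recip q″)) (Σ<-mono m rest) ⟩
    r * (x ^ m * recip q″) + Σ< m (λ i → r * g i)            ≡⟨ ≡.cong (λ z → r * (x ^ m * recip q″) + z) (Σ<-*ˡ m r g) ⟩
    r * (x ^ m * recip q″) + r * Σ< m g                      ≡⟨ ℚ.*-distribˡ-+ r (x ^ m * recip q″) (Σ< m g) ⟨
    r * tailBound x (recip q″) m                             ∎
    where
    n = suc m
    r = recip n
    f : ℕ → ℚ
    f d = fromℕ (π d) * tail n d
    g : ℕ → ℚ
    g i = x ^ ((2 ℕ.+ i) ℕ.⊔ (m ℕ.∸ i))
    rest : ∀ i → i ℕ.< m → f (2 ℕ.+ i) ≤ r * g i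
    -- With s the floor of n / d, s d is at least d because d ≤ n, and it exceeds n - d, which for n
    -- = m + 1 and d = i + 2 means s d ≥ m - i. This is the origin of the maximum in `tailBound`.
    rest i i<m = tail-≥2 n d ((2 ℕ.+ i) ℕ.⊔ (m ℕ.∸ i)) (s≤s (s≤s z≤n)) _ (ℕ.⊔-lub
      (ℕ.m≤n*m d (n ℕ./ d) {{ℕ.>-nonZero (ℕ.m≥n⇒m/n>0 (s≤s i<m))}})
      (ℕ.m≤n+o⇒m∸n≤o m i (ℕ.s≤s⁻¹ (ℕ.s≤s⁻¹ (ℕ.≤-<-trans (ℕ.≤-reflexive (ℕ.m≡m%n+[m/n]*n n d)) (ℕ.+-monoˡ-< ((n ℕ./ d) ℕ.* d) (ℕ.m%n<n n d)))))))
      where d = 2 ℕ.+ i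

  total : ∀ m → ΣQ.∑ (upTo (2 ℕ.+ m)) (λ d → fromℕ (π d) * (main (suc m) d + tail (suc m) d)) ≤
                harmonic (suc m) + recip (suc m) * tailBound x (recip q″) m
  total m = begin
    ΣQ.∑ D (λ d → fromℕ (π d) * (main n d + tail n d))
      ≡⟨ ΣQ.∑-cong D (λ {d} _ → ℚ.*-distribˡ-+ (fromℕ (π d)) (main n d) (tail n d)) ⟩
    ΣQ.∑ D (λ d → fromℕ (π d) * main n d + fromℕ (π d) * tail n d)
      ≡⟨ ΣQ.∑-+ D (λ d → fromℕ (π d) * main n d) (λ d → fromℕ (π d) * tail n d) ⟩
    ΣQ.∑ D (λ d → fromℕ (π d) * main n d) + ΣQ.∑ D (λ d → fromℕ (π d) * tail n d)
      ≤⟨ ℚ.+-mono-≤ (ℚ.≤-reflexive (main-sum n)) (tail-sum m) ⟩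
    harmonic n + recip n * tailBound x (recip q″) m ∎
    where
    n = suc m
    D = upTo (suc n)

  geometric-≤exp : ∀ n d {ρ} → 1 ℕ.≤ d → 0ℚ < ρ → ∃[ y ] geometric d ≤exp y × y ≤ main n d + tail n d + ρ
  geometric-≤exp n d@(suc _) {ρ} 1≤d 0<ρ = relax
    (1/1-≤exp (n ℕ./ d) {x ^ d} {geometric d} {ρ} (^-nonNeg 0≤x d) (0<1-x^ d 1≤d) (geometric-inverse d 1≤d) 0<ρ)
    where
    relax : (∃[ y ] geometric d ≤exp y × y ≤ logBound (n ℕ./ d) (geometric d) (x ^ d) + ρ) → ∃[ y ] geometric d ≤exp y × y ≤ main n d + tail n d + ρ
    relax (y , c , y≤) = y , c , ℚ.≤-trans y≤ (ℚ.+-monoˡ-≤ ρ (logBound≤ n d))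

-- Exact counts of irreducibles for q = 2

module SmallPrimeCounts {π : ℕ → ℕ} where

  -- The divisor sum in Gauss' identity evaluates by computation and leaves 2 + 2 π(2) = 4; in the
  -- same way 2 + 3 π(3) = 8 gives the next count.
  π-2 : PrimeCount 2 π → π 2 ≡ 1
  π-2 count = ℕ.*-cancelʳ-≡ (π 2) 1 2 (ℕ.+-cancelˡ-≡ 2 (π 2 ℕ.* 2) 2 (begin
    2 ℕ.* 1 ℕ.+ π 2 ℕ.* 2                                ≡⟨ ≡.cong₂ (λ a b → a ℕ.* 1 ℕ.+ b) π-1 (ℕ.+-identityʳ (π 2 ℕ.* 2)) ⟨
    π 1 ℕ.* 1 ℕ.+ (π 2 ℕ.* 2 ℕ.+ 0)                      ≡⟨ ≡.cong (ℕ._+ (π 1 ℕ.* 1 ℕ.+ (π 2 ℕ.* 2 ℕ.+ 0))) (ℕ.*-zeroʳ (π 0)) ⟨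
    π 0 ℕ.* 0 ℕ.+ (π 1 ℕ.* 1 ℕ.+ (π 2 ℕ.* 2 ℕ.+ 0))      ≡⟨ π-sum 2 2 (s≤s z≤n) ℕ.≤-refl ⟩
    4                                                    ∎))
    where
    open ≡.≡-Reasoning
    open PrimeCount count

  π-3 : PrimeCount 2 π → π 3 ≡ 2
  π-3 count = ℕ.*-cancelʳ-≡ (π 3) 2 3 (ℕ.+-cancelˡ-≡ 2 (π 3 ℕ.* 3) 6 (begin
    2 ℕ.* 1 ℕ.+ π 3 ℕ.* 3
      ≡⟨ ≡.cong₂ (λ a b → a ℕ.* 1 ℕ.+ b) π-1 (ℕ.+-identityʳ (π 3 ℕ.* 3)) ⟨
    π 1 ℕ.* 1 ℕ.+ (π 3 ℕ.* 3 ℕ.+ 0)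
      ≡⟨ ≡.cong₂ (λ a b → a ℕ.+ (π 1 ℕ.* 1 ℕ.+ (b ℕ.+ (π 3 ℕ.* 3 ℕ.+ 0)))) (ℕ.*-zeroʳ (π 0)) (ℕ.*-zeroʳ (π 2)) ⟨
    π 0 ℕ.* 0 ℕ.+ (π 1 ℕ.* 1 ℕ.+ (π 2 ℕ.* 0 ℕ.+ (π 3 ℕ.* 3 ℕ.+ 0)))
      ≡⟨ π-sum 3 3 (s≤s z≤n) ℕ.≤-refl ⟩
    8 ∎))
    where
    open ≡.≡-Reasoning
    open PrimeCount count

-- The bound for the Euler product

module EulerProductBound {c ℓ : Level} {q″ : ℕ} (F : FiniteField c ℓ (suc (suc q″))) where

  open import Data.Rational.Base using (_+_; _*_; _-_; _≤_; _<_; _/_)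
  open import Data.Integer.Base using (+_)
  open Real using (fromℕ; recip; half; harmonic; recip-nonNeg; recip-pos; fromℕ-recip; fromℕ-nonNeg)
  open Polynomials F
  open EulerProduct using (product≤)
  open EulerProduct F using (factor; ‖_‖; ‖‖-nonZero)
  open PrimeCounting F
  open PrimePolynomialTheorem F
  open ExponentialBounds
  open GeometricLogarithm
  open TailBound
  open RationalSums
  open Reduction
  open ℚ.≤-Reasoning
  open +-*-Solver
  module ΠQ = ListSum ℚ.*-1-commutativeMonoid

  count : PrimeCount (2 ℕ.+ q″) π
  count = record { π-1 = π-1 ; π-bound = π-bound ; π-sum = prime-polynomial-theorem }

  x : ℚ
  x = recip (suc q″)

  open EulerProductLogarithm count {x} (fromℕ-recip (suc q″))

  1/-unique : ∀ N .{{_ : ℕ.NonZero N}} {y} → fromℕ N * y ≡ 1ℚ → + 1 / N ≡ y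
  1/-unique (suc k) {y} Ny≡1 = begin-equality
    recip k                              ≡⟨ ℚ.*-identityʳ (recip k) ⟨
    recip k * 1ℚ                         ≡⟨ ≡.cong (recip k *_) Ny≡1 ⟨
    recip k * (fromℕ (suc k) * y)        ≡⟨ solve 3 (λ r m y → r :* (m :* y) := m :* r :* y) ≡.refl (recip k) (fromℕ (suc k)) y ⟩
    fromℕ (suc k) * recip k * y          ≡⟨ ≡.cong (_* y) (fromℕ-recip k) ⟩
    1ℚ * y                               ≡⟨ ℚ.*-identityˡ y ⟩
    y                                    ∎

  factor≡ : ∀ p → factor p ≡ 1ℚ - x ^ deg p
  factor≡ p = ≡.cong (λ y → 1ℚ - y) (1/-unique ‖ p ‖ {{‖‖-nonZero p}} {x ^ deg p} (q^*x^ (deg p)))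

  product≡∏ : ∀ n → product≤ F n ≡ ΠQ.∑ (irreducibles≤ n) (λ p → 1ℚ - x ^ deg p)
  product≡∏ n = go (irreducibles≤ n)
    where
    go : ∀ ps → foldr _*_ 1ℚ (map factor ps) ≡ ΠQ.∑ ps (λ p → 1ℚ - x ^ deg p)
    go []       = ≡.refl
    go (p ∷ ps) = ≡.cong₂ _*_ (factor≡ p) (go ps)

  product-by-degree : ∀ n → product≤ F n ≡ ΠQ.∑ (upTo (suc n)) (λ d → π d ΠQ.· (1ℚ - x ^ d))
  product-by-degree n = ≡.trans (product≡∏ n) (∑-by-degree ℚ.*-1-commutativeMonoid n (λ d → 1ℚ - x ^ d))

  ≤exp-∏ : ∀ {a} {A : Set a} (ps : List A) (g b : A → ℚ) → (∀ {p} → p ∈ ps → ∃[ y ] g p ≤exp y × y ≤ b p) →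
           ∃[ y ] ΠQ.∑ ps g ≤exp y × y ≤ ΣQ.∑ ps b
  ≤exp-∏ []       g b bound = 0ℚ , one , ℚ.≤-refl
  ≤exp-∏ (p ∷ ps) g b bound = combine (bound (here ≡.refl)) (≤exp-∏ ps g b (bound ∘ there))
    where
    combine : (∃[ y ] g p ≤exp y × y ≤ b p) → (∃[ y ] ΠQ.∑ ps g ≤exp y × y ≤ ΣQ.∑ ps b) →
              ∃[ y ] g p * ΠQ.∑ ps g ≤exp y × y ≤ b p + ΣQ.∑ ps b
    combine (y , c , y≤) (z , d , z≤) = y + z , ≤exp-* c d , ℚ.+-mono-≤ y≤ z≤

  ∏-pos : ∀ {a} {A : Set a} (ps : List A) {g : A → ℚ} → (∀ {p} → p ∈ ps → 0ℚ < g p) → 0ℚ < ΠQ.∑ ps g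
  ∏-pos []       0<g = Real.0<1
  ∏-pos (p ∷ ps) 0<g = Real.*-pos (0<g (here ≡.refl)) (∏-pos ps (0<g ∘ there))

  irreducible-degree-≥1 : ∀ n {p} → p ∈ irreducibles≤ n → 1 ℕ.≤ deg p
  irreducible-degree-≥1 n {p} p∈ = irreducible-degree p (proj₂ (proj₂ (irreducibles≤-∈⁻ n p∈)))

  generic-Bound : ∀ {m} → Generic q″ m → Bound (suc m) (product≤ F (suc m))
  generic-Bound {m} gen = conclude (≤exp-∏ I (geometric ∘ deg) (λ p → b (deg p) + ρ)
      (λ {p} p∈ → geometric-≤exp n (deg p) (irreducible-degree-≥1 n p∈) 0<ρ))
    where
    n = suc m
    I = irreducibles≤ n
    r = recip n
    b : ℕ → ℚ
    b d = main n d + tail n d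
    -- Every irreducible gets an equal share of r / 32, which fits between 7/16 and ½. `recip`
    -- divides by the length plus one, so an empty list is harmless.
    ρ = recip (length I) * (+ 1 / 32 * r)
    0<ρ : 0ℚ < ρ
    0<ρ = Real.*-pos (recip-pos (length I)) (Real.*-pos (toWitness {a? = 0ℚ ℚ.<? + 1 / 32} _) (recip-pos n))
    inverse : ΠQ.∑ I (geometric ∘ deg) * product≤ F n ≡ 1ℚ
    inverse = begin-equality
      ΠQ.∑ I (geometric ∘ deg) * product≤ F n                           ≡⟨ ≡.cong (ΠQ.∑ I (geometric ∘ deg) *_) (product≡∏ n) ⟩
      ΠQ.∑ I (geometric ∘ deg) * ΠQ.∑ I (λ p → 1ℚ - x ^ deg p)          ≡⟨ ΠQ.∑-+ I (geometric ∘ deg) (λ p → 1ℚ - x ^ deg p) ⟨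
      ΠQ.∑ I (λ p → geometric (deg p) * (1ℚ - x ^ deg p))               ≡⟨ ΠQ.∑-cong I (λ {p} p∈ → ≡.trans (ℚ.*-comm (geometric (deg p)) (1ℚ - x ^ deg p))
                                                                             (geometric-inverse (deg p) (irreducible-degree-≥1 n p∈))) ⟩
      ΠQ.∑ I (λ _ → 1ℚ)                                                 ≡⟨ ΠQ.∑-0 I ⟩
      1ℚ                                                                ∎
    sum : ΣQ.∑ I (λ p → b (deg p) + ρ) < harmonic n + half r
    sum = begin-strict
      ΣQ.∑ I (λ p → b (deg p) + ρ)                                      ≡⟨ ΣQ.∑-+ I (b ∘ deg) (λ _ → ρ) ⟩
      ΣQ.∑ I (b ∘ deg) + ΣQ.∑ I (λ _ → ρ)                               ≡⟨ ≡.cong₂ _+_ (∑-by-degree ℚ.+-0-commutativeMonoid n b) (≡.trans (ΣQ.∑-const I ρ) (·≡fromℕ-* (length I) ρ)) ⟩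
      ΣQ.∑ (upTo (suc n)) (λ d → π d ΣQ.· b d) + fromℕ (length I) * ρ   ≤⟨ ℚ.+-mono-≤ by-degree slack ⟩
      harmonic n + r * (+ 7 / 16) + + 1 / 32 * r                        ≡⟨ solve 2 (λ h r → h :+ r :* con (+ 7 / 16) :+ con (+ 1 / 32) :* r := h :+ con (+ 15 / 32) :* r) ≡.refl (harmonic n) r ⟩
      harmonic n + + 15 / 32 * r                                        <⟨ ℚ.+-monoʳ-< (harmonic n) (ℚ.*-monoˡ-<-pos r {{ℚ.positive (recip-pos n)}} (toWitness {a? = + 15 / 32 ℚ.<? ½} _)) ⟩
      harmonic n + half r                                               ∎
      where
      by-degree : ΣQ.∑ (upTo (suc n)) (λ d → π d ΣQ.· b d) ≤ harmonic n + r * (+ 7 / 16)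
      by-degree = ℚ.≤-trans (ℚ.≤-reflexive (ΣQ.∑-cong (upTo (suc n)) (λ {d} _ → ·≡fromℕ-* (π d) (b d))))
        (ℚ.≤-trans (total m) (ℚ.+-monoʳ-≤ (harmonic n) (*-monoˡ {tailBound x (recip q″) m} {+ 7 / 16} {r} (recip-nonNeg n) (tailBound-generic gen))))
      slack : fromℕ (length I) * ρ ≤ + 1 / 32 * r
      slack = slack′ (length I) (+ 1 / 32 * r) (Real.*-nonNeg (toWitness {a? = 0ℚ ℚ.≤? + 1 / 32} _) (recip-nonNeg n))
        where
        slack′ : ∀ L z → 0ℚ ≤ z → fromℕ L * (recip L * z) ≤ z
        slack′ L z 0≤z = begin
          fromℕ L * (recip L * z)          ≤⟨ *-monoʳ {fromℕ L} {fromℕ (suc L)} (Real.*-nonNeg (recip-nonNeg L) 0≤z) (fromℕ-mono (ℕ.n≤1+n L)) ⟩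
          fromℕ (suc L) * (recip L * z)    ≡⟨ ℚ.*-assoc (fromℕ (suc L)) (recip L) z ⟨
          fromℕ (suc L) * recip L * z      ≡⟨ ≡.cong (_* z) (fromℕ-recip L) ⟩
          1ℚ * z                           ≡⟨ ℚ.*-identityˡ z ⟩
          z                                ∎
    conclude : (∃[ y ] ΠQ.∑ I (geometric ∘ deg) ≤exp y × y ≤ ΣQ.∑ I (λ p → b (deg p) + ρ)) → Bound n (product≤ F n)
    conclude (y , c , y≤) = ≤exp⇒Bound n (product≤ F n)
      (∏-pos I (λ {p} p∈ → geometric-pos (deg p) (irreducible-degree-≥1 n p∈))) inverse c (ℚ.≤-<-trans y≤ sum)

  -- `π̂` is to be given by closed values, so that evaluation decides the inequality; `π` depends on
  -- the abstract field and does not compute.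
  exact-Bound : ∀ n (π̂ : ℕ → ℕ) → (∀ d → d ℕ.< suc n → π d ≡ π̂ d) →
               True (1ℚ ℚ.<? e^γ⁻ * fromℕ (suc n) * ΠQ.∑ (upTo (suc n)) (λ d → π̂ d ΠQ.· (1ℚ - x ^ d))) → Bound n (product≤ F n)
  exact-Bound n π̂ π≡ 1< = e^γ⇒Bound n (product≤ F n) (≡.subst (λ P → 1ℚ < e^γ⁻ * fromℕ (suc n) * P) (≡.sym (≡.trans (product-by-degree n)
    (ΠQ.∑-cong (upTo (suc n)) (λ {d} d∈ → ≡.cong (ΠQ._· (1ℚ - x ^ d)) (π≡ d (∈-upTo⁻ d∈)))))) (toWitness 1<))

-- Case distinction on q and n

module _ {c ℓ : Level} where

  open Reduction
  open SmallPrimeCounts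

  π̂₂ : ℕ → ℕ
  π̂₂ 0 = 0
  π̂₂ 2 = 1
  π̂₂ _ = 2

  π̂₃ : ℕ → ℕ
  π̂₃ 0 = 0
  π̂₃ _ = 3

  by-cases : ∀ q″ (F : FiniteField c ℓ (suc (suc q″))) m → ¬ (suc (suc q″) ≡ 2 × suc m ≡ 1) → Bound (suc m) (EulerProduct.product≤ F (suc m))
  by-cases zero    F zero ex = ⊥-elim (ex (≡.refl , ≡.refl))
  -- The exactly evaluated products are 3/16 for (q , n) = (2 , 2), 147/1024 for (2 , 3) and 8/27
  -- for (3 , 1). Times 1.778 (n + 1) each exceeds 1, the first only by 1/8000.
  by-cases zero    F 1 _ = exact-Bound 2 π̂₂
      (λ { 0 _ → ≡.refl ; 1 _ → π-1 ; 2 _ → π-2 count ; (suc (suc (suc _))) (s≤s (s≤s (s≤s ()))) })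
      _
    where
    open EulerProductBound F
    open PrimePolynomialTheorem F
  by-cases zero    F 2 _ = exact-Bound 3 π̂₂
      (λ { 0 _ → ≡.refl ; 1 _ → π-1 ; 2 _ → π-2 count ; 3 _ → π-3 count ; (suc (suc (suc (suc _)))) (s≤s (s≤s (s≤s (s≤s ())))) })
      _
    where
    open EulerProductBound F
    open PrimePolynomialTheorem F
  by-cases (suc zero) F zero _ = exact-Bound 1 π̂₃
      (λ { 0 _ → ≡.refl ; 1 _ → π-1 ; (suc (suc _)) (s≤s (s≤s ())) })
      _
    where
    open EulerProductBound F
    open PrimePolynomialTheorem F
  by-cases (suc (suc q)) F zero _ = EulerProductBound.generic-Bound F (n≡1 q)
    where open TailBound
  by-cases (suc q) F 1 _ = EulerProductBound.generic-Bound F (n≡2 q)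
    where open TailBound
  by-cases (suc q) F 2 _ = EulerProductBound.generic-Bound F (n≡3 q)
    where open TailBound
  by-cases q F (suc (suc (suc m))) _ = EulerProductBound.generic-Bound F (large-n q m)
    where open TailBound

open import Data.Nat.Base using (_≤_)
open EulerProduct using (product≤)
open Real using (γ; exp; fromℕ; fromℚ; _*ℝ_; _⁻¹⟨_⟩; _<ℝ_; expγ*suc-pos)

proposition3p4 : ∀ {c ℓ} (q : ℕ) → PrimePower q → (F : FiniteField c ℓ q) →
    (n : ℕ) → 1 ≤ n → ¬ (q ≡ 2 × n ≡ 1) →
    (exp γ *ℝ fromℚ (fromℕ (suc n))) ⁻¹⟨ expγ*suc-pos n ⟩ <ℝ fromℚ (product≤ F n)
-- A field has at least two elements: `Fin 0` cannot represent 0, and for q = 1 the elements 0 and 1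
-- would coincide.
proposition3p4 zero _ F n _ _ = ⊥-elim (Fin.¬Fin0 (Polynomials.to F (FiniteField.0# F)))
proposition3p4 (suc zero) _ F n _ _ = ⊥-elim (1≉0 (trans (sym (from∘to 1#)) (trans (reflexive (≡.cong from (Fin1-unique (to 1#) (to 0#)))) (from∘to 0#))))
  where
  open FiniteField F
  open Polynomials F
  Fin1-unique : ∀ (i j : Fin 1) → i ≡ j
  Fin1-unique Fin.zero Fin.zero = ≡.refl
proposition3p4 (suc (suc q)) _ F (suc m) _ exception = by-cases q F m exception
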